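{- Let $r\ge 1$, let $X$ be an $(r+1)$-partite $r$-dimensional simplicial complex on vertex set $V$, and let $1\le k\le f_{r-1}(X)$. Then \[ \sum_{i=1}^{k} \lambda_i(L_{r-1}^{+}(X)) \le \sum_{i=1}^k \left| \{v\in V:\, \deg^{(r)}_X(v)\ge i\}\right|. \]
   Context: A simplicial complex $X$ on a finite vertex set $V$ is a family of subsets of $V$ closed under inclusion; its elements are called simplices (or faces), $\dim(\sigma)=|\sigma|-1$ for $\sigma\in X$, and $\dim(X)$ is the maximal dimension of a simplex. $X(i)$ is the set of $i$-dimensional simplices (with $X(-1)=\{\emptyset\}$; $X(0)$ is identified with $V$) and $f_i(X)=|X(i)|$. For $\sigma\in X$ and $1\le r\le\dim(X)$, the $r$-degree $\deg_X^{(r)}(\sigma)$ is the number of $r$-dimensional simplices of $X$ containing $\sigma$; for a vertex $v$, $\deg_X^{(r)}(v)$ is the number of $r$-dimensional simplices containing $v$. An $r$-dimensional simplicial complex $X$ is $(r+1)$-partite if there is a partition $V_1,\ldots,V_{r+1}$ of $V$ such that $|\sigma\cap V_i|\le 1$ for every $\sigma\in X$ and $1\le i\le r+1$. Fix an arbitrary linear order $<$ on $V$. For $\sigma\in X(s-1)$, $\tau\in X(s)$ with $\sigma\subset\tau$ ($0\le s\le \dim(X)$), let $u$ be the unique vertex of $\tau\setminus\sigma$ and set $(\tau:\sigma)=(-1)^{|\{v\in\tau:\,v<u\}|}$. For $1\le r\le\dim(X)$, the upper Laplacian $L_{r-1}^+(X)\in\mathbb{R}^{f_{r-1}(X)\times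 f_{r-1}(X)}$ is the matrix indexed by $X(r-1)$ with $L_{r-1}^+(X)_{\tau,\tau}=\deg_X^{(r)}(\tau)$; $L_{r-1}^+(X)_{\tau,\eta}=-(\tau:\tau\cap\eta)(\eta:\tau\cap\eta)$ if $|\tau\cap\eta|=r-1$ and $\tau\cup\eta\in X$; and all other entries $0$. For a symmetric real matrix $M$, $\lambda_i(M)$ is its $i$-th largest eigenvalue (with multiplicity). -}

module Defs where

open import Algebra.Bundles using (RawRing)
import Algebra.Definitions.RawMonoid as RawMonoidDefs
import Algebra.Definitions.RawSemiring as RawSemiringDefs
open import Data.Bool.Base using (if_then_else_)
import Data.Bool.Properties as Bool
open import Data.Fin.Base as Fin using (Fin; zero; suc; toℕ; punchIn)
import Data.Fin.Properties as Fin
open import Data.Fin.Subset using (Subset; inside; outside; _∈_; _⊆_; _∩_; _∪_; _─_; ∣_∣; ⁅_⁆; ⊥)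
open import Data.Fin.Subset.Properties using (_∈?_; _⊆?_)
open import Data.Integer.Base as ℤ using (ℤ; +_; -1ℤ; 0ℤ)
open import Data.List.Base using (List; []; _∷_; _++_; map; filter; length; lookup; allFin)
open import Data.Nat.Base as ℕ using (ℕ; zero; suc)
import Data.Nat.Properties as ℕ
open import Data.Product.Base using (Σ-syntax; ∃-syntax; _×_; _,_)
open import Data.Product using (∃!)
open import Data.Rational.Base as ℚ using (ℚ; 0ℚ; 1ℚ; ½)
import Data.Rational.Properties as ℚ
open import Data.Rational.Solver using (module +-*-Solver)
open import Data.Vec.Base using ([]; _∷_)
import Data.Vec.Properties as Vec
open import Level using (0ℓ)
open import Relation.Binary.Core using (Rel)
open import Relation.Binary.PropositionalEquality
  using (_≡_; refl; sym; trans; cong; subst)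
open import Relation.Binary.Structures using (IsStrictTotalOrder)
open import Relation.Nullary.Decidable using (yes; no; does; _×-dec_)
open import Relation.Unary using (Pred; Decidable)

------------------------------------------------------------------------
-- Real numbers: Cauchy sequences of rationals with pointwise operations.
-- Equality of reals is _≈_ (the difference is a null sequence), not _≡_.

IsCauchy : (ℕ → ℚ) → Set
IsCauchy x = ∀ ε → 0ℚ ℚ.< ε →
  ∃[ N ] (∀ m n → N ℕ.≤ m → N ℕ.≤ n → ℚ.∣ x m ℚ.- x n ∣ ℚ.< ε)

record ℝ : Set where
  no-eta-equality
  field
    seq    : ℕ → ℚ
    cauchy : IsCauchy seq

open ℝ public

infix 4 _≈_ _≤_

record _≈_ (x y : ℝ) : Set where
  constructor mk≈
  field
    null : ∀ ε → 0ℚ ℚ.< ε →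
      ∃[ N ] (∀ n → N ℕ.≤ n → ℚ.∣ seq x n ℚ.- seq y n ∣ ℚ.< ε)

record _≤_ (x y : ℝ) : Set where
  constructor mk≤
  field
    bound : ∀ ε → 0ℚ ℚ.< ε →
      ∃[ N ] (∀ n → N ℕ.≤ n → seq x n ℚ.≤ seq y n ℚ.+ ε)

open +-*-Solver using (solve; _:=_; _:+_; _:*_; _:-_; :-_)

neg-sub : ∀ a b → ℚ.- (a ℚ.- b) ≡ ℚ.- a ℚ.- (ℚ.- b)
neg-sub = solve 2 (λ a b → :- (a :- b) := :- a :- (:- b)) refl

sub-add : ∀ a b → a ≡ (a ℚ.- b) ℚ.+ b
sub-add = solve 2 (λ a b → a := (a :- b) :+ b) refl

sub-+ : ∀ a b c d → (a ℚ.+ b) ℚ.- (c ℚ.+ d) ≡ (a ℚ.- c) ℚ.+ (b ℚ.- d)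
sub-+ = solve 4 (λ a b c d → (a :+ b) :- (c :+ d) := (a :- c) :+ (b :- d)) refl

sub-* : ∀ a b c d → a ℚ.* b ℚ.- c ℚ.* d ≡ a ℚ.* (b ℚ.- d) ℚ.+ d ℚ.* (a ℚ.- c)
sub-* = solve 4 (λ a b c d → a :* b :- c :* d := a :* (b :- d) :+ d :* (a :- c)) refl

*-swap : ∀ a b c → a ℚ.* (b ℚ.* c) ≡ b ℚ.* (a ℚ.* c)
*-swap = solve 3 (λ a b c → a :* (b :* c) := b :* (a :* c)) refl

half+half : ∀ ε → ε ℚ.* ½ ℚ.+ ε ℚ.* ½ ≡ ε
half+half ε = trans (sym (ℚ.*-distribˡ-+ ε ½ ½)) (ℚ.*-identityʳ ε)

half-pos : ∀ {ε} → 0ℚ ℚ.< ε → 0ℚ ℚ.< ε ℚ.* ½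
half-pos {ε} 0<ε = subst (ℚ._< ε ℚ.* ½) (ℚ.*-zeroˡ ½) (ℚ.*-monoˡ-<-pos ½ 0<ε)

const-cauchy : ∀ q → IsCauchy (λ _ → q)
const-cauchy q ε 0<ε =
  0 , λ _ _ _ _ → subst (ℚ._< ε) (sym (cong ℚ.∣_∣ (ℚ.+-inverseʳ q))) 0<ε

neg-cauchy : ∀ x → IsCauchy (λ n → ℚ.- seq x n)
neg-cauchy x ε 0<ε with cauchy x ε 0<ε
... | N , h = N , λ m n N≤m N≤n → subst (ℚ._< ε)
  (trans (sym (ℚ.∣-p∣≡∣p∣ (seq x m ℚ.- seq x n)))
    (cong ℚ.∣_∣ (neg-sub (seq x m) (seq x n))))
  (h m n N≤m N≤n)

+-cauchy : ∀ x y → IsCauchy (λ n → seq x n ℚ.+ seq y n)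
+-cauchy x y ε 0<ε with cauchy x (ε ℚ.* ½) (half-pos 0<ε) | cauchy y (ε ℚ.* ½) (half-pos 0<ε)
... | N₁ , h₁ | N₂ , h₂ = N₁ ℕ.⊔ N₂ , λ m n N≤m N≤n → begin-strict
    ℚ.∣ (seq x m ℚ.+ seq y m) ℚ.- (seq x n ℚ.+ seq y n) ∣
      ≡⟨ cong ℚ.∣_∣ (sub-+ (seq x m) (seq y m) (seq x n) (seq y n)) ⟩
    ℚ.∣ (seq x m ℚ.- seq x n) ℚ.+ (seq y m ℚ.- seq y n) ∣
      ≤⟨ ℚ.∣p+q∣≤∣p∣+∣q∣ (seq x m ℚ.- seq x n) (seq y m ℚ.- seq y n) ⟩
    ℚ.∣ seq x m ℚ.- seq x n ∣ ℚ.+ ℚ.∣ seq y m ℚ.- seq y n ∣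
      <⟨ ℚ.+-mono-<
           (h₁ m n (ℕ.≤-trans (ℕ.m≤m⊔n N₁ N₂) N≤m) (ℕ.≤-trans (ℕ.m≤m⊔n N₁ N₂) N≤n))
           (h₂ m n (ℕ.≤-trans (ℕ.m≤n⊔m N₁ N₂) N≤m) (ℕ.≤-trans (ℕ.m≤n⊔m N₁ N₂) N≤n)) ⟩
    ε ℚ.* ½ ℚ.+ ε ℚ.* ½
      ≡⟨ half+half ε ⟩
    ε ∎
  where open ℚ.≤-Reasoning

0<1 : 0ℚ ℚ.< 1ℚ
0<1 = ℚ.positive⁻¹ 1ℚ

eventually-bounded : ∀ x →
  Σ[ B ∈ ℚ ] (0ℚ ℚ.< B × ∃[ N ] (∀ n → N ℕ.≤ n → ℚ.∣ seq x n ∣ ℚ.≤ B))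
eventually-bounded x with cauchy x 1ℚ 0<1
... | N , h = 1ℚ ℚ.+ ℚ.∣ seq x N ∣
            , ℚ.+-mono-<-≤ 0<1 (ℚ.0≤∣p∣ (seq x N))
            , N , λ n N≤n → begin
    ℚ.∣ seq x n ∣
      ≡⟨ cong ℚ.∣_∣ (sub-add (seq x n) (seq x N)) ⟩
    ℚ.∣ (seq x n ℚ.- seq x N) ℚ.+ seq x N ∣
      ≤⟨ ℚ.∣p+q∣≤∣p∣+∣q∣ (seq x n ℚ.- seq x N) (seq x N) ⟩
    ℚ.∣ seq x n ℚ.- seq x N ∣ ℚ.+ ℚ.∣ seq x N ∣
      ≤⟨ ℚ.+-monoˡ-≤ ℚ.∣ seq x N ∣ (ℚ.<⇒≤ (h n N N≤n ℕ.≤-refl)) ⟩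
    1ℚ ℚ.+ ℚ.∣ seq x N ∣ ∎
  where open ℚ.≤-Reasoning

divide : ∀ {ε S} → 0ℚ ℚ.< ε → 0ℚ ℚ.< S → Σ[ δ ∈ ℚ ] (0ℚ ℚ.< δ × S ℚ.* δ ≡ ε)
divide {ε} {S} 0<ε 0<S = δ , 0<δ , Sδ≡ε
  where
  instance
    S-pos : ℚ.Positive S
    S-pos = ℚ.positive 0<S
    S-nonZero : ℚ.NonZero S
    S-nonZero = ℚ.pos⇒nonZero S
    1/S-pos : ℚ.Positive (ℚ.1/ S)
    1/S-pos = ℚ.1/pos⇒pos S
  δ : ℚ
  δ = ε ℚ.* ℚ.1/ S
  0<δ : 0ℚ ℚ.< δ
  0<δ = subst (ℚ._< δ) (ℚ.*-zeroˡ (ℚ.1/ S)) (ℚ.*-monoˡ-<-pos (ℚ.1/ S) 0<ε)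
  Sδ≡ε : S ℚ.* δ ≡ ε
  Sδ≡ε = trans (*-swap S ε (ℚ.1/ S))
           (trans (cong (ε ℚ.*_) (ℚ.*-inverseʳ S)) (ℚ.*-identityʳ ε))

+-pos : ∀ p q → 0ℚ ℚ.< p → 0ℚ ℚ.< q → 0ℚ ℚ.< p ℚ.+ q
+-pos p q 0<p 0<q = ℚ.+-mono-< 0<p 0<q

*-bound : ∀ p q {B δ} → ℚ.∣ p ∣ ℚ.≤ B → 0ℚ ℚ.< B → ℚ.∣ q ∣ ℚ.< δ → ℚ.∣ p ℚ.* q ∣ ℚ.< B ℚ.* δ
*-bound p q {B} {δ} p≤B 0<B q<δ = begin-strict
    ℚ.∣ p ℚ.* q ∣
      ≡⟨ ℚ.∣p*q∣≡∣p∣*∣q∣ p q ⟩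
    ℚ.∣ p ∣ ℚ.* ℚ.∣ q ∣
      ≤⟨ ℚ.*-monoʳ-≤-nonNeg ℚ.∣ q ∣ {{ℚ.nonNegative (ℚ.0≤∣p∣ q)}} p≤B ⟩
    B ℚ.* ℚ.∣ q ∣
      <⟨ ℚ.*-monoʳ-<-pos B {{ℚ.positive 0<B}} q<δ ⟩
    B ℚ.* δ ∎
  where open ℚ.≤-Reasoning

*-near : ∀ a b c d {B C δ ε} → 0ℚ ℚ.< B → 0ℚ ℚ.< C → (B ℚ.+ C) ℚ.* δ ≡ ε →
  ℚ.∣ a ∣ ℚ.≤ B → ℚ.∣ d ∣ ℚ.≤ C → ℚ.∣ b ℚ.- d ∣ ℚ.< δ → ℚ.∣ a ℚ.- c ∣ ℚ.< δ →
  ℚ.∣ a ℚ.* b ℚ.- c ℚ.* d ∣ ℚ.< ε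
*-near a b c d {B} {C} {δ} {ε} 0<B 0<C Sδ≡ε a≤B d≤C bd<δ ac<δ = begin-strict
    ℚ.∣ a ℚ.* b ℚ.- c ℚ.* d ∣
      ≡⟨ cong ℚ.∣_∣ (sub-* a b c d) ⟩
    ℚ.∣ a ℚ.* (b ℚ.- d) ℚ.+ d ℚ.* (a ℚ.- c) ∣
      ≤⟨ ℚ.∣p+q∣≤∣p∣+∣q∣ (a ℚ.* (b ℚ.- d)) (d ℚ.* (a ℚ.- c)) ⟩
    ℚ.∣ a ℚ.* (b ℚ.- d) ∣ ℚ.+ ℚ.∣ d ℚ.* (a ℚ.- c) ∣
      <⟨ ℚ.+-mono-< (*-bound a (b ℚ.- d) a≤B 0<B bd<δ) (*-bound d (a ℚ.- c) d≤C 0<C ac<δ) ⟩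
    B ℚ.* δ ℚ.+ C ℚ.* δ
      ≡⟨ sym (ℚ.*-distribʳ-+ δ B C) ⟩
    (B ℚ.+ C) ℚ.* δ
      ≡⟨ Sδ≡ε ⟩
    ε ∎
  where open ℚ.≤-Reasoning

*-cauchy : ∀ x y → IsCauchy (λ n → seq x n ℚ.* seq y n)
*-cauchy x y ε 0<ε =
  let B , 0<B , N₁ , b = eventually-bounded x
      C , 0<C , N₂ , c = eventually-bounded y
      δ , 0<δ , Sδ≡ε   = divide 0<ε (+-pos B C 0<B 0<C)
      N₃ , h₃          = cauchy x δ 0<δ
      N₄ , h₄          = cauchy y δ 0<δ
      from₁ : ∀ {k} → (N₁ ℕ.⊔ N₂) ℕ.⊔ (N₃ ℕ.⊔ N₄) ℕ.≤ k → N₁ ℕ.≤ k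
      from₁ = λ p → ℕ.m⊔n≤o⇒m≤o N₁ N₂ (ℕ.m⊔n≤o⇒m≤o (N₁ ℕ.⊔ N₂) (N₃ ℕ.⊔ N₄) p)
      from₂ : ∀ {k} → (N₁ ℕ.⊔ N₂) ℕ.⊔ (N₃ ℕ.⊔ N₄) ℕ.≤ k → N₂ ℕ.≤ k
      from₂ = λ p → ℕ.m⊔n≤o⇒n≤o N₁ N₂ (ℕ.m⊔n≤o⇒m≤o (N₁ ℕ.⊔ N₂) (N₃ ℕ.⊔ N₄) p)
      from₃ : ∀ {k} → (N₁ ℕ.⊔ N₂) ℕ.⊔ (N₃ ℕ.⊔ N₄) ℕ.≤ k → N₃ ℕ.≤ k
      from₃ = λ p → ℕ.m⊔n≤o⇒m≤o N₃ N₄ (ℕ.m⊔n≤o⇒n≤o (N₁ ℕ.⊔ N₂) (N₃ ℕ.⊔ N₄) p)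
      from₄ : ∀ {k} → (N₁ ℕ.⊔ N₂) ℕ.⊔ (N₃ ℕ.⊔ N₄) ℕ.≤ k → N₄ ℕ.≤ k
      from₄ = λ p → ℕ.m⊔n≤o⇒n≤o N₃ N₄ (ℕ.m⊔n≤o⇒n≤o (N₁ ℕ.⊔ N₂) (N₃ ℕ.⊔ N₄) p)
  in (N₁ ℕ.⊔ N₂) ℕ.⊔ (N₃ ℕ.⊔ N₄) , λ m n N≤m N≤n →
     *-near (seq x m) (seq y m) (seq x n) (seq y n) 0<B 0<C Sδ≡ε
       (b m (from₁ N≤m)) (c n (from₂ N≤n))
       (h₄ m n (from₄ N≤m) (from₄ N≤n)) (h₃ m n (from₃ N≤m) (from₃ N≤n))

infix  8 -ᴿ_
infixl 7 _*ᴿ_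
infixl 6 _+ᴿ_

_+ᴿ_ : ℝ → ℝ → ℝ
seq    (x +ᴿ y) n = seq x n ℚ.+ seq y n
cauchy (x +ᴿ y)   = +-cauchy x y

_*ᴿ_ : ℝ → ℝ → ℝ
seq    (x *ᴿ y) n = seq x n ℚ.* seq y n
cauchy (x *ᴿ y)   = *-cauchy x y

-ᴿ_ : ℝ → ℝ
seq    (-ᴿ x) n = ℚ.- seq x n
cauchy (-ᴿ x)   = neg-cauchy x

fromℚ : ℚ → ℝ
seq    (fromℚ q) _ = q
cauchy (fromℚ q)   = const-cauchy q

fromℤ : ℤ → ℝ
fromℤ i = fromℚ (i ℚ./ 1)

fromℕ : ℕ → ℝ
fromℕ n = fromℤ (+ n)

ℝ-rawRing : RawRing 0ℓ 0ℓ
ℝ-rawRing = record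
  { Carrier = ℝ
  ; _≈_     = _≈_
  ; _+_     = _+ᴿ_
  ; _*_     = _*ᴿ_
  ; -_      = -ᴿ_
  ; 0#      = fromℚ 0ℚ
  ; 1#      = fromℚ 1ℚ
  }

------------------------------------------------------------------------
-- Matrices and eigenvalues

Matrix : Set → ℕ → Set
Matrix A n = Fin n → Fin n → A

module LinearAlgebra (R : RawRing 0ℓ 0ℓ) where
  open RawRing R hiding (_≈_)
  open RawSemiringDefs rawSemiring using (_^_)
  open RawMonoidDefs +-rawMonoid public using () renaming (sum to ∑)
  open RawMonoidDefs *-rawMonoid public using () renaming (sum to ∏)

  -- Laplace expansion along the first row.
  det : ∀ {n} → Matrix Carrier n → Carrier
  det {zero}  M = 1#
  det {suc n} M =
    ∑ λ j → (- 1#) ^ toℕ j * (M zero j * det (λ i k → M (suc i) (punchIn j k)))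

  charPoly : ∀ {n} → Matrix Carrier n → Carrier → Carrier
  charPoly M x = det (λ i j → (if does (i Fin.≟ j) then x else 0#) + - M i j)

open LinearAlgebra ℝ-rawRing public using (∑; ∏; det; charPoly)

-- μ lists the eigenvalues of M with multiplicity in non-increasing order, so
-- that μ i is the (i+1)-th largest one.  Over the infinite field ℝ the
-- polynomial identity det (x I - M) = ∏ (x - μᵢ) is the same as its validity
-- at every real x.
record IsEigenvalueList {n} (M : Matrix ℝ n) (μ : Fin n → ℝ) : Set where
  field
    nonincreasing : ∀ i j → i Fin.≤ j → μ j ≤ μ i
    characteristic : ∀ x → charPoly M x ≈ ∏ (λ i → x +ᴿ -ᴿ μ i)

------------------------------------------------------------------------
-- Simplicial complexes

-- The identification of X(0) with the vertex set is the field `vertex`.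
record SimplicialComplex (n : ℕ) : Set₁ where
  field
    Face   : Pred (Subset n) 0ℓ
    face?  : Decidable Face
    closed : ∀ {σ τ} → σ ⊆ τ → Face τ → Face σ
    empty  : Face ⊥
    vertex : ∀ v → Face ⁅ v ⁆

-- Every subset, exactly once.
subsets : ∀ n → List (Subset n)
subsets zero    = [] ∷ []
subsets (suc n) = map (outside ∷_) (subsets n) ++ map (inside ∷_) (subsets n)

count : ∀ {n} {P : Pred (Fin n) 0ℓ} → Decidable P → ℕ
count {n} P? = length (filter P? (allFin n))

module _ {n : ℕ} (X : SimplicialComplex n) where
  open SimplicialComplex X

  -- Simplices are indexed by their number of vertices: `simplices m` is
  -- X(m - 1) and `f m` is f_{m-1}(X), which includes X(-1) without truncation.
  simplices : ℕ → List (Subset n)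
  simplices m = filter (λ σ → face? σ ×-dec (∣ σ ∣ ℕ.≟ m)) (subsets n)

  f : ℕ → ℕ
  f m = length (simplices m)

  HasDimension : ℕ → Set
  HasDimension r = (∃[ σ ] (Face σ × ∣ σ ∣ ≡ suc r)) × (∀ {σ} → Face σ → ∣ σ ∣ ℕ.≤ suc r)

  Partite : ℕ → Set
  Partite p = Σ[ V ∈ (Fin p → Subset n) ]
    (∀ v → ∃! _≡_ λ i → v ∈ V i) ×
    (∀ {σ} → Face σ → ∀ i → ∣ σ ∩ V i ∣ ℕ.≤ 1)

  -- The r-degree; r-dimensional simplices have r + 1 vertices.
  deg : ℕ → Subset n → ℕ
  deg r σ = length (filter (σ ⊆?_) (simplices (suc r)))

  degᵛ : ℕ → Fin n → ℕ
  degᵛ r v = deg r ⁅ v ⁆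

  module Laplacian {_≺_ : Rel (Fin n) 0ℓ} (≺-isStrictTotalOrder : IsStrictTotalOrder _≡_ _≺_) where
    open IsStrictTotalOrder ≺-isStrictTotalOrder using () renaming (_<?_ to _≺?_)

    -- (τ : σ) = (-1)^|{v ∈ τ : v ≺ u}| where τ ─ σ = ⁅ u ⁆.  It is only ever
    -- used when τ ─ σ is such a singleton, where "v ≺ u" is the same as
    -- "v ≺ w for some w ∈ τ ─ σ".
    incidence : Subset n → Subset n → ℤ
    incidence τ σ = -1ℤ ℤ.^ count λ v →
      (v ∈? τ) ×-dec Fin.any? (λ w → (w ∈? (τ ─ σ)) ×-dec (v ≺? w))

    upperEntry : ℕ → Subset n → Subset n → ℤ
    upperEntry r τ η with Vec.≡-dec Bool._≟_ τ η
    ... | yes _ = + deg r τ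
    ... | no  _ with (suc ∣ τ ∩ η ∣ ℕ.≟ r) ×-dec face? (τ ∪ η)
    ...   | yes _ = ℤ.- (incidence τ (τ ∩ η) ℤ.* incidence η (τ ∩ η))
    ...   | no  _ = 0ℤ

    -- The matrix L⁺_{r-1}(X), with rows and columns indexed by X(r - 1).
    L⁺ : (r : ℕ) → Matrix ℝ (f r)
    L⁺ r i j = fromℤ (upperEntry r (lookup (simplices r) i) (lookup (simplices r) j))

-- Write L = BBᵀ for the signed incidence matrix B of X(r-1) against X(r), and
-- K = BᵀB.  Call a vertex high if its degree is at least k, let T be the number
-- of high vertices, and let t(τ) and q(τ) count the r-simplices τ ∪ {v} with v
-- high and not high.  If 0 ≤ V ≤ I, then every row b of B satisfies
-- ⟨b,Vb⟩ ≤ t(τ) s(τ) + q(τ), where s(τ) is the sum of V over the diagonal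
-- entries in the support of b.  A vertex v extends at most one facet of a given
-- r-simplex, namely the one that misses the colour of v, so summing over τ gives
-- tr V(K - T) ≤ Σ q.  Since kT + Σ q ≤ Σ_v min (k, deg v) = Σ_{i ≤ k} |{v : deg v ≥ i}|,
-- it remains to let V approach the spectral projection of K to [T, ∞).
--
-- No spectral theorem is needed for this: V is an iterate of the polynomial
-- 6x⁵ - 15x⁴ + 10x³ at an affine function of K, and tr p(L) = Σ p(μᵢ) for every
-- polynomial p.  The latter follows by taking logarithmic derivatives in
-- det (I - zA) = ∏ (1 - μᵢ z) as power series in z.

module Submission where

open import Defs using (Matrix; module LinearAlgebra; divide; 0<1)
open import Algebra.Bundles using (CommutativeRing; RawRing; Semiring)
import Algebra.Definitions.RawSemiring
import Algebra.Properties.CommutativeMonoid.Mult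
import Algebra.Properties.Ring
import Algebra.Properties.Semiring.Mult
import Algebra.Properties.Semiring.Sum
import Algebra.Solver.Ring.NaturalCoefficients.Default
open import Data.Bool.Base using (true; false; if_then_else_)
import Data.Bool.Properties as Bool
open import Data.Empty using (⊥-elim)
open import Data.Fin.Base using (Fin; zero; suc; toℕ; punchIn; inject≤)
import Data.Fin.Properties as Fin
open import Data.Fin.Subset using (Subset; inside; outside; _∈_; _∉_; _⊆_; _∩_; _∪_; _─_; ∣_∣; ⁅_⁆)
open import Data.Fin.Subset.Properties
open import Data.Integer.Base as ℤ using (ℤ; -1ℤ; 1ℤ)
import Data.Integer.Properties as ℤ
open import Data.List.Base using (List; []; _∷_; map; filter; length; lookup; replicate; tabulate)
open import Data.List.Membership.Propositional using () renaming (_∈_ to _∈ₗ_)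
open import Data.List.Membership.Propositional.Properties
  using (∈-filter⁺; ∈-filter⁻; ∈-lookup; ∈-++⁺ˡ; ∈-++⁺ʳ; ∈-map⁺; ∈-map⁻)
open import Data.List.Relation.Unary.All as All using (All; []; _∷_)
import Data.List.Relation.Unary.Any as Any
open import Data.List.Relation.Unary.Any.Properties using (lookup-index)
open import Data.List.Relation.Unary.AllPairs using ([]; _∷_)
open import Data.List.Relation.Unary.Unique.Propositional using (Unique)
import Data.List.Relation.Unary.Unique.Propositional.Properties as Unique
open import Data.Nat.Base as ℕ using (ℕ; zero; suc; s≤s; s≤s⁻¹; z≤n)
import Data.Nat.Properties as ℕ
open import Data.Nat.Properties using (_≤?_)
open import Data.Product.Base using (_,_; proj₁; proj₂; ∃-syntax; _×_; Σ-syntax)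
open import Data.Rational.Base as ℚ using (ℚ; 0ℚ; 1ℚ; ½)
open import Data.Rational.Literals using (fromℤ)
import Data.Rational.Properties as ℚ
open import Data.Rational.Solver using (module +-*-Solver)
open import Data.Sum.Base as Sum using (_⊎_; inj₁; inj₂)
open import Data.Vec.Base using ([]; _∷_; here; there)
open import Data.Vec.Functional using (Vector; updateAt)
open import Data.Vec.Functional.Properties using (updateAt-updates; updateAt-minimal)
import Data.Vec.Properties as Vec
open import Function.Base using (_∘_; const; id)
open import Level using (0ℓ)
open import Relation.Binary.Core using (Rel)
open import Relation.Binary.Definitions using (tri<; tri≈; tri>)
open import Relation.Binary.PropositionalEquality as ≡ using (_≡_; _≢_; _≗_)
import Relation.Binary.Reasoning.Setoid
open import Relation.Binary.Structures using (IsStrictTotalOrder)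
open import Relation.Nullary using (Dec; ¬_)
open import Relation.Nullary.Decidable using (yes; no; does; _×-dec_)
open import Relation.Nullary.Negation using (contradiction)
open import Relation.Unary using (Pred; Decidable)

-- The Laplacian has integer entries, so the operators live over `ℚ` and real numbers enter only
-- through `μ`. Order and equality of Cauchy reals are not decidable; every bound that is needed at
-- an eigenvalue is therefore proved at all rationals and used at the approximations `seq (μ i) s`.
--
-- The smoothstep polynomial f has two properties that survive the substitution of an operator.
-- Since 6v² - 15v + 10 = 6 (v - 5/4)² + 5/8, f(v) is a sum of positive multiples of products p v p
-- with p a polynomial in v, so f preserves V ≥ 0. Since f(v) + f(1 - v) = 1, it preserves I - V ≥ 0
-- as well. Within the unit interval its iterates push values away from ½ towards 0 and 1.
--
-- The eigenvalues belong to L = BBᵀ, while the estimate concerns K = BᵀB. The traces of p(L) and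
-- p(K) differ by p(0) times the difference of the two sizes. The polynomial that replaces max (x -
-- T) 0 takes a value between -ε and 0 at x = 0, so passing from K to L costs at most a multiple of
-- ε.

-- Finite sums in a commutative ring

-- Opaque, so that the unifier can read off the summand.
module Summation (R : CommutativeRing 0ℓ 0ℓ) where
  open CommutativeRing R hiding (zero)
  private module S = Algebra.Properties.Semiring.Sum semiring
  open Algebra.Properties.Ring ring using (-1*x≈-x)

  infixl 10 ∑-syntax

  opaque
    ∑ : ∀ {n} → (Fin n → Carrier) → Carrier
    ∑ = S.sum

  ∑-syntax : ∀ n → (Fin n → Carrier) → Carrier
  ∑-syntax n = ∑ {n}

  syntax ∑-syntax n (λ i → x) = ∑[ i < n ] x

  opaque
    unfolding ∑

    ∑≡sum : ∀ {n} (f : Fin n → Carrier) → ∑ f ≡ S.sum f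
    ∑≡sum f = ≡.refl

    ∑-zero : (f : Fin 0 → Carrier) → ∑ f ≈ 0#
    ∑-zero f = refl

    ∑-suc : ∀ {n} (f : Fin (suc n) → Carrier) → ∑ f ≈ f zero + ∑ (f ∘ suc)
    ∑-suc f = refl

    ∑-cong : ∀ {n} {f g : Fin n → Carrier} → (∀ i → f i ≈ g i) → ∑ f ≈ ∑ g
    ∑-cong = S.sum-cong-≋

    ∑-0 : ∀ {n} {f : Fin n → Carrier} → (∀ i → f i ≈ 0#) → ∑ f ≈ 0#
    ∑-0 {n} f≈0 = trans (S.sum-cong-≋ f≈0) (S.sum-replicate-zero n)

    ∑-+ : ∀ {n} (f g : Fin n → Carrier) → ∑ (λ i → f i + g i) ≈ ∑ f + ∑ g
    ∑-+ = S.∑-distrib-+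

    ∑-comm : ∀ {m n} (f : Fin m → Fin n → Carrier) → ∑[ i < m ] ∑[ j < n ] f i j ≈ ∑[ j < n ] ∑[ i < m ] f i j
    ∑-comm = S.∑-comm

    ∑-distribˡ : ∀ {n} x (f : Fin n → Carrier) → x * ∑ f ≈ ∑ (λ i → x * f i)
    ∑-distribˡ = S.*-distribˡ-sum

    ∑-distribʳ : ∀ {n} x (f : Fin n → Carrier) → ∑ f * x ≈ ∑ (λ i → f i * x)
    ∑-distribʳ = S.*-distribʳ-sum

  ∑-neg : ∀ {n} (f : Fin n → Carrier) → ∑ (λ i → - f i) ≈ - ∑ f
  ∑-neg f = trans (∑-cong λ i → sym (-1*x≈-x (f i))) (trans (sym (∑-distribˡ (- 1#) f)) (-1*x≈-x (∑ f)))

  ∑-single : ∀ {n} (f : Fin n → Carrier) i → (∀ l → l ≢ i → f l ≈ 0#) → ∑ f ≈ f i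
  ∑-single f zero    f≈0 = trans (∑-suc f) (trans (+-congˡ (∑-0 λ l → f≈0 (suc l) λ ())) (+-identityʳ _))
  ∑-single f (suc i) f≈0 = trans (∑-suc f) (trans
    (+-cong (f≈0 zero λ ()) (∑-single (f ∘ suc) i λ l l≢i → f≈0 (suc l) (l≢i ∘ Fin.suc-injective)))
    (+-identityˡ _))

infixl 6 _[_]≔_

_[_]≔_ : ∀ {A : Set} {n} → Vector A n → Fin n → A → Vector A n
xs [ i ]≔ x = updateAt xs i (const x)

map-[]≔ : ∀ {A B : Set} {n} (g : A → B) (xs : Vector A n) i x → g ∘ (xs [ i ]≔ x) ≗ (g ∘ xs) [ i ]≔ g x
map-[]≔ g xs zero    x zero    = ≡.refl
map-[]≔ g xs zero    x (suc l) = ≡.refl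
map-[]≔ g xs (suc i) x zero    = ≡.refl
map-[]≔ g xs (suc i) x (suc l) = map-[]≔ g (xs ∘ suc) i x l

-- Determinants: multilinearity, alternation and derivations

module Determinant (R : CommutativeRing 0ℓ 0ℓ) where
  open CommutativeRing R hiding (zero)
  private module L = LinearAlgebra rawRing
  open Summation R
  open Algebra.Properties.Ring ring using (-‿distribˡ-*; -‿distribʳ-*; -1*x≈-x; -0#≈0#; +-inverseˡ-unique; x+x≈x⇒x≈0)
  open Algebra.Definitions.RawSemiring (Semiring.rawSemiring semiring) using (_^_)
  open Algebra.Solver.Ring.NaturalCoefficients.Default commutativeSemiring
    using (solve; _:=_; _:*_; _:+_)
  open Relation.Binary.Reasoning.Setoid setoid

  opaque
    sgn : ∀ {n} → Fin n → Carrier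
    sgn j = (- 1#) ^ toℕ j

    sgn-zero : ∀ {n} → sgn {suc n} zero ≈ 1#
    sgn-zero = refl

    sgn-suc : ∀ {n} (j : Fin n) → sgn (suc j) ≈ - sgn j
    sgn-suc j = -1*x≈-x (sgn j)

    det : ∀ {n} → Matrix Carrier n → Carrier
    det = L.det

  minor : ∀ {n} → Matrix Carrier (suc n) → Fin (suc n) → Matrix Carrier n
  minor T j i k = T (suc i) (punchIn j k)

  opaque
    unfolding det ∑

    det≡ : ∀ {n} (T : Matrix Carrier n) → det T ≡ L.det T
    det≡ T = ≡.refl

    det-zero : (T : Matrix Carrier 0) → det T ≈ 1#
    det-zero T = refl

    det-suc : ∀ {n} (T : Matrix Carrier (suc n)) → det T ≈ ∑[ j < suc n ] (sgn j * T zero j * det (minor T j))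
    det-suc T = ∑-cong λ j → sym (*-assoc (sgn j) (T zero j) (det (minor T j)))

  det-cong : ∀ {n} {S T : Matrix Carrier n} → (∀ i j → S i j ≈ T i j) → det S ≈ det T
  det-cong {zero}  {S} {T} S≈T = trans (det-zero S) (sym (det-zero T))
  det-cong {suc n} {S} {T} S≈T = trans (det-suc S) (trans
    (∑-cong λ j → *-cong (*-congˡ (S≈T zero j)) (det-cong λ i k → S≈T (suc i) (punchIn j k)))
    (sym (det-suc T)))

  ≡⇒≈ : ∀ {n} {S T : Fin n → Carrier} → S ≡ T → ∀ k → S k ≈ T k
  ≡⇒≈ ≡.refl k = refl

  -- A minor along row 0 keeps the replaced row, restricted to the remaining columns; this lets
  -- inductions on the Laplace expansion pass below the first row.
  minor-[]≔ : ∀ {n} (T : Matrix Carrier (suc n)) i r j →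
    det (minor (T [ suc i ]≔ r) j) ≈ det (minor T j [ i ]≔ (r ∘ punchIn j))
  minor-[]≔ T i r j = det-cong λ l → ≡⇒≈ (map-[]≔ (_∘ punchIn j) (T ∘ suc) i r l)

  -- Row 0 enters the Laplace expansion linearly, and any other row is a row of every minor.
  det-linear : ∀ {n m} (T : Matrix Carrier n) i (c : Fin m → Carrier) (r : Fin m → Fin n → Carrier) →
    det (T [ i ]≔ λ k → ∑[ l < m ] (c l * r l k)) ≈ ∑[ l < m ] (c l * det (T [ i ]≔ r l))
  det-linear {suc n} {m} T i c r = begin
    det (T [ i ]≔ λ k → ∑[ l < m ] (c l * r l k))
      ≈⟨ trans (det-suc (T [ i ]≔ λ k → ∑[ l < m ] (c l * r l k))) (∑-cong (term i)) ⟩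
    ∑[ j < suc n ] ∑[ l < m ] (c l * t i j l)
      ≈⟨ ∑-comm (λ j l → c l * t i j l) ⟩
    ∑[ l < m ] ∑[ j < suc n ] (c l * t i j l)
      ≈⟨ ∑-cong (λ l → trans (*-congˡ (det-suc (T [ i ]≔ r l))) (∑-distribˡ (c l) (λ j → t i j l))) ⟨
    ∑[ l < m ] (c l * det (T [ i ]≔ r l)) ∎
    where
    t : Fin (suc n) → Fin (suc n) → Fin m → Carrier
    t i j l = sgn j * (T [ i ]≔ r l) zero j * det (minor (T [ i ]≔ r l) j)

    u : Fin (suc n) → Fin n → Carrier
    u i = λ k → ∑[ l < m ] (c l * r l (punchIn i k))

    term : ∀ i j → sgn j * (T [ i ]≔ λ k → ∑[ l < m ] (c l * r l k)) zero j *
                   det (minor (T [ i ]≔ λ k → ∑[ l < m ] (c l * r l k)) j)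
                   ≈ ∑[ l < m ] (c l * t i j l)
    term zero j = begin
      sgn j * ∑[ l < m ] (c l * r l j) * d
        ≈⟨ solve 3 (λ s x d → s :* x :* d := s :* d :* x) refl (sgn j) _ d ⟩
      sgn j * d * ∑[ l < m ] (c l * r l j)
        ≈⟨ ∑-distribˡ (sgn j * d) (λ l → c l * r l j) ⟩
      ∑[ l < m ] (sgn j * d * (c l * r l j))
        ≈⟨ ∑-cong (λ l → solve 4 (λ s c r d → s :* d :* (c :* r) := c :* (s :* r :* d)) refl (sgn j) (c l)
          (r l j) d) ⟩
      ∑[ l < m ] (c l * t zero j l) ∎
      where d = det (minor T j)
    term (suc i) j = begin
      s * det (minor (T [ suc i ]≔ λ k → ∑[ l < m ] (c l * r l k)) j)
        ≈⟨ *-congˡ (minor-[]≔ T i _ j) ⟩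
      s * det (minor T j [ i ]≔ u j)
        ≈⟨ *-congˡ (det-linear (minor T j) i c (λ l → r l ∘ punchIn j)) ⟩
      s * ∑[ l < m ] (c l * det (minor T j [ i ]≔ (r l ∘ punchIn j)))
        ≈⟨ ∑-distribˡ s (λ l → c l * det (minor T j [ i ]≔ (r l ∘ punchIn j))) ⟩
      ∑[ l < m ] (s * (c l * det (minor T j [ i ]≔ (r l ∘ punchIn j))))
        ≈⟨ ∑-cong (λ l → trans (solve 3 (λ s c d → s :* (c :* d) := c :* (s :* d)) refl s (c l) _)
              (*-congˡ (*-congˡ (sym (minor-[]≔ T i (r l) j))))) ⟩
      ∑[ l < m ] (c l * t (suc i) j l) ∎
      where s = sgn j * T zero j

  det-scale : ∀ {n} x (T : Matrix Carrier n) → det (λ i j → x * T i j) ≈ x ^ n * det T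
  det-scale {zero}  x T = trans (det-zero _) (sym (trans (*-identityˡ _) (det-zero T)))
  det-scale {suc n} x T = begin
    det (λ i j → x * T i j)
      ≈⟨ det-suc (λ i j → x * T i j) ⟩
    ∑[ j < suc n ] (sgn j * (x * T zero j) * det (λ i k → x * minor T j i k))
      ≈⟨ ∑-cong (λ j → trans (*-congˡ (det-scale x (minor T j)))
           (solve 5 (λ s x t y d → s :* (x :* t) :* (y :* d) := x :* y :* (s :* t :* d)) refl
             (sgn j) x (T zero j) (x ^ n) (det (minor T j)))) ⟩
    ∑[ j < suc n ] (x ^ suc n * (sgn j * T zero j * det (minor T j)))
      ≈⟨ ∑-distribˡ (x ^ suc n) (λ j → sgn j * T zero j * det (minor T j)) ⟨
    x ^ suc n * ∑[ j < suc n ] (sgn j * T zero j * det (minor T j))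
      ≈⟨ *-congˡ (det-suc T) ⟨
    x ^ suc n * det T ∎

  -- In the double Laplace expansion of a determinant whose first two rows are
  -- both t, the terms of the column pairs (0 , k) and (k , 0) cancel; the
  -- other pairs form the same expression for the tail of t.
  double-expansion : ∀ m (t : Fin (suc (suc m)) → Carrier) (F : (Fin m → Fin (suc (suc m))) → Carrier) →
    (∀ {c c′} → c ≗ c′ → F c ≈ F c′) →
    ∑[ j < suc (suc m) ] (sgn j * t j *
      ∑[ k < suc m ] (sgn k * t (punchIn j k) * F (punchIn j ∘ punchIn k))) ≈ 0#
  double-expansion m t F F-cong = begin
    _
      ≈⟨ ∑-suc _ ⟩
    sgn zero * t zero * ∑ b + ∑[ j < suc m ] (sgn (suc j) * t (suc j) * ∑[ k < suc m ]
      (sgn k * t (punchIn (suc j) k) * F (punchIn (suc j) ∘ punchIn k)))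
      ≈⟨ +-cong first (∑-cong split) ⟩
    ∑ (λ j → t zero * b j) + ∑[ j < suc m ] (- (t zero * b j) + - (sgn j * t (suc j) * c j))
      ≈⟨ +-congˡ (∑-+ (λ j → - (t zero * b j)) _) ⟩
    ∑ (λ j → t zero * b j) + (∑ (λ j → - (t zero * b j)) + ∑[ j < suc m ] (- (sgn j * t (suc j) * c j)))
      ≈⟨ +-assoc _ _ _ ⟨
    ∑ (λ j → t zero * b j) + ∑ (λ j → - (t zero * b j)) + ∑[ j < suc m ] (- (sgn j * t (suc j) * c j))
      ≈⟨ +-cong (trans (+-congˡ (∑-neg _)) (-‿inverseʳ _)) (trans (∑-neg _) (-‿cong (rest m t F F-cong))) ⟩
    0# + - 0#
      ≈⟨ trans (+-identityˡ _) -0#≈0# ⟩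
    0# ∎
    where
    b : Fin (suc m) → Carrier
    b k = sgn k * t (suc k) * F (suc ∘ punchIn k)

    c : Fin (suc m) → Carrier
    c j = ∑[ k < m ] (sgn (suc k) * t (punchIn (suc j) (suc k)) * F (punchIn (suc j) ∘ punchIn (suc k)))

    first : sgn (zero {suc m}) * t zero * ∑ b ≈ ∑ (λ j → t zero * b j)
    first = trans (*-congʳ (trans (*-congʳ sgn-zero) (*-identityˡ _))) (∑-distribˡ (t zero) b)

    split : ∀ j → sgn (suc j) * t (suc j) * ∑[ k < suc m ]
                    (sgn k * t (punchIn (suc j) k) * F (punchIn (suc j) ∘ punchIn k)) ≈
                  - (t zero * b j) + - (sgn j * t (suc j) * c j)
    split j = begin
      sgn (suc j) * t (suc j) * _
        ≈⟨ *-cong (trans (*-congʳ (sgn-suc j)) (sym (-‿distribˡ-* _ _)))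
             (trans (∑-suc _) (+-congʳ (*-congʳ (trans (*-congʳ sgn-zero) (*-identityˡ _))))) ⟩
      - (sgn j * t (suc j)) * (t zero * F (suc ∘ punchIn j) + c j)
        ≈⟨ distribˡ _ _ _ ⟩
      - (sgn j * t (suc j)) * (t zero * F (suc ∘ punchIn j)) + - (sgn j * t (suc j)) * c j
        ≈⟨ +-cong (trans (sym (-‿distribˡ-* _ _)) (-‿cong
             (solve 4 (λ s x y f → s :* x :* (y :* f) := y :* (s :* x :* f)) refl (sgn j) (t (suc j)) (t zero) _)))
             (sym (-‿distribˡ-* _ _)) ⟩
      - (t zero * b j) + - (sgn j * t (suc j) * c j) ∎

    rest : ∀ m (t : Fin (suc (suc m)) → Carrier) (F : (Fin m → Fin (suc (suc m))) → Carrier) →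
      (∀ {c c′} → c ≗ c′ → F c ≈ F c′) →
      ∑[ j < suc m ] (sgn j * t (suc j) *
        ∑[ k < m ] (sgn (suc k) * t (suc (punchIn j k)) * F (punchIn (suc j) ∘ punchIn (suc k)))) ≈ 0#
    rest zero    t F F-cong = ∑-0 λ j → trans (*-congˡ (∑-zero _)) (zeroʳ _)
    rest (suc m) t F F-cong = begin
      ∑[ j < suc (suc m) ] (sgn j * t (suc j) *
        ∑[ k < suc m ] (sgn (suc k) * t (suc (punchIn j k)) * F (punchIn (suc j) ∘ punchIn (suc k))))
        ≈⟨ ∑-cong (λ j → *-congˡ (trans (∑-cong λ k →
             trans (*-cong (trans (*-congʳ (sgn-suc k)) (sym (-‿distribˡ-* _ _)))
               (F-cong {c′ = shift (punchIn j ∘ punchIn k)} λ { zero → ≡.refl ; (suc l) → ≡.refl }))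
             (sym (-‿distribˡ-* _ _))) (∑-neg _))) ⟩
      ∑[ j < suc (suc m) ] (sgn j * t (suc j) * - (∑[ k < suc m ]
        (sgn k * t (suc (punchIn j k)) * F (shift (punchIn j ∘ punchIn k)))))
        ≈⟨ ∑-cong (λ j → sym (-‿distribʳ-* _ _)) ⟩
      ∑[ j < suc (suc m) ] (- (sgn j * t (suc j) * (∑[ k < suc m ]
        (sgn k * t (suc (punchIn j k)) * F (shift (punchIn j ∘ punchIn k))))))
        ≈⟨ trans (∑-neg _) (-‿cong (double-expansion m (t ∘ suc) (F ∘ shift) λ c≗c′ →
             F-cong λ { zero → ≡.refl ; (suc l) → ≡.cong suc (c≗c′ l) })) ⟩
      - 0#
        ≈⟨ -0#≈0# ⟩
      0# ∎
      where
      -- Column 0 is not deleted in any of these terms, so the surviving columns are 0 followed by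
      -- surviving columns of the tail, and `F ∘ shift` is a function of the latter.
      shift : ∀ {p q} → (Fin p → Fin q) → Fin (suc p) → Fin (suc q)
      shift c zero    = zero
      shift c (suc l) = suc (c l)

  -- Derived from the double expansion and not from antisymmetry: a swap of the rows would give only
  -- det T + det T = 0, and 2 may be a zero divisor in `R`.
  det-equal-rows₀₁ : ∀ {n} (T : Matrix Carrier (suc (suc n))) → (∀ k → T zero k ≈ T (suc zero) k) → det T ≈ 0#
  det-equal-rows₀₁ {n} T T₀≈T₁ = trans
    (trans (det-suc T) (∑-cong λ j → *-congˡ (trans (det-suc (minor T j))
      (∑-cong λ k → *-congʳ (*-congˡ (sym (T₀≈T₁ (punchIn j k))))))))
    (double-expansion n (T zero) (λ c → det (λ i l → T (suc (suc i)) (c l)))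
      λ c≗c′ → det-cong λ i l → reflexive (≡.cong (T (suc (suc i))) (c≗c′ l)))

  det-additive : ∀ {n} (T : Matrix Carrier (suc n)) i a b →
    det (T [ i ]≔ λ k → a k + b k) ≈ det (T [ i ]≔ a) + det (T [ i ]≔ b)
  det-additive T i a b = begin
    det (T [ i ]≔ λ k → a k + b k)
      ≈⟨ det-cong (λ l k → rows l k) ⟩
    det (T [ i ]≔ λ k → ∑[ l < 2 ] (1# * r l k))
      ≈⟨ det-linear T i (λ _ → 1#) r ⟩
    ∑[ l < 2 ] (1# * det (T [ i ]≔ r l))
      ≈⟨ ∑₂ (λ l → det (T [ i ]≔ r l)) ⟩
    det (T [ i ]≔ a) + det (T [ i ]≔ b) ∎
    where
    r : Fin 2 → Fin _ → Carrier
    r zero    = a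
    r (suc _) = b
    ∑₂ : ∀ f → ∑[ l < 2 ] (1# * f l) ≈ f zero + f (suc zero)
    ∑₂ f = trans (∑-suc _) (+-cong (*-identityˡ _)
      (trans (∑-suc _) (trans (+-cong (*-identityˡ _) (∑-zero _)) (+-identityʳ _))))
    rows : ∀ l k → (T [ i ]≔ λ k → a k + b k) l k ≈ (T [ i ]≔ λ k → ∑[ l < 2 ] (1# * r l k)) l k
    rows l k with l Fin.≟ i
    ... | yes ≡.refl = trans (≡⇒≈ (updateAt-updates i T) k)
                       (trans (sym (∑₂ (λ l → r l k))) (sym (≡⇒≈ (updateAt-updates i T) k)))
    ... | no l≢i = trans (≡⇒≈ (updateAt-minimal l i T l≢i) k) (sym (≡⇒≈ (updateAt-minimal l i T l≢i) k))

  swap₀₁ : ∀ {n} → Matrix Carrier (suc (suc n)) → Matrix Carrier (suc (suc n))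
  swap₀₁ T zero          = T (suc zero)
  swap₀₁ T (suc zero)    = T zero
  swap₀₁ T (suc (suc i)) = T (suc (suc i))

  -- Polarisation: the determinant whose first two rows both equal a + b vanishes, and so do the two
  -- terms of its expansion that repeat a row.
  det-swap₀₁ : ∀ {n} (T : Matrix Carrier (suc (suc n))) → det T + det (swap₀₁ T) ≈ 0#
  det-swap₀₁ {n} T = begin
    det T + det (swap₀₁ T)
      ≈⟨ +-cong (trans (+-identityˡ _) (rows λ { zero → ≡.refl ; (suc zero) → ≡.refl ; (suc (suc i)) → ≡.refl }))
                (trans (+-identityʳ _) (rows λ { zero → ≡.refl ; (suc zero) → ≡.refl ; (suc (suc i)) → ≡.refl })) ⟨
    0# + det (M a b) + (det (M b a) + 0#)
      ≈⟨ +-cong (+-congʳ (det-equal-rows₀₁ (M a a) λ _ → refl)) (+-congˡ (det-equal-rows₀₁ (M b b) λ _ → refl)) ⟨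
    det (M a a) + det (M a b) + (det (M b a) + det (M b b))
      ≈⟨ +-cong (split a) (split b) ⟨
    det (M a u) + det (M b u)
      ≈⟨ det-additive (T [ suc zero ]≔ u) zero a b ⟨
    det (M u u)
      ≈⟨ det-equal-rows₀₁ (M u u) (λ _ → refl) ⟩
    0# ∎
    where
    a = T zero
    b = T (suc zero)
    u : Fin (suc (suc n)) → Carrier
    u k = a k + b k
    M : (_ _ : Fin (suc (suc n)) → Carrier) → Matrix Carrier (suc (suc n))
    M x y = (T [ suc zero ]≔ y) [ zero ]≔ x
    rows : ∀ {m} {S T : Matrix Carrier m} → S ≗ T → det S ≈ det T
    rows S≗T = det-cong λ i → ≡⇒≈ (S≗T i)
    M-comm : ∀ x y → det (T [ zero ]≔ x [ suc zero ]≔ y) ≈ det (M x y)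
    M-comm x y = rows λ { zero → ≡.refl ; (suc zero) → ≡.refl ; (suc (suc i)) → ≡.refl }
    split : ∀ x → det (M x u) ≈ det (M x a) + det (M x b)
    split x = trans (sym (M-comm x u)) (trans (det-additive (T [ zero ]≔ x) (suc zero) a b)
      (+-cong (M-comm x a) (M-comm x b)))

  -- Swapping the first two rows moves row 0 below the first row, so that the equal pair lies in
  -- every minor and induction applies.
  det-equal-rows₀ : ∀ {n} (T : Matrix Carrier (suc n)) j → (∀ k → T zero k ≈ T (suc j) k) → det T ≈ 0#
  det-equal-rows₀ T zero T₀≈Tⱼ = det-equal-rows₀₁ T T₀≈Tⱼ
  det-equal-rows₀ T (suc j) T₀≈Tⱼ = begin
    det T                     ≈⟨ +-identityʳ _ ⟨
    det T + 0#                ≈⟨ +-congˡ (trans (det-suc (swap₀₁ T)) (∑-0 λ l → trans (*-congˡ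
      (det-equal-rows₀ (minor (swap₀₁ T) l) j λ k → T₀≈Tⱼ (punchIn l k))) (zeroʳ _))) ⟨
    det T + det (swap₀₁ T)    ≈⟨ det-swap₀₁ T ⟩
    0#                        ∎

  det-equal-rows : ∀ {n} (T : Matrix Carrier n) i j → i ≢ j → (∀ k → T i k ≈ T j k) → det T ≈ 0#
  det-equal-rows T zero    zero    i≢j _     = contradiction ≡.refl i≢j
  det-equal-rows T zero    (suc j) i≢j Tᵢ≈Tⱼ = det-equal-rows₀ T j Tᵢ≈Tⱼ
  det-equal-rows T (suc i) zero    i≢j Tᵢ≈Tⱼ = det-equal-rows₀ T i λ k → sym (Tᵢ≈Tⱼ k)
  det-equal-rows T (suc i) (suc j) i≢j Tᵢ≈Tⱼ = trans (det-suc T) (∑-0 λ l →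
    trans (*-congˡ (det-equal-rows (minor T l) i j (i≢j ∘ ≡.cong suc) λ k → Tᵢ≈Tⱼ (punchIn l k))) (zeroʳ _))

  record IsDerivation (D : Carrier → Carrier) : Set where
    field
      D-cong : ∀ {x y} → x ≈ y → D x ≈ D y
      D-+    : ∀ x y → D (x + y) ≈ D x + D y
      D-*    : ∀ x y → D (x * y) ≈ D x * y + x * D y

  module _ {D : Carrier → Carrier} (isDerivation : IsDerivation D) where
    open IsDerivation isDerivation

    D-0 : D 0# ≈ 0#
    D-0 = x+x≈x⇒x≈0 _ (trans (sym (D-+ 0# 0#)) (D-cong (+-identityʳ 0#)))

    D-1 : D 1# ≈ 0#
    D-1 = x+x≈x⇒x≈0 _ (trans (sym (+-cong (*-identityʳ _) (*-identityˡ _)))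
      (trans (sym (D-* 1# 1#)) (D-cong (*-identityʳ 1#))))

    D-neg : ∀ x → D (- x) ≈ - D x
    D-neg x = +-inverseˡ-unique _ _ (trans (sym (D-+ (- x) x)) (trans (D-cong (-‿inverseˡ x)) D-0))

    D-sgn : ∀ {n} (j : Fin n) → D (sgn j) ≈ 0#
    D-sgn zero    = trans (D-cong sgn-zero) D-1
    D-sgn (suc j) = trans (D-cong (sgn-suc j)) (trans (D-neg _) (trans (-‿cong (D-sgn j)) -0#≈0#))

    D-sum : ∀ {n} (f : Vector Carrier n) → D (∑ f) ≈ ∑ (D ∘ f)
    D-sum {zero}  f = trans (D-cong (∑-zero f)) (trans D-0 (sym (∑-zero _)))
    D-sum {suc n} f = trans (D-cong (∑-suc f)) (trans (D-+ _ _) (trans (+-congˡ (D-sum (f ∘ suc))) (sym (∑-suc _))))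

    D-det : ∀ {n} (T : Matrix Carrier n) → D (det T) ≈ ∑[ i < n ] det (T [ i ]≔ (D ∘ T i))
    D-det {zero}  T = trans (D-cong (det-zero T)) (trans D-1 (sym (∑-zero _)))
    D-det {suc n} T = begin
      D (det T)
        ≈⟨ D-cong (det-suc T) ⟩
      D (∑[ j < suc n ] (sgn j * T zero j * det (minor T j)))
        ≈⟨ D-sum (λ j → sgn j * T zero j * det (minor T j)) ⟩
      ∑[ j < suc n ] D (sgn j * T zero j * det (minor T j))
        ≈⟨ ∑-cong term ⟩
      ∑[ j < suc n ] (sgn j * D (T zero j) * det (minor T j) + ∑[ i < n ] t i j)
        ≈⟨ ∑-+ (λ j → sgn j * D (T zero j) * det (minor T j)) _ ⟩
      ∑[ j < suc n ] (sgn j * D (T zero j) * det (minor T j)) + ∑[ j < suc n ] ∑[ i < n ] t i j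
        ≈⟨ +-cong (sym (det-suc (T [ zero ]≔ (D ∘ T zero)))) (trans (∑-comm (λ j i → t i j))
             (∑-cong λ i → sym (det-suc (T [ suc i ]≔ (D ∘ T (suc i)))))) ⟩
      det (T [ zero ]≔ (D ∘ T zero)) + ∑[ i < n ] det (T [ suc i ]≔ (D ∘ T (suc i)))
        ≈⟨ ∑-suc _ ⟨
      ∑[ i < suc n ] det (T [ i ]≔ (D ∘ T i)) ∎
      where
      t : Fin n → Fin (suc n) → Carrier
      t i j = sgn j * T zero j * det (minor (T [ suc i ]≔ (D ∘ T (suc i))) j)

      term : ∀ j → D (sgn j * T zero j * det (minor T j)) ≈
                   sgn j * D (T zero j) * det (minor T j) + ∑[ i < n ] t i j
      term j = begin
        D (sgn j * T zero j * det (minor T j))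
          ≈⟨ D-* _ _ ⟩
        D (sgn j * T zero j) * det (minor T j) + sgn j * T zero j * D (det (minor T j))
          ≈⟨ +-cong (*-congʳ (trans (D-* _ _) (trans (+-congʳ (trans (*-congʳ (D-sgn j)) (zeroˡ _)))
            (+-identityˡ _))))
               (*-congˡ (D-det (minor T j))) ⟩
        sgn j * D (T zero j) * det (minor T j) + sgn j * T zero j * ∑[ i < n ] det (minor T j [ i ]≔
          (D ∘ minor T j i))
          ≈⟨ +-congˡ (trans (∑-distribˡ (sgn j * T zero j) _)
               (∑-cong λ i → *-congˡ (sym (minor-[]≔ T i (D ∘ T (suc i)) j)))) ⟩
        sgn j * D (T zero j) * det (minor T j) + ∑[ i < n ] t i j ∎

    -- Jacobi's formula without adjugate or inverse. In the i-th summand of `D-det` the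
    -- differentiated row is a combination of the rows `T l`, and each of them except `T i` repeats
    -- another row.
    liouville : ∀ {n} (E T : Matrix Carrier n) → (∀ i k → D (T i k) ≈ ∑[ l < n ] (E i l * T l k)) →
      D (det T) ≈ (∑[ i < n ] E i i) * det T
    liouville {n} E T DT≈ET = begin
      D (det T)
        ≈⟨ D-det T ⟩
      ∑[ i < n ] det (T [ i ]≔ (D ∘ T i))
        ≈⟨ ∑-cong row ⟩
      ∑[ i < n ] (E i i * det T)
        ≈⟨ ∑-distribʳ (det T) (λ i → E i i) ⟨
      (∑[ i < n ] E i i) * det T ∎
      where
      []≔-cong : ∀ i {r r′ : Fin n → Carrier} → (∀ k → r k ≈ r′ k) → ∀ l k → (T [ i ]≔ r) l k ≈ (T [ i ]≔ r′) l k
      []≔-cong i r≈r′ l k with l Fin.≟ i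
      ... | yes ≡.refl = trans (≡⇒≈ (updateAt-updates i T) k) (trans (r≈r′ k) (sym (≡⇒≈ (updateAt-updates i T) k)))
      ... | no l≢i = trans (≡⇒≈ (updateAt-minimal l i T l≢i) k) (sym (≡⇒≈ (updateAt-minimal l i T l≢i) k))

      own : ∀ i l k → (T [ i ]≔ T i) l k ≈ T l k
      own i l k with l Fin.≟ i
      ... | yes ≡.refl = ≡⇒≈ (updateAt-updates i T) k
      ... | no l≢i = ≡⇒≈ (updateAt-minimal l i T l≢i) k

      row : ∀ i → det (T [ i ]≔ (D ∘ T i)) ≈ E i i * det T
      row i = begin
        det (T [ i ]≔ (D ∘ T i))
          ≈⟨ det-cong ([]≔-cong i (DT≈ET i)) ⟩
        det (T [ i ]≔ λ k → ∑[ l < n ] (E i l * T l k))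
          ≈⟨ det-linear T i (E i) T ⟩
        ∑[ l < n ] (E i l * det (T [ i ]≔ T l))
          ≈⟨ ∑-single _ i (λ l l≢i → trans (*-congˡ (det-equal-rows (T [ i ]≔ T l) i l (λ i≡l → l≢i (≡.sym i≡l)) λ k →
               trans (≡⇒≈ (updateAt-updates i T) k) (sym (≡⇒≈ (updateAt-minimal l i T l≢i) k)))) (zeroʳ _)) ⟩
        E i i * det (T [ i ]≔ T i)
          ≈⟨ *-congˡ (det-cong (own i)) ⟩
        E i i * det T ∎

-- Formal power series and logarithmic derivatives

module PowerSeries (R : CommutativeRing 0ℓ 0ℓ) where
  open CommutativeRing R hiding (zero)
  open Algebra.Properties.Ring ring
    using (-‿distribˡ-*; -‿distribʳ-*; -0#≈0#; -‿+-comm; x≈y⇒x∙y⁻¹≈ε; x∙y⁻¹≈ε⇒x≈y; -‿injective)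
  open Algebra.Properties.Semiring.Mult semiring using (×-congʳ; ×-comm-*) renaming (_×_ to _·_)
  open Algebra.Properties.CommutativeMonoid.Mult +-commutativeMonoid using (×-distrib-+)
  open Algebra.Solver.Ring.NaturalCoefficients.Default commutativeSemiring
    using (solve; _:=_; _:*_; _:+_)
  open Relation.Binary.Reasoning.Setoid setoid

  Series : Set
  Series = ℕ → Carrier

  infixl 7 _⊛_

  _⊛_ : Series → Series → Series
  (a ⊛ b) zero    = a 0 * b 0
  (a ⊛ b) (suc n) = a 0 * b (suc n) + (a ∘ suc ⊛ b) n

  constant : Carrier → Series
  constant x zero    = x
  constant x (suc _) = 0#

  ⊛-cong : ∀ {a a′ b b′} → (∀ n → a n ≈ a′ n) → (∀ n → b n ≈ b′ n) → ∀ n → (a ⊛ b) n ≈ (a′ ⊛ b′) n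
  ⊛-cong a≈ b≈ zero    = *-cong (a≈ 0) (b≈ 0)
  ⊛-cong a≈ b≈ (suc n) = +-cong (*-cong (a≈ 0) (b≈ (suc n))) (⊛-cong (a≈ ∘ suc) b≈ n)

  ⊛-distribʳ : ∀ c a b n → ((λ m → a m + b m) ⊛ c) n ≈ (a ⊛ c) n + (b ⊛ c) n
  ⊛-distribʳ c a b zero    = distribʳ (c 0) (a 0) (b 0)
  ⊛-distribʳ c a b (suc n) = trans (+-congˡ (⊛-distribʳ c (a ∘ suc) (b ∘ suc) n))
    (solve 5 (λ a b c x y → (a :+ b) :* c :+ (x :+ y) := (a :* c :+ x) :+ (b :* c :+ y)) refl
      (a 0) (b 0) (c (suc n)) _ _)

  ⊛-scale : ∀ x b c n → ((λ m → x * b m) ⊛ c) n ≈ x * (b ⊛ c) n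
  ⊛-scale x b c zero    = *-assoc x (b 0) (c 0)
  ⊛-scale x b c (suc n) = trans (+-cong (*-assoc x (b 0) (c (suc n))) (⊛-scale x (b ∘ suc) c n))
    (sym (distribˡ x _ _))

  -- The product is defined by peeling off its left factor. Peeling off the right one as well turns
  -- commutativity into an induction.
  ⊛-sucʳ : ∀ a b n → (a ⊛ b) (suc n) ≈ a (suc n) * b 0 + (a ⊛ b ∘ suc) n
  ⊛-sucʳ a b zero    = +-comm _ _
  ⊛-sucʳ a b (suc n) = trans (+-congˡ (⊛-sucʳ (a ∘ suc) b n))
    (solve 3 (λ x y z → x :+ (y :+ z) := y :+ (x :+ z)) refl _ _ _)

  ⊛-comm : ∀ a b n → (a ⊛ b) n ≈ (b ⊛ a) n
  ⊛-comm a b zero    = *-comm _ _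
  ⊛-comm a b (suc n) = trans (+-cong (*-comm _ _) (⊛-comm (a ∘ suc) b n)) (sym (⊛-sucʳ b a n))

  ⊛-assoc : ∀ a b c n → ((a ⊛ b) ⊛ c) n ≈ (a ⊛ (b ⊛ c)) n
  ⊛-assoc a b c zero    = *-assoc _ _ _
  ⊛-assoc a b c (suc n) = begin
    a 0 * b 0 * c (suc n) + ((λ m → a 0 * b (suc m) + (a ∘ suc ⊛ b) m) ⊛ c) n
      ≈⟨ +-congˡ (trans (⊛-distribʳ c _ _ n) (+-cong (⊛-scale (a 0) (b ∘ suc) c n) (⊛-assoc (a ∘ suc) b c n))) ⟩
    a 0 * b 0 * c (suc n) + (a 0 * (b ∘ suc ⊛ c) n + (a ∘ suc ⊛ (b ⊛ c)) n)
      ≈⟨ solve 5 (λ a b c x y → a :* b :* c :+ (a :* x :+ y) := a :* (b :* c :+ x) :+ y) refl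
           (a 0) (b 0) (c (suc n)) _ _ ⟩
    a 0 * (b ⊛ c) (suc n) + (a ∘ suc ⊛ (b ⊛ c)) n ∎

  ⊛-zeroˡ : ∀ {a} b → (∀ n → a n ≈ 0#) → ∀ n → (a ⊛ b) n ≈ 0#
  ⊛-zeroˡ b a≈0 zero    = trans (*-congʳ (a≈0 0)) (zeroˡ _)
  ⊛-zeroˡ b a≈0 (suc n) = trans (+-cong (trans (*-congʳ (a≈0 0)) (zeroˡ _)) (⊛-zeroˡ b (a≈0 ∘ suc) n)) (+-identityˡ _)

  ⊛-constantˡ : ∀ x b n → (constant x ⊛ b) n ≈ x * b n
  ⊛-constantˡ x b zero    = refl
  ⊛-constantˡ x b (suc n) = trans (+-congˡ (⊛-zeroˡ b (λ _ → refl) n)) (+-identityʳ _)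

  ⊛-identityˡ : ∀ b n → (constant 1# ⊛ b) n ≈ b n
  ⊛-identityˡ b n = trans (⊛-constantˡ 1# b n) (*-identityˡ _)

  ⊛-distribˡ : ∀ c a b n → (c ⊛ (λ m → a m + b m)) n ≈ (c ⊛ a) n + (c ⊛ b) n
  ⊛-distribˡ c a b n = trans (⊛-comm c _ n) (trans (⊛-distribʳ c a b n) (+-cong (⊛-comm a c n) (⊛-comm b c n)))

  series : CommutativeRing 0ℓ 0ℓ
  series = record
    { Carrier = Series
    ; _≈_ = λ a b → ∀ n → a n ≈ b n
    ; _+_ = λ a b n → a n + b n
    ; _*_ = _⊛_
    ; -_ = λ a n → - a n
    ; 0# = λ _ → 0#
    ; 1# = constant 1#
    ; isCommutativeRing = record
      { isRing = record
        { +-isAbelianGroup = record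
          { isGroup = record
            { isMonoid = record
              { isSemigroup = record
                { isMagma = record
                  { isEquivalence = record
                    { refl = λ n → refl
                    ; sym = λ p n → sym (p n)
                    ; trans = λ p q n → trans (p n) (q n)
                    }
                  ; ∙-cong = λ p q n → +-cong (p n) (q n)
                  }
                ; assoc = λ a b c n → +-assoc (a n) (b n) (c n)
                }
              ; identity = (λ a n → +-identityˡ (a n)) , (λ a n → +-identityʳ (a n))
              }
            ; inverse = (λ a n → -‿inverseˡ (a n)) , (λ a n → -‿inverseʳ (a n))
            ; ⁻¹-cong = λ p n → -‿cong (p n)
            }
          ; comm = λ a b n → +-comm (a n) (b n)
          }
        ; *-cong = ⊛-cong
        ; *-assoc = ⊛-assoc
        ; *-identity = ⊛-identityˡ , (λ a n → trans (⊛-comm a _ n) (⊛-identityˡ a n))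
        ; distrib = ⊛-distribˡ , ⊛-distribʳ
        }
      ; *-comm = ⊛-comm
      }
    }

  ·-zero : ∀ m → m · 0# ≈ 0#
  ·-zero zero    = refl
  ·-zero (suc m) = trans (+-identityˡ _) (·-zero m)

  -- The Euler operator z d/dz: a derivation that preserves degrees, so that no indices shift.
  D : Series → Series
  D a n = n · a n

  D-⊛ : ∀ a b n → D (a ⊛ b) n ≈ (D a ⊛ b) n + (a ⊛ D b) n
  D-⊛ a b zero    = sym (trans (+-cong (zeroˡ _) (zeroʳ _)) (+-identityˡ _))
  D-⊛ a b (suc n) = begin
    suc n · (a 0 * b (suc n) + (a ∘ suc ⊛ b) n)
      ≈⟨ ×-distrib-+ _ _ (suc n) ⟩
    suc n · (a 0 * b (suc n)) + ((a ∘ suc ⊛ b) n + D (a ∘ suc ⊛ b) n)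
      ≈⟨ +-cong (sym (×-comm-* (suc n) (a 0) (b (suc n)))) (+-congˡ (D-⊛ (a ∘ suc) b n)) ⟩
    a 0 * D b (suc n) + ((a ∘ suc ⊛ b) n + ((D (a ∘ suc) ⊛ b) n + (a ∘ suc ⊛ D b) n))
      ≈⟨ solve 4 (λ x y z w → x :+ (y :+ (z :+ w)) := (y :+ z) :+ (x :+ w)) refl _ _ _ _ ⟩
    (a ∘ suc ⊛ b) n + (D (a ∘ suc) ⊛ b) n + (a ⊛ D b) (suc n)
      ≈⟨ +-congʳ (trans (+-congʳ (zeroˡ _)) (trans (+-identityˡ _) (⊛-distribʳ b (a ∘ suc) (D (a ∘ suc)) n))) ⟨
    (D a ⊛ b) (suc n) + (a ⊛ D b) (suc n) ∎

  open Determinant series using (IsDerivation; liouville) renaming (det to detₛ; det≡ to detₛ≡)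

  D-isDerivation : IsDerivation D
  D-isDerivation = record
    { D-cong = λ a≈b n → ×-congʳ n (a≈b n)
    ; D-+ = λ a b n → ×-distrib-+ (a n) (b n) n
    ; D-* = D-⊛
    }

  -- The constant term of a ⊛ h is that of a, which therefore vanishes; then `a ∘ suc` satisfies the
  -- same hypothesis.
  cancel : ∀ {h} → h 0 ≈ 1# → ∀ n {a} → (∀ m → (a ⊛ h) m ≈ 0#) → a n ≈ 0#
  cancel h₀≈1 zero ah≈0 = trans (sym (*-identityʳ _)) (trans (*-congˡ (sym h₀≈1)) (ah≈0 0))
  cancel h₀≈1 (suc n) ah≈0 = cancel h₀≈1 n λ m → trans (sym (+-identityˡ _))
    (trans (+-congʳ (sym (trans (*-congʳ (cancel h₀≈1 0 ah≈0)) (zeroˡ _)))) (ah≈0 (suc m)))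

  private
    module Σ = Summation R
    module Σₛ = Summation series
    module L = LinearAlgebra rawRing
    module Lₛ = LinearAlgebra (CommutativeRing.rawRing series)

  open Σ using (∑; ∑-syntax; ∑-cong; ∑-suc; ∑-0; ∑-single)

  coeff-∑ : ∀ {k} (f : Fin k → Series) n → Σₛ.∑ f n ≈ ∑ (λ i → f i n)
  coeff-∑ {zero}  f n = trans (Σₛ.∑-zero f n) (sym (Σ.∑-zero _))
  coeff-∑ {suc k} f n = trans (Σₛ.∑-suc f n) (trans (+-congˡ (coeff-∑ (f ∘ suc) n)) (sym (∑-suc _)))

  linear : Carrier → Carrier → Series
  linear x y zero    = x
  linear x y (suc n) = constant y n

  ⊛-linear : ∀ a x y n → (a ⊛ linear x y) (suc n) ≈ a (suc n) * x + a n * y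
  ⊛-linear a x y n = trans (⊛-sucʳ a (linear x y) n)
    (+-congˡ (trans (⊛-comm a _ n) (trans (⊛-constantˡ y a n) (*-comm _ _))))

  -- The identity matrix, in the form in which it occurs in `charPoly`.
  δ : ∀ {k} → Matrix Carrier k
  δ i j = if does (i Fin.≟ j) then 1# else 0#

  δ-refl : ∀ {k} (i : Fin k) → δ i i ≈ 1#
  δ-refl i with i Fin.≟ i
  ... | yes _  = refl
  ... | no i≢i = contradiction ≡.refl i≢i

  δ-≢ : ∀ {k} {i j : Fin k} → i ≢ j → δ i j ≈ 0#
  δ-≢ {i = i} {j} i≢j with i Fin.≟ j
  ... | yes i≡j = contradiction i≡j i≢j
  ... | no _    = refl

  ∑-δʳ : ∀ {k} (f : Fin k → Carrier) j → ∑ (λ i → f i * δ i j) ≈ f j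
  ∑-δʳ f j = trans (∑-single _ j λ l l≢j → trans (*-congˡ (δ-≢ l≢j)) (zeroʳ _))
    (trans (*-congˡ (δ-refl j)) (*-identityʳ _))

  -- I - zA
  pencil : ∀ {k} → Matrix Carrier k → Matrix Series k
  pencil A i j = linear (δ i j) (- A i j)

  -- `P m` is the m-th power of `A`. A relation, so that iterates of an operator can be supplied as
  -- the powers of its matrix.
  record IsPowers {k} (A : Matrix Carrier k) (P : ℕ → Matrix Carrier k) : Set where
    field
      P-zero : ∀ i j → P 0 i j ≈ δ i j
      P-suc  : ∀ m i j → P (suc m) i j ≈ ∑[ l < k ] (P m i l * A l j)

  -- The logarithmic derivative D(I - zA) (I - zA)⁻¹ = - Σ_{m ≥ 1} Aᵐ zᵐ.
  logDeriv : ∀ {k} → (ℕ → Matrix Carrier k) → Matrix Series k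
  logDeriv P i j zero    = 0#
  logDeriv P i j (suc m) = - P (suc m) i j

  -- At degree m + 1 the product with I - zA has coefficient -Aᵐ⁺¹ + Aᵐ A, which is 0, for m ≥ 1.
  -- For m = 0 the second term is absent, as `logDeriv` has no constant term, and -A remains.
  logDeriv-pencil : ∀ {k} (A : Matrix Carrier k) {P} → IsPowers A P → ∀ i j n →
    D (pencil A i j) n ≈ Σₛ.∑ (λ l → logDeriv P i l ⊛ pencil A l j) n
  logDeriv-pencil {k} A {P} isPowers i j n = trans (go n) (sym (coeff-∑ _ n))
    where
    open IsPowers isPowers
    E = logDeriv P i

    neg : ∀ m → ∑ (λ l → P m i l * - A l j) ≈ - P (suc m) i j
    neg m = trans (∑-cong λ l → sym (-‿distribʳ-* _ _)) (trans (Σ.∑-neg _) (-‿cong (sym (P-suc m i j))))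

    step : ∀ m → ∑ (λ l → (E l ⊛ pencil A l j) (suc m)) ≈ - P (suc m) i j + ∑ (λ l → E l m * - A l j)
    step m = trans (∑-cong λ l → ⊛-linear (E l) _ _ m)
      (trans (Σ.∑-+ (λ l → E l (suc m) * δ l j) _) (+-congʳ (∑-δʳ (λ l → E l (suc m)) j)))

    P₁ : P 1 i j ≈ A i j
    P₁ = trans (P-suc 0 i j) (trans (∑-cong λ l → *-congʳ (P-zero i l))
      (trans (∑-single _ i λ l l≢i → trans (*-congʳ (δ-≢ (l≢i ∘ ≡.sym))) (zeroˡ _))
        (trans (*-congʳ (δ-refl i)) (*-identityˡ _))))

    go : ∀ n → D (pencil A i j) n ≈ ∑ (λ l → (E l ⊛ pencil A l j) n)
    go zero = sym (∑-0 λ l → zeroˡ _)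
    go (suc zero) = sym (trans (step 0) (trans (+-cong (-‿cong P₁) (∑-0 λ l → zeroˡ _)) refl))
    go (suc (suc m)) = begin
      suc (suc m) · 0#
        ≈⟨ ·-zero (suc (suc m)) ⟩
      0#
        ≈⟨ -‿inverseʳ (- P (suc (suc m)) i j) ⟨
      - P (suc (suc m)) i j + - - P (suc (suc m)) i j
        ≈⟨ +-congˡ (trans (sym (-‿cong (neg (suc m)))) (trans (sym (Σ.∑-neg _)) (∑-cong λ l → -‿distribˡ-* _ _))) ⟩
      - P (suc (suc m)) i j + ∑ (λ l → E l (suc m) * - A l j)
        ≈⟨ step (suc m) ⟨
      ∑ (λ l → (E l ⊛ pencil A l j) (suc (suc m))) ∎

  open Algebra.Definitions.RawSemiring (Semiring.rawSemiring semiring) using (_^_)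

  -- Logarithmic derivatives of factors add up; each is given by an equation in place of a quotient.
  D-∏ : ∀ {k} (e f : Fin k → Series) → (∀ i n → D (f i) n ≈ (e i ⊛ f i) n) →
    ∀ n → D (Lₛ.∏ f) n ≈ (Σₛ.∑ e ⊛ Lₛ.∏ f) n
  D-∏ {zero} e f Df n = trans (·-one n) (sym (⊛-zeroˡ _ (Σₛ.∑-zero e) n))
    where
    ·-one : ∀ n → n · constant 1# n ≈ 0#
    ·-one zero    = refl
    ·-one (suc n) = ·-zero (suc n)
  D-∏ {suc k} e f Df n = begin
    D (f₀ ⊛ F) n
      ≈⟨ D-⊛ f₀ F n ⟩
    (D f₀ ⊛ F) n + (f₀ ⊛ D F) n
      ≈⟨ +-cong (⊛-cong (Df zero) (λ _ → refl) n) (⊛-cong {a = f₀} (λ _ → refl) (D-∏ (e ∘ suc) (f ∘ suc)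
        (Df ∘ suc)) n) ⟩
    ((e zero ⊛ f₀) ⊛ F) n + (f₀ ⊛ (E ⊛ F)) n
      ≈⟨ +-cong (⊛-assoc (e zero) f₀ F n) (trans (sym (⊛-assoc f₀ E F n))
           (trans (⊛-cong {b = F} (⊛-comm f₀ E) (λ _ → refl) n) (⊛-assoc E f₀ F n))) ⟩
    (e zero ⊛ (f₀ ⊛ F)) n + (E ⊛ (f₀ ⊛ F)) n
      ≈⟨ ⊛-distribʳ (f₀ ⊛ F) (e zero) E n ⟨
    ((λ m → e zero m + E m) ⊛ (f₀ ⊛ F)) n
      ≈⟨ ⊛-cong {b = f₀ ⊛ F} (λ m → sym (Σₛ.∑-suc e m)) (λ _ → refl) n ⟩
    (Σₛ.∑ e ⊛ (f₀ ⊛ F)) n ∎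
    where
    f₀ = f zero
    F = Lₛ.∏ (f ∘ suc)
    E = Σₛ.∑ (e ∘ suc)

  ∏-constant-term : ∀ {k} (f : Fin k → Series) → (∀ i → f i 0 ≈ 1#) → Lₛ.∏ f 0 ≈ 1#
  ∏-constant-term {zero}  f f₀≈1 = refl
  ∏-constant-term {suc k} f f₀≈1 =
    trans (*-cong (f₀≈1 zero) (∏-constant-term (f ∘ suc) (f₀≈1 ∘ suc))) (*-identityˡ _)

  -- The trace of `logDeriv P` and the sum of the logarithmic derivatives of the factors give the
  -- same product with F. As F has constant term 1 it cancels, and the coefficients of degree m + 1
  -- are the two sides, negated.
  power-sums : ∀ {k} (A : Matrix Carrier k) {P} → IsPowers A P → (μ : Fin k → Carrier) →
    (∀ n → Lₛ.det (pencil A) n ≈ Lₛ.∏ (λ i → linear 1# (- μ i)) n) →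
    ∀ m → ∑[ i < k ] P (suc m) i i ≈ ∑[ i < k ] (μ i ^ suc m)
  power-sums {k} A {P} isPowers μ det≈∏ m = begin
    ∑ (λ i → P (suc m) i i)
      ≈⟨ -‿injective (trans (sym (Σ.∑-neg _)) (trans (sym (coeff-∑ (λ i → logDeriv P i i) (suc m)))
           (trans (x∙y⁻¹≈ε⇒x≈y _ _ (cancel (∏-constant-term (λ i → linear 1# (- μ i)) λ _ → refl) (suc m) {a = λ n
             → Σₛ.∑ (λ i → logDeriv P i i) n + - Σₛ.∑ e n} difference))
             (trans (coeff-∑ e (suc m)) (Σ.∑-neg _))))) ⟩
    ∑ (λ i → μ i ^ suc m) ∎
    where

    -- A factor 1 - xz is the pencil of the 1 × 1 matrix x, so `logDeriv-pencil` provides its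
    -- logarithmic derivative too.
    Q : Carrier → ℕ → Matrix Carrier 1
    Q x m _ _ = x ^ m

    Q-isPowers : ∀ x → IsPowers (λ _ _ → x) (Q x)
    Q-isPowers x = record
      { P-zero = λ { zero zero → refl }
      ; P-suc  = λ m i j → trans (*-comm _ _) (sym (trans (∑-suc _) (trans (+-congˡ (Σ.∑-zero _)) (+-identityʳ _))))
      }

    e : Fin k → Series
    e i = logDeriv (Q (μ i)) zero zero

    F : Series
    F = Lₛ.∏ (λ i → linear 1# (- μ i))

    De : ∀ i n → D (linear 1# (- μ i)) n ≈ (e i ⊛ linear 1# (- μ i)) n
    De i n = trans (logDeriv-pencil (λ _ _ → μ i) (Q-isPowers (μ i)) zero zero n)
      (trans (coeff-∑ _ n) (trans (∑-suc _) (trans (+-congˡ (Σ.∑-zero _)) (+-identityʳ _))))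

    X : Series
    X = Σₛ.∑ (λ i → logDeriv P i i)

    det≈F : ∀ n → detₛ (pencil A) n ≈ F n
    det≈F n = trans (reflexive (≡.cong (λ s → s n) (detₛ≡ (pencil A)))) (det≈∏ n)

    X⊛F≈e⊛F : ∀ n → (X ⊛ F) n ≈ (Σₛ.∑ e ⊛ F) n
    X⊛F≈e⊛F n = begin
      (X ⊛ F) n                 ≈⟨ ⊛-cong {a = X} (λ _ → refl) det≈F n ⟨
      (X ⊛ detₛ (pencil A)) n   ≈⟨ liouville D-isDerivation (logDeriv P) (pencil A) (logDeriv-pencil A isPowers) n ⟨
      D (detₛ (pencil A)) n     ≈⟨ ×-congʳ n (det≈F n) ⟩
      D F n                     ≈⟨ D-∏ e _ De n ⟩
      (Σₛ.∑ e ⊛ F) n            ∎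

    difference : ∀ n → ((λ n → X n + - Σₛ.∑ e n) ⊛ F) n ≈ 0#
    difference n = begin
      ((λ n → X n + - Σₛ.∑ e n) ⊛ F) n
        ≈⟨ ⊛-distribʳ F X _ n ⟩
      (X ⊛ F) n + ((λ n → - Σₛ.∑ e n) ⊛ F) n
        ≈⟨ +-congˡ (Algebra.Properties.Ring.-‿distribˡ-* (CommutativeRing.ring series) (Σₛ.∑ e) F n) ⟨
      (X ⊛ F) n + - (Σₛ.∑ e ⊛ F) n
        ≈⟨ x≈y⇒x∙y⁻¹≈ε (X⊛F≈e⊛F n) ⟩
      0# ∎

-- Maps that preserve determinants and products

module RawRingHomomorphism (S : RawRing 0ℓ 0ℓ) (R : CommutativeRing 0ℓ 0ℓ) where
  private
    module S = RawRing S
    module R = CommutativeRing R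
    module LS = LinearAlgebra S
    module LR = LinearAlgebra R.rawRing
    module ES = Algebra.Definitions.RawSemiring S.rawSemiring
    module ER = Algebra.Definitions.RawSemiring (Semiring.rawSemiring R.semiring)
  open R using (_≈_; refl; trans; *-cong; +-cong; -‿cong)

  -- Only the operations of the source matter. Coefficient lists under `_≡_` violate ring laws, for
  -- instance p - p is a list of zeros and not the empty list.
  record IsHomomorphism (h : S.Carrier → R.Carrier) : Set where
    field
      h-+ : ∀ x y → h (x S.+ y) ≈ h x R.+ h y
      h-* : ∀ x y → h (x S.* y) ≈ h x R.* h y
      h-- : ∀ x → h (S.- x) ≈ R.- h x
      h-0 : h S.0# ≈ R.0#
      h-1 : h S.1# ≈ R.1#

  module _ {h : S.Carrier → R.Carrier} (isHomomorphism : IsHomomorphism h) where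
    open IsHomomorphism isHomomorphism

    h-∏ : ∀ {n} (f : Fin n → S.Carrier) → h (LS.∏ f) ≈ LR.∏ (h ∘ f)
    h-∏ {zero}  f = h-1
    h-∏ {suc n} f = trans (h-* _ _) (*-cong refl (h-∏ (f ∘ suc)))

    h-^ : ∀ x n → h (x ES.^ n) ≈ h x ER.^ n
    h-^ x zero    = h-1
    h-^ x (suc n) = trans (h-* _ _) (*-cong refl (h-^ x n))

    h-∑ : ∀ {n} {f : Fin n → S.Carrier} {g : Fin n → R.Carrier} → (∀ i → h (f i) ≈ g i) → h (LS.∑ f) ≈ LR.∑ g
    h-∑ {zero}  f≈g = h-0
    h-∑ {suc n} f≈g = trans (h-+ _ _) (+-cong (f≈g zero) (h-∑ (f≈g ∘ suc)))

    h-det : ∀ {n} (T : Matrix S.Carrier n) → h (LS.det T) ≈ LR.det (λ i j → h (T i j))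
    h-det {zero}  T = h-1
    h-det {suc n} T = h-∑ λ j → trans (h-* _ _)
      (*-cong (trans (h-^ _ (toℕ j)) (^-cong (toℕ j) (trans (h-- _) (-‿cong h-1))))
        (trans (h-* (T zero j) _) (*-cong refl (h-det λ i k → T (suc i) (punchIn j k)))))
      where
      ^-cong : ∀ {x y} n → x ≈ y → x ER.^ n ≈ y ER.^ n
      ^-cong zero    x≈y = refl
      ^-cong (suc n) x≈y = *-cong x≈y (^-cong n x≈y)

-- Polynomials: from values at many points to coefficients

-- Polynomials are coefficient lists, constant term first; trailing zeros are allowed.
module Polynomial (R : CommutativeRing 0ℓ 0ℓ) where
  open CommutativeRing R hiding (zero)
  open Algebra.Properties.Ring ring using (-‿distribʳ-*; -0#≈0#; -‿+-comm; x≈y⇒x∙y⁻¹≈ε; x∙y⁻¹≈ε⇒x≈y; -1*x≈-x)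
  open Algebra.Solver.Ring.NaturalCoefficients.Default commutativeSemiring
    using (solve; _:=_; _:*_; _:+_)
  open Relation.Binary.Reasoning.Setoid setoid
  open PowerSeries R

  Poly : Set
  Poly = List Carrier

  infixl 6 _⊕_
  infixl 7 _⊙_ _⊗_

  _⊕_ : Poly → Poly → Poly
  []      ⊕ q       = q
  (c ∷ p) ⊕ []      = c ∷ p
  (c ∷ p) ⊕ (d ∷ q) = (c + d) ∷ (p ⊕ q)

  _⊙_ : Carrier → Poly → Poly
  x ⊙ []      = []
  x ⊙ (c ∷ p) = x * c ∷ x ⊙ p

  _⊗_ : Poly → Poly → Poly
  []      ⊗ q = []
  (c ∷ p) ⊗ q = c ⊙ q ⊕ (0# ∷ p ⊗ q)

  poly : RawRing 0ℓ 0ℓ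
  poly = record
    { Carrier = Poly ; _≈_ = _≡_ ; _+_ = _⊕_ ; _*_ = _⊗_ ; -_ = (- 1#) ⊙_ ; 0# = [] ; 1# = 1# ∷ [] }

  eval : Poly → Carrier → Carrier
  eval []      x = 0#
  eval (c ∷ p) x = c + x * eval p x

  eval-⊕ : ∀ p q x → eval (p ⊕ q) x ≈ eval p x + eval q x
  eval-⊕ []      q       x = sym (+-identityˡ _)
  eval-⊕ (c ∷ p) []      x = sym (+-identityʳ _)
  eval-⊕ (c ∷ p) (d ∷ q) x = trans (+-congˡ (*-congˡ (eval-⊕ p q x)))
    (solve 5 (λ c d x p q → (c :+ d) :+ x :* (p :+ q) := (c :+ x :* p) :+ (d :+ x :* q)) refl c d x _ _)

  eval-⊙ : ∀ y p x → eval (y ⊙ p) x ≈ y * eval p x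
  eval-⊙ y []      x = sym (zeroʳ y)
  eval-⊙ y (c ∷ p) x = trans (+-congˡ (*-congˡ (eval-⊙ y p x)))
    (solve 4 (λ y c x p → y :* c :+ x :* (y :* p) := y :* (c :+ x :* p)) refl y c x _)

  eval-⊗ : ∀ p q x → eval (p ⊗ q) x ≈ eval p x * eval q x
  eval-⊗ []      q x = sym (zeroˡ _)
  eval-⊗ (c ∷ p) q x = trans (eval-⊕ (c ⊙ q) (0# ∷ p ⊗ q) x)
    (trans (+-cong (eval-⊙ c q x) (trans (+-identityˡ _) (*-congˡ (eval-⊗ p q x))))
      (solve 4 (λ c x p q → c :* q :+ x :* (p :* q) := (c :+ x :* p) :* q) refl c x _ _))

  eval-constant : ∀ c x → eval (c ∷ []) x ≈ c
  eval-constant c x = trans (+-congˡ (zeroʳ x)) (+-identityʳ c)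

  coeff : Poly → ℕ → Carrier
  coeff []      n       = 0#
  coeff (c ∷ p) zero    = c
  coeff (c ∷ p) (suc n) = coeff p n

  coeff-⊕ : ∀ p q n → coeff (p ⊕ q) n ≈ coeff p n + coeff q n
  coeff-⊕ []      q       n       = sym (+-identityˡ _)
  coeff-⊕ (c ∷ p) []      n       = sym (+-identityʳ _)
  coeff-⊕ (c ∷ p) (d ∷ q) zero    = refl
  coeff-⊕ (c ∷ p) (d ∷ q) (suc n) = coeff-⊕ p q n

  coeff-⊙ : ∀ y p n → coeff (y ⊙ p) n ≈ y * coeff p n
  coeff-⊙ y []      n       = sym (zeroʳ y)
  coeff-⊙ y (c ∷ p) zero    = refl
  coeff-⊙ y (c ∷ p) (suc n) = coeff-⊙ y p n

  coeff-⊗ : ∀ p q n → coeff (p ⊗ q) n ≈ (coeff p ⊛ coeff q) n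
  coeff-⊗ []      q n       = sym (⊛-zeroˡ (coeff q) (λ _ → refl) n)
  coeff-⊗ (c ∷ p) q zero    = trans (coeff-⊕ (c ⊙ q) (0# ∷ p ⊗ q) 0) (trans (+-identityʳ _) (coeff-⊙ c q 0))
  coeff-⊗ (c ∷ p) q (suc n) = trans (coeff-⊕ (c ⊙ q) (0# ∷ p ⊗ q) (suc n))
    (+-cong (coeff-⊙ c q (suc n)) (coeff-⊗ p q n))

  coeff-constant : ∀ c n → coeff (c ∷ []) n ≈ constant c n
  coeff-constant c zero    = refl
  coeff-constant c (suc n) = refl

  coeff-linear : ∀ c d n → coeff (c ∷ d ∷ []) n ≈ linear c d n
  coeff-linear c d zero    = refl
  coeff-linear c d (suc n) = coeff-constant d n

  module Eval = RawRingHomomorphism poly R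
  module Coeff = RawRingHomomorphism poly series

  eval-isHomomorphism : ∀ x → Eval.IsHomomorphism (λ p → eval p x)
  eval-isHomomorphism x = record
    { h-+ = λ p q → eval-⊕ p q x
    ; h-* = λ p q → eval-⊗ p q x
    ; h-- = λ p → trans (eval-⊙ (- 1#) p x) (-1*x≈-x _)
    ; h-0 = refl
    ; h-1 = eval-constant 1# x
    }

  coeff-isHomomorphism : Coeff.IsHomomorphism coeff
  coeff-isHomomorphism = record
    { h-+ = coeff-⊕
    ; h-* = coeff-⊗
    ; h-- = λ p n → trans (coeff-⊙ (- 1#) p n) (-1*x≈-x _)
    ; h-0 = λ n → refl
    ; h-1 = coeff-constant 1#
    }

  coeff-0 : ∀ {p} → All (_≈ 0#) p → ∀ n → coeff p n ≈ 0#
  coeff-0 []       n       = refl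
  coeff-0 (c ∷ cs) zero    = c
  coeff-0 (c ∷ cs) (suc n) = coeff-0 cs n

  -- The values at a of all suffixes of p; those of the proper suffixes are the
  -- coefficients of the quotient of p - p(a) by x - a.
  suffixes : Carrier → Poly → Poly
  suffixes a []      = []
  suffixes a (c ∷ p) = eval (c ∷ p) a ∷ suffixes a p

  -- Synthetic division p(x) - p(a) = (x - a) q(x), rearranged so that no subtraction occurs and the
  -- semiring solver applies.
  division : ∀ a c p x → eval (c ∷ p) x + a * eval (suffixes a p) x ≈ eval (c ∷ p) a + x * eval (suffixes a p) x
  division a c []      x =
    solve 4 (λ c x a z → (c :+ x :* z) :+ a :* z := (c :+ a :* z) :+ x :* z) refl c x a 0#
  division a c (d ∷ p) x = begin
    c + x * P + a * (Q + x * S)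
      ≈⟨ solve 6 (λ c x a P Q S → c :+ x :* P :+ a :* (Q :+ x :* S) := c :+ a :* Q :+ x :*
        (P :+ a :* S)) refl c x a P Q S ⟩
    c + a * Q + x * (P + a * S)
      ≈⟨ +-congˡ (*-congˡ (division a d p x)) ⟩
    c + a * Q + x * (Q + x * S) ∎
    where
    P = eval (d ∷ p) x
    Q = eval (d ∷ p) a
    S = eval (suffixes a p) x

  -- By Horner's rule the value of a suffix is its first coefficient plus a times the value of the
  -- next suffix.
  suffixes-0 : ∀ a p → All (_≈ 0#) (suffixes a p) → All (_≈ 0#) p
  suffixes-0 a []          _          = []
  suffixes-0 a (c ∷ [])    (c≈0 ∷ _)  = trans (sym (eval-constant c a)) c≈0 ∷ []
  suffixes-0 a (c ∷ d ∷ p) (c≈0 ∷ s≈0@(d≈0 ∷ _)) =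
    trans (sym (trans (+-congˡ (trans (*-congˡ d≈0) (zeroʳ a))) (+-identityʳ c))) c≈0 ∷ suffixes-0 a (d ∷ p) s≈0

  -- Differences of the points can be cancelled, which is what the factor theorem requires of the
  -- ring.
  Separated : (ℕ → Carrier) → Set
  Separated x = ∀ m n → m ℕ.< n → ∀ c → x n * c ≈ x m * c → c ≈ 0#

  module _ (x : ℕ → Carrier) (separated : Separated x) where

    -- Factor theorem: if p vanishes at `x m`, its quotient vanishes at all later points. The
    -- induction is on the length, because the quotient is not a sublist of p.
    vanishing : ∀ p m → (∀ n → m ℕ.≤ n → eval p (x n) ≈ 0#) → All (_≈ 0#) p
    vanishing p m p≈0 = go (Data.List.Base.length p) p ≡.refl m p≈0
      where
      length-suffixes : ∀ a p → Data.List.Base.length (suffixes a p) ≡ Data.List.Base.length p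
      length-suffixes a []      = ≡.refl
      length-suffixes a (c ∷ p) = ≡.cong suc (length-suffixes a p)
      go : ∀ k p → Data.List.Base.length p ≡ k → ∀ m → (∀ n → m ℕ.≤ n → eval p (x n) ≈ 0#) → All (_≈ 0#) p
      go zero    []      _  m p≈0 = []
      go (suc k) (c ∷ p) eq m p≈0 = suffixes-0 a (c ∷ p) (p≈0 m ℕ.≤-refl ∷
        go k (suffixes a p) (≡.trans (length-suffixes a p) (ℕ.suc-injective eq)) (suc m) λ n m<n →
          separated m n m<n _ (sym (trans (sym (+-identityˡ _)) (trans (+-congʳ (sym (p≈0 n (ℕ.<⇒≤ m<n))))
            (trans (division a c p (x n)) (trans (+-congʳ (p≈0 m ℕ.≤-refl)) (+-identityˡ _)))))))
        where a = x m

    identity : ∀ p q → (∀ n → eval p (x n) ≈ eval q (x n)) → ∀ n → coeff p n ≈ coeff q n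
    identity p q p≈q n = x∙y⁻¹≈ε⇒x≈y _ _ (trans (+-congˡ (sym (trans (coeff-⊙ (- 1#) q n) (-1*x≈-x _))))
      (trans (sym (coeff-⊕ p ((- 1#) ⊙ q) n)) (coeff-0 (vanishing (p ⊕ (- 1#) ⊙ q) 0 λ m _ →
        trans (eval-⊕ p ((- 1#) ⊙ q) (x m)) (trans (+-congˡ (trans (eval-⊙ (- 1#) q (x m)) (-1*x≈-x _)))
          (x≈y⇒x∙y⁻¹≈ε (p≈q m)))) n)))

  private
    module L = LinearAlgebra rawRing
    module Lₛ = LinearAlgebra (CommutativeRing.rawRing series)
    module Lₚ = LinearAlgebra poly
    module Det = Determinant R
    module Detₛ = Determinant series
  open Algebra.Definitions.RawSemiring (Semiring.rawSemiring semiring) using (_^_)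

  det-cong : ∀ {k} {S T : Matrix Carrier k} → (∀ i j → S i j ≈ T i j) → L.det S ≈ L.det T
  det-cong {S = S} {T} S≈T = trans (reflexive (≡.sym (Det.det≡ S)))
    (trans (Det.det-cong S≈T) (reflexive (Det.det≡ T)))

  ∏-cong : ∀ {k} {f g : Fin k → Carrier} → (∀ i → f i ≈ g i) → L.∏ f ≈ L.∏ g
  ∏-cong {zero}  f≈g = refl
  ∏-cong {suc k} f≈g = *-cong (f≈g zero) (∏-cong (f≈g ∘ suc))

  ∏-scale : ∀ {k} x (f : Fin k → Carrier) → L.∏ (λ i → x * f i) ≈ x ^ k * L.∏ f
  ∏-scale {zero}  x f = sym (*-identityˡ 1#)
  ∏-scale {suc k} x f = trans (*-congˡ (∏-scale x (f ∘ suc)))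
    (solve 4 (λ x f y p → x :* f :* (y :* p) := x :* y :* (f :* p)) refl x (f zero) (x ^ k) _)

  ∏-congₛ : ∀ {k} {f g : Fin k → Series} → (∀ i n → f i n ≈ g i n) → ∀ n → Lₛ.∏ f n ≈ Lₛ.∏ g n
  ∏-congₛ {zero}  f≈g n = refl
  ∏-congₛ {suc k} f≈g = ⊛-cong (f≈g zero) (∏-congₛ (f≈g ∘ suc))

  -- The polynomial identity det (I - zA) = ∏ (1 - μᵢ z) follows from the values
  -- of the characteristic polynomial at infinitely many 1/z.
  module _ (z w : ℕ → Carrier) (zw≈1 : ∀ n → z n * w n ≈ 1#) (separated : Separated z)
           {k} (A : Matrix Carrier k) (μ : Fin k → Carrier)
           (characteristic : ∀ x → L.charPoly A x ≈ L.∏ (λ i → x + - μ i)) where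

    reversed : Matrix Poly k
    reversed i j = δ i j ∷ - A i j ∷ []

    factors : Fin k → Poly
    factors i = 1# ∷ - μ i ∷ []

    eval-linear : ∀ c d x → eval (c ∷ d ∷ []) x ≈ c + x * d
    eval-linear c d x = +-congˡ (*-congˡ (eval-constant d x))

    values : ∀ n → eval (Lₚ.det reversed) (z n) ≈ eval (Lₚ.∏ factors) (z n)
    values n = begin
      eval (Lₚ.det reversed) (z n)
        ≈⟨ Eval.h-det (eval-isHomomorphism (z n)) reversed ⟩
      L.det (λ i j → eval (reversed i j) (z n))
        ≈⟨ det-cong entry ⟩
      L.det (λ i j → z n * X i j)
        ≈⟨ trans (reflexive (≡.sym (Det.det≡ _))) (trans (Det.det-scale (z n) X) (*-congˡ (reflexive (Det.det≡ X)))) ⟩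
      z n ^ k * L.det X
        ≈⟨ *-congˡ (characteristic (w n)) ⟩
      z n ^ k * L.∏ (λ i → w n + - μ i)
        ≈⟨ ∏-scale (z n) (λ i → w n + - μ i) ⟨
      L.∏ (λ i → z n * (w n + - μ i))
        ≈⟨ ∏-cong (λ i → trans (distribˡ _ _ _) (trans (+-congʳ (zw≈1 n)) (sym (eval-linear 1# (- μ i) (z n))))) ⟩
      L.∏ (λ i → eval (factors i) (z n))
        ≈⟨ Eval.h-∏ (eval-isHomomorphism (z n)) factors ⟨
      eval (Lₚ.∏ factors) (z n) ∎
      where
      -- This is w I - A; multiplying by z gives I - zA, because zw = 1.
      X : Matrix Carrier k
      X i j = (if does (i Fin.≟ j) then w n else 0#) + - A i j
      entry : ∀ i j → eval (reversed i j) (z n) ≈ z n * X i j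
      entry i j = trans (eval-linear (δ i j) (- A i j) (z n)) (sym (trans (distribˡ _ _ _) (+-congʳ diagonal)))
        where
        diagonal : z n * (if does (i Fin.≟ j) then w n else 0#) ≈ δ i j
        diagonal with does (i Fin.≟ j)
        ... | true  = zw≈1 n
        ... | false = zeroʳ _

    det-pencil : ∀ n → Lₛ.det (pencil A) n ≈ Lₛ.∏ (λ i → linear 1# (- μ i)) n
    det-pencil n = begin
      Lₛ.det (pencil A) n
        ≈⟨ detₛ-cong (λ i j m → coeff-linear (δ i j) (- A i j) m) n ⟨
      Lₛ.det (λ i j → coeff (reversed i j)) n
        ≈⟨ Coeff.h-det coeff-isHomomorphism reversed n ⟨
      coeff (Lₚ.det reversed) n
        ≈⟨ identity z separated (Lₚ.det reversed) (Lₚ.∏ factors) values n ⟩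
      coeff (Lₚ.∏ factors) n
        ≈⟨ Coeff.h-∏ coeff-isHomomorphism factors n ⟩
      Lₛ.∏ (λ i → coeff (factors i)) n
        ≈⟨ ∏-congₛ (λ i → coeff-linear 1# (- μ i)) n ⟩
      Lₛ.∏ (λ i → linear 1# (- μ i)) n ∎
      where
      detₛ-cong : ∀ {S T : Matrix Series k} → (∀ i j n → S i j n ≈ T i j n) → ∀ n → Lₛ.det S n ≈ Lₛ.det T n
      detₛ-cong {S} {T} S≈T n = trans (reflexive (≡.cong (λ s → s n) (≡.sym (Detₛ.det≡ S))))
        (trans (Detₛ.det-cong S≈T n) (reflexive (≡.cong (λ s → s n) (Detₛ.det≡ T))))

    trace-powers : ∀ {P} → IsPowers A P → ∀ m →
      Summation.∑ R (λ i → P (suc m) i i) ≈ Summation.∑ R (λ i → μ i ^ suc m)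
    trace-powers isPowers = power-sums A isPowers μ det-pencil

-- Rational inequalities and the smoothstep iteration

module RationalOrder where
  open import Data.Integer.Base using (+_)
  open import Data.Rational.Base using (_+_; _*_; -_; _-_; _≤_; _<_; _/_; ↥_; ↧_; *≤*)
  open ≡ using (refl; sym; trans; cong; cong₂; subst)
  open +-*-Solver using (solve; _:=_; _:+_; _:*_; _:-_; :-_; con)

  -- `i / 1` normalises by a gcd and is stuck at a variable `i`, whereas `fromℤ i` is already in
  -- lowest terms.
  /1≡ : ∀ i → i / 1 ≡ fromℤ i
  /1≡ i = ℚ.↥p/↧p≡p (fromℤ i)

  /1-+ : ∀ i j → (i ℤ.+ j) / 1 ≡ i / 1 + j / 1
  /1-+ i j = sym (trans (cong₂ _+_ (/1≡ i) (/1≡ j)) (cong (_/ 1) (cong₂ ℤ._+_ (ℤ.*-identityʳ i) (ℤ.*-identityʳ j))))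

  /1-* : ∀ i j → (i ℤ.* j) / 1 ≡ (i / 1) * (j / 1)
  /1-* i j = sym (cong₂ _*_ (/1≡ i) (/1≡ j))

  /1-mono : ∀ {i j} → i ℤ.≤ j → i / 1 ≤ j / 1
  /1-mono {i} {j} i≤j = ℚ.≤-trans (ℚ.≤-reflexive (/1≡ i))
    (ℚ.≤-trans (*≤* (ℤ.*-monoʳ-≤-nonNeg 1ℤ i≤j)) (ℚ.≤-reflexive (sym (/1≡ j))))

  ι : ℕ → ℚ
  ι n = + n / 1

  ι-+ : ∀ m n → ι (m ℕ.+ n) ≡ ι m + ι n
  ι-+ m n = trans (cong (_/ 1) (ℤ.pos-+ m n)) (/1-+ (+ m) (+ n))

  ι-mono : ∀ {m n} → m ℕ.≤ n → ι m ≤ ι n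
  ι-mono m≤n = /1-mono (ℤ.+≤+ m≤n)

  0≤ι : ∀ n → 0ℚ ≤ ι n
  0≤ι n = ι-mono {0} {n} ℕ.z≤n

  archimedean : ∀ q → ∃[ n ] q ≤ ι n
  archimedean q = n , ℚ.≤-trans (*≤* ineq) (ℚ.≤-reflexive (sym (/1≡ (+ n))))
    where
    n = ℤ.∣ ↥ q ∣
    ineq : ↥ q ℤ.* 1ℤ ℤ.≤ + n ℤ.* ↧ q
    ineq = begin
      ↥ q ℤ.* 1ℤ     ≡⟨ ℤ.*-identityʳ (↥ q) ⟩
      ↥ q            ≤⟨ i≤∣i∣ (↥ q) ⟩
      + n            ≡⟨ ℤ.*-identityʳ (+ n) ⟨
      + n ℤ.* 1ℤ     ≤⟨ ℤ.*-monoˡ-≤-nonNeg (+ n) (ℤ.+≤+ (ℕ.s≤s ℕ.z≤n)) ⟩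
      + n ℤ.* ↧ q    ∎
      where
      open ℤ.≤-Reasoning
      i≤∣i∣ : ∀ i → i ℤ.≤ + ℤ.∣ i ∣
      i≤∣i∣ (+ n)        = ℤ.≤-refl
      i≤∣i∣ (ℤ.-[1+ n ]) = ℤ.-≤+

  0≤+ : ∀ {p q} → 0ℚ ≤ p → 0ℚ ≤ q → 0ℚ ≤ p + q
  0≤+ 0≤p 0≤q = ℚ.+-mono-≤ 0≤p 0≤q

  0≤* : ∀ {p q} → 0ℚ ≤ p → 0ℚ ≤ q → 0ℚ ≤ p * q
  0≤* {p} {q} 0≤p 0≤q = subst (_≤ p * q) (ℚ.*-zeroˡ q) (ℚ.*-monoʳ-≤-nonNeg q {{ℚ.nonNegative 0≤q}} 0≤p)

  0≤-from : ∀ {p q} → p ≤ q → 0ℚ ≤ q - p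
  0≤-from {p} {q} p≤q = subst (_≤ q - p) (ℚ.+-inverseʳ p) (ℚ.+-monoˡ-≤ (- p) p≤q)

  -- Most inequalities below are certified in this form: the ring solver identifies q - p with an
  -- expression that is visibly nonnegative.
  ≤-from : ∀ {p q d} → d ≡ q - p → 0ℚ ≤ d → p ≤ q
  ≤-from {p} {q} {d} d≡ 0≤d = begin
    p            ≡⟨ ℚ.+-identityˡ p ⟨
    0ℚ + p       ≤⟨ ℚ.+-monoˡ-≤ p 0≤d ⟩
    d + p        ≡⟨ cong (_+ p) d≡ ⟩
    q - p + p    ≡⟨ solve 2 (λ p q → q :- p :+ p := q) refl p q ⟩
    q            ∎
    where open ℚ.≤-Reasoning

  0≤-square : ∀ p → 0ℚ ≤ p * p
  0≤-square p with ℚ.≤-total 0ℚ p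
  ... | inj₁ 0≤p = 0≤* 0≤p 0≤p
  ... | inj₂ p≤0 = subst (0ℚ ≤_) (solve 1 (λ p → (:- p) :* (:- p) := p :* p) refl p) (0≤* 0≤-p 0≤-p)
    where
    0≤-p : 0ℚ ≤ - p
    0≤-p = ℚ.neg-antimono-≤ p≤0

  *-monoˡ : ∀ {r p q} → 0ℚ ≤ r → p ≤ q → r * p ≤ r * q
  *-monoˡ {r} 0≤r = ℚ.*-monoˡ-≤-nonNeg r {{ℚ.nonNegative 0≤r}}

  *-monoʳ : ∀ {r p q} → 0ℚ ≤ r → p ≤ q → p * r ≤ q * r
  *-monoʳ {r} 0≤r = ℚ.*-monoʳ-≤-nonNeg r {{ℚ.nonNegative 0≤r}}

  0≤½ : 0ℚ ≤ ½
  0≤½ = ℚ.<⇒≤ (ℚ.positive⁻¹ ½)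

  module Σℚ = Summation ℚ.+-*-commutativeRing
  open Σℚ using (∑; ∑-syntax)

  ∑-mono : ∀ {n} {f g : Fin n → ℚ} → (∀ i → f i ≤ g i) → ∑ f ≤ ∑ g
  ∑-mono {zero}  {f} {g} f≤g = ℚ.≤-reflexive (trans (Σℚ.∑-zero f) (sym (Σℚ.∑-zero g)))
  ∑-mono {suc n} {f} {g} f≤g = ℚ.≤-trans (ℚ.≤-reflexive (Σℚ.∑-suc f))
    (ℚ.≤-trans (ℚ.+-mono-≤ (f≤g zero) (∑-mono (f≤g ∘ suc))) (ℚ.≤-reflexive (sym (Σℚ.∑-suc g))))

  ∑-nonneg : ∀ {n} {f : Fin n → ℚ} → (∀ i → 0ℚ ≤ f i) → 0ℚ ≤ ∑ f
  ∑-nonneg {n} 0≤f = ℚ.≤-trans (ℚ.≤-reflexive (sym (Σℚ.∑-0 {n} λ _ → refl))) (∑-mono 0≤f)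

  ∑-const : ∀ n c → ∑ {n} (λ _ → c) ≡ ι n * c
  ∑-const zero    c = trans (Σℚ.∑-zero _) (sym (ℚ.*-zeroˡ c))
  ∑-const (suc n) c = trans (Σℚ.∑-suc _) (trans (cong₂ _+_ (sym (ℚ.*-identityˡ c)) (∑-const n c))
    (trans (sym (ℚ.*-distribʳ-+ c 1ℚ (ι n))) (cong (_* c) (sym (ι-+ 1 n)))))

  -- The smoothstep polynomial 6v⁵ - 15v⁴ + 10v³, written so that it is visibly
  -- nonnegative wherever v is.
  five-quarters five-eighths six : ℚ
  five-quarters = + 5 / 4
  five-eighths  = + 5 / 8
  six           = + 6 / 1

  smoothstep : ℚ → ℚ
  smoothstep v = six * (a * (v * a)) + five-eighths * (v * (v * v))
    where a = v * (v - five-quarters)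

  smoothstep-nonneg : ∀ {v} → 0ℚ ≤ v → 0ℚ ≤ smoothstep v
  smoothstep-nonneg {v} 0≤v = 0≤+
    (subst (0ℚ ≤_) (solve 3 (λ s a v → s :* (v :* (a :* a)) := s :* (a :* (v :* a))) refl six a v)
      (0≤* (0≤ι 6) (0≤* 0≤v (0≤-square a))))
    (0≤* (ℚ.<⇒≤ (ℚ.positive⁻¹ five-eighths)) (0≤* 0≤v (0≤* 0≤v 0≤v)))
    where a = v * (v - five-quarters)

  smoothstep-complement : ∀ v → smoothstep v + smoothstep (1ℚ - v) ≡ 1ℚ
  smoothstep-complement = solve 1 (λ v →
    let f = λ v → con six :* ((v :* (v :- con five-quarters)) :* (v :* (v :* (v :- con five-quarters))))
                  :+ con five-eighths :* (v :* (v :* v))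
    in f v :+ f (con 1ℚ :- v) := con 1ℚ) refl

  ten fifteen : ℚ
  ten     = + 10 / 1
  fifteen = + 15 / 1

  -- The contraction factor of 1 - v under smoothstep.
  ratio : ℚ → ℚ
  ratio d = d * d * (ten - fifteen * d + six * (d * d))

  -- By the symmetry of smoothstep the left side is its value at d, which is d³ (10 - 15d + 6d²).
  1-smoothstep : ∀ d → 1ℚ - smoothstep (1ℚ - d) ≡ d * ratio d
  1-smoothstep = solve 1 (λ d →
    let v = con 1ℚ :- d in
    con 1ℚ :- (con six :* ((v :* (v :- con five-quarters)) :* (v :* (v :* (v :- con five-quarters))))
               :+ con five-eighths :* (v :* (v :* v)))
    := d :* (d :* d :* (con ten :- con fifteen :* d :+ con six :* (d :* d)))) refl

  iterate : ℕ → ℚ → ℚ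
  iterate zero    v = v
  iterate (suc n) v = smoothstep (iterate n v)

  -- Below d = ½ the ratio is at most ½ + d; above v = 1 the iterates stay there.
  smoothstep-converges : ∀ {y v} → y ≡ v + v - 1ℚ → 0ℚ ≤ y → ∀ n → ι n * y * (1ℚ - iterate n v) ≤ ι 2
  smoothstep-converges {y} {v} y≡ 0≤y n = extract (go n)
    where
    two = ι 2

    -- Here d is 1 minus the n-th iterate. Either the iterate has reached 1, or d ≤ 2 / (ny + 2),
    -- which is Bernoulli's bound for the n-th power of 1 - y/2; the condition d ≤ ½ - y/2 keeps the
    -- ratio below that base.
    State : ℕ → ℚ → Set
    State n d = (d ≤ 0ℚ) ⊎ (0ℚ ≤ d × 0ℚ ≤ ½ - y * ½ - d × (ι n * y + two) * d ≤ two)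

    step : ∀ n d → State n d → State (suc n) (d * ratio d)
    step n d (inj₁ d≤0) = inj₁ (≤-from (solve 2 (λ d r → (:- d) :* r := con 0ℚ :- d :* r) refl d (ratio d))
      (0≤* 0≤-d (0≤* (0≤-square d) (subst (0ℚ ≤_)
        (solve 1 (λ d → con ten :+ (con fifteen :* (:- d) :+ con six :* (d :* d))
          := con ten :- con fifteen :* d :+ con six :* (d :* d)) refl d)
        (0≤+ (0≤ι 10) (0≤+ (0≤* (0≤ι 15) 0≤-d) (0≤* (0≤ι 6) (0≤-square d))))))))
      where
      0≤-d : 0ℚ ≤ - d
      0≤-d = ℚ.neg-antimono-≤ d≤0
    step n d (inj₂ (0≤d , d≤ , bound)) = inj₂ (0≤* 0≤d 0≤g , d′≤ , bound′)
      where
      e = ½ - d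
      g = ratio d
      d′ = d * g
      0≤y½ : 0ℚ ≤ y * ½
      0≤y½ = 0≤* 0≤y 0≤½
      0≤e : 0ℚ ≤ e
      0≤e = subst (0ℚ ≤_) (solve 2 (λ y d → (con ½ :- y :* con ½ :- d) :+ y :* con ½ := con ½ :- d) refl y d)
        (0≤+ d≤ 0≤y½)
      0≤g : 0ℚ ≤ g
      0≤g = 0≤* (0≤-square d) (subst (0ℚ ≤_)
        (solve 1 (λ d → con (ι 5 ℚ.* ½) :+ (con fifteen :* (con ½ :- d) :+ con six :* (d :* d))
          := con ten :- con fifteen :* d :+ con six :* (d :* d)) refl d)
        (0≤+ (0≤* (0≤ι 5) 0≤½) (0≤+ (0≤* (0≤ι 15) 0≤e) (0≤* (0≤ι 6) (0≤-square d)))))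
      -- The difference has the factor e = ½ - d because the ratio is 1 at the fixed point d = ½;
      -- the cofactor is nonnegative for 0 ≤ d ≤ ½.
      g≤ : 0ℚ ≤ ½ + d - g
      g≤ = subst (0ℚ ≤_)
        (solve 1 (λ d → let e = con ½ :- d in
            con two :* e :* (e :+ con six :* (d :* e) :+ con (ι 3) :* (d :* (d :* d)))
            := con ½ :+ d :- d :* d :* (con ten :- con fifteen :* d :+ con six :* (d :* d))) refl d)
        (0≤* (0≤* (0≤ι 2) 0≤e) (0≤+ (0≤+ 0≤e (0≤* (0≤ι 6) (0≤* 0≤d 0≤e))) (0≤* (0≤ι 3) (0≤* 0≤d (0≤* 0≤d 0≤d)))))
      slack : 0ℚ ≤ d * (1ℚ - y * ½) - d′
      slack = subst (0ℚ ≤_) (solve 3 (λ d y g → d :* ((con ½ :- y :* con ½ :- d) :+ (con ½ :+ d :- g)) := d :*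
        (con 1ℚ :- y :* con ½) :- d :* g) refl d y g)
        (0≤* 0≤d (0≤+ d≤ g≤))
      d′≤ : 0ℚ ≤ ½ - y * ½ - d′
      d′≤ = subst (0ℚ ≤_) (solve 3 (λ d y d′ → (con ½ :- y :* con ½ :- d) :+ (d :* (y :* con ½)) :+ (d :*
        (con 1ℚ :- y :* con ½) :- d′) := con ½ :- y :* con ½ :- d′) refl d y d′)
        (0≤+ (0≤+ d≤ (0≤* 0≤d 0≤y½)) slack)
      0≤ny : 0ℚ ≤ ι n * y
      0≤ny = 0≤* (0≤ι n) 0≤y
      -- ((n + 1) y + 2) (1 - y/2) = ny + 2 - (y/2) (ny + y), so the weight grows no faster than d
      -- shrinks.
      bound′ : (ι (suc n) * y + two) * d′ ≤ two
      bound′ = ℚ.≤-trans (ℚ.≤-reflexive (cong (λ i → (i * y + two) * d′) (ι-+ 1 n)))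
        (ℚ.≤-trans (≤-from (solve 4 (λ i y d d′ →
             ((con 1ℚ :+ i) :* y :+ con two) :* (d :* (con 1ℚ :- y :* con ½) :- d′) :+ d :* (y :* con ½ :*
               (i :* y :+ y))
             := (i :* y :+ con two) :* d :- ((con 1ℚ :+ i) :* y :+ con two) :* d′) refl (ι n) y d d′)
          (0≤+ (0≤* (0≤+ (0≤* (0≤+ (0≤ι 1) (0≤ι n)) 0≤y) (0≤ι 2)) slack) (0≤* 0≤d (0≤* 0≤y½ (0≤+ 0≤ny 0≤y))))) bound)

    start : State 0 (1ℚ - v)
    start with ℚ.≤-total (1ℚ - v) 0ℚ
    ... | inj₁ d≤0 = inj₁ d≤0
    ... | inj₂ 0≤d = inj₂ (0≤d
      , ℚ.≤-reflexive (trans (solve 1 (λ v → con 0ℚ := con ½ :- (v :+ v :- con 1ℚ) :* con ½ :- (con 1ℚ :- v)) refl v)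
          (cong (λ y → ½ - y * ½ - (1ℚ - v)) (sym y≡)))
      , ≤-from (trans (solve 1 (λ v → v :+ v :- con 1ℚ :+ con 1ℚ := con two :- con two :* (con 1ℚ :- v)) refl v)
          (solve 2 (λ y d → con two :- con two :* d := con two :- (con (ι 0) :* y :+ con two) :* d) refl y (1ℚ - v)))
        (0≤+ (subst (0ℚ ≤_) y≡ 0≤y) (0≤ι 1)))

    go : ∀ n → State n (1ℚ - iterate n v)
    go zero    = start
    go (suc n) = subst (State (suc n)) (trans (sym (1-smoothstep d)) (cong (λ u → 1ℚ - smoothstep u) (1-d
      (iterate n v)))) (step n d (go n))
      where
      d = 1ℚ - iterate n v
      1-d : ∀ u → 1ℚ - (1ℚ - u) ≡ u
      1-d = solve 1 (λ u → con 1ℚ :- (con 1ℚ :- u) := u) refl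

    extract : ∀ {d} → State n d → ι n * y * d ≤ two
    extract {d} (inj₁ d≤0) = ℚ.≤-trans (≤-from (solve 2 (λ m d → m :* (:- d) := con 0ℚ :- m :* d) refl (ι n * y) d)
            (0≤* (0≤* (0≤ι n) 0≤y) (ℚ.neg-antimono-≤ d≤0))) (0≤ι 2)
    extract {d} (inj₂ (0≤d , _ , bound)) = ℚ.≤-trans (≤-from (solve 2 (λ m d → con (ι 2) :* d := (m :+ con
      (ι 2)) :* d :- m :* d) refl (ι n * y) d)
            (0≤* (0≤ι 2) 0≤d)) bound

open RationalOrder

-- Positivity of polynomials in a symmetric operator

module Operators where
  open import Data.Rational.Base using (_+_; _*_; -_; _-_; _≤_; _<_)
  open ≡ using (_≗_; refl; sym; trans; cong; cong₂; subst; module ≡-Reasoning)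
  open +-*-Solver using (solve; _:=_; _:+_; _:*_; _:-_; :-_; con)
  open Σℚ
  open Polynomial ℚ.+-*-commutativeRing using (Poly; _⊕_; _⊙_; _⊗_; eval; eval-⊕; eval-⊙; eval-⊗; eval-constant)
  open PowerSeries ℚ.+-*-commutativeRing using (δ; δ-refl; δ-≢; ∑-δʳ)

  Vec : ℕ → Set
  Vec n = Fin n → ℚ

  ⟨_,_⟩ : ∀ {n} → Vec n → Vec n → ℚ
  ⟨ x , y ⟩ = ∑ λ i → x i * y i

  ⟨⟩-cong : ∀ {n} {x x′ y y′ : Vec n} → x ≗ x′ → y ≗ y′ → ⟨ x , y ⟩ ≡ ⟨ x′ , y′ ⟩
  ⟨⟩-cong x≗ y≗ = ∑-cong λ i → cong₂ _*_ (x≗ i) (y≗ i)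

  ⟨⟩-congʳ : ∀ {n} (x : Vec n) {y y′} → y ≗ y′ → ⟨ x , y ⟩ ≡ ⟨ x , y′ ⟩
  ⟨⟩-congʳ x = ⟨⟩-cong {x = x} λ _ → refl

  ⟨⟩-linearʳ : ∀ {n} (x : Vec n) a b y z → ⟨ x , (λ i → a * y i + b * z i) ⟩ ≡ a * ⟨ x , y ⟩ + b * ⟨ x , z ⟩
  ⟨⟩-linearʳ x a b y z = begin
    ⟨ x , (λ i → a * y i + b * z i) ⟩
      ≡⟨ ∑-cong (λ i → solve 5 (λ x a b y z → x :* (a :* y :+ b :* z) := a :* (x :* y) :+ b :* (x :* z)) refl
        (x i) a b (y i) (z i)) ⟩
    ∑ (λ i → a * (x i * y i) + b * (x i * z i))
      ≡⟨ ∑-+ (λ i → a * (x i * y i)) _ ⟩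
    ∑ (λ i → a * (x i * y i)) + ∑ (λ i → b * (x i * z i))
      ≡⟨ cong₂ _+_ (∑-distribˡ a _) (∑-distribˡ b _) ⟨
    a * ⟨ x , y ⟩ + b * ⟨ x , z ⟩ ∎
    where open ≡-Reasoning

  ⟨⟩-comm : ∀ {n} (x y : Vec n) → ⟨ x , y ⟩ ≡ ⟨ y , x ⟩
  ⟨⟩-comm x y = ∑-cong λ i → ℚ.*-comm (x i) (y i)

  ⟨⟩-linearˡ : ∀ {n} a b (x y z : Vec n) → ⟨ (λ i → a * x i + b * y i) , z ⟩ ≡ a * ⟨ x , z ⟩ + b * ⟨ y , z ⟩
  ⟨⟩-linearˡ a b x y z = trans (⟨⟩-comm _ z) (trans (⟨⟩-linearʳ z a b x y)
    (cong₂ (λ s t → a * s + b * t) (⟨⟩-comm z x) (⟨⟩-comm z y)))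

  0≤⟨x,x⟩ : ∀ {n} (x : Vec n) → 0ℚ ≤ ⟨ x , x ⟩
  0≤⟨x,x⟩ x = ∑-nonneg λ i → 0≤-square (x i)

  -- With the indices in this order `∑-δʳ` is literally the statement that ⟨ x , e i ⟩ is x i.
  e : ∀ {n} → Fin n → Vec n
  e i j = δ j i

  ⟨_,e⟩ : ∀ {n} (x : Vec n) i → ⟨ x , e i ⟩ ≡ x i
  ⟨ x ,e⟩ i = ∑-δʳ x i

  record IsSymmetric {n} (H : Vec n → Vec n) : Set where
    field
      H-cong   : ∀ {x y} → x ≗ y → H x ≗ H y
      H-linear : ∀ a b x y → H (λ i → a * x i + b * y i) ≗ λ i → a * H x i + b * H y i
      H-symm   : ∀ x y → ⟨ H x , y ⟩ ≡ ⟨ x , H y ⟩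

    H-0 : ∀ {x} → (∀ i → x i ≡ 0ℚ) → ∀ i → H x i ≡ 0ℚ
    H-0 {x} x≡0 i = trans (H-cong (λ j → trans (x≡0 j) (zeros (x j))) i)
      (trans (H-linear 0ℚ 0ℚ x x i) (sym (zeros (H x i))))
      where
      zeros : ∀ q → 0ℚ ≡ 0ℚ * q + 0ℚ * q
      zeros = solve 1 (λ q → con 0ℚ := con 0ℚ :* q :+ con 0ℚ :* q) refl

    H-scale : ∀ a x i → H (λ i → a * x i) i ≡ a * H x i
    H-scale a x i = trans (H-cong (λ j → pad (a * x j) (x j)) i)
      (trans (H-linear a 0ℚ x x i) (sym (pad (a * H x i) (H x i))))
      where
      pad : ∀ p q → p ≡ p + 0ℚ * q
      pad = solve 2 (λ p q → p := p :+ con 0ℚ :* q) refl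

    H-+ : ∀ x y i → H (λ i → x i + y i) i ≡ H x i + H y i
    H-+ x y i = trans (H-cong (λ j → pad (x j) (y j)) i)
      (trans (H-linear 1ℚ 1ℚ x y i) (sym (pad (H x i) (H y i))))
      where
      pad : ∀ p q → p + q ≡ 1ℚ * p + 1ℚ * q
      pad = solve 2 (λ p q → p :+ q := con 1ℚ :* p :+ con 1ℚ :* q) refl

    H-∑ : ∀ {k} (c : Fin k → ℚ) (x : Fin k → Vec n) i →
      H (λ j → ∑ λ l → c l * x l j) i ≡ ∑ λ l → c l * H (x l) i
    H-∑ {zero}  c x i = trans (H-0 (λ j → ∑-zero _) i) (sym (∑-zero _))
    H-∑ {suc k} c x i = begin
      H (λ j → ∑ λ l → c l * x l j) i
        ≡⟨ H-cong (λ j → ∑-suc _) i ⟩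
      H (λ j → c zero * x zero j + ∑ λ l → c (suc l) * x (suc l) j) i
        ≡⟨ H-+ _ _ i ⟩
      H (λ j → c zero * x zero j) i + H (λ j → ∑ λ l → c (suc l) * x (suc l) j) i
        ≡⟨ cong₂ _+_ (H-scale (c zero) (x zero) i) (H-∑ (c ∘ suc) (x ∘ suc) i) ⟩
      c zero * H (x zero) i + ∑ (λ l → c (suc l) * H (x (suc l)) i)
        ≡⟨ ∑-suc _ ⟨
      ∑ (λ l → c l * H (x l) i) ∎
      where open ≡-Reasoning

  -- The operator p(H), by Horner's rule.
  apply : ∀ {n} → (Vec n → Vec n) → Poly → Vec n → Vec n
  apply H []      x i = 0ℚ
  apply H (c ∷ p) x i = c * x i + H (apply H p x) i

  module _ {n} {H : Vec n → Vec n} (symmetric : IsSymmetric H) where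
    open IsSymmetric symmetric

    apply-cong : ∀ p {x y} → x ≗ y → apply H p x ≗ apply H p y
    apply-cong []      x≗y i = refl
    apply-cong (c ∷ p) x≗y i = cong₂ (λ s t → c * s + t) (x≗y i) (H-cong (apply-cong p x≗y) i)

    apply-linear : ∀ p a b x y → apply H p (λ i → a * x i + b * y i) ≗ λ i → a * apply H p x i + b * apply H p y i
    apply-linear []      a b x y i = solve 2 (λ a b → con 0ℚ := a :* con 0ℚ :+ b :* con 0ℚ) refl a b
    apply-linear (c ∷ p) a b x y i = trans
      (cong (c * (a * x i + b * y i) +_) (trans (H-cong (apply-linear p a b x y) i) (H-linear a b (apply H p x)
        (apply H p y) i)))
      (solve 7 (λ c a b x y X Y → c :* (a :* x :+ b :* y) :+ (a :* X :+ b :* Y) := a :* (c :* x :+ X) :+ b :*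
        (c :* y :+ Y)) refl
        c a b (x i) (y i) (H (apply H p x) i) (H (apply H p y) i))

    apply-commute : ∀ p x → apply H p (H x) ≗ H (apply H p x)
    apply-commute []      x i = sym (H-0 (λ _ → refl) i)
    apply-commute (c ∷ p) x i = trans (cong (c * H x i +_) (H-cong (apply-commute p x) i))
      (sym (trans (H-+ (λ j → c * x j) (H (apply H p x)) i) (cong (_+ H (H (apply H p x)) i) (H-scale c x i))))

    apply-symm : ∀ p x y → ⟨ apply H p x , y ⟩ ≡ ⟨ x , apply H p y ⟩
    apply-symm []      x y = ∑-cong λ i → trans (ℚ.*-zeroˡ (y i)) (sym (ℚ.*-zeroʳ (x i)))
    apply-symm (c ∷ p) x y = begin
      ⟨ (λ i → c * x i + H (apply H p x) i) , y ⟩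
        ≡⟨ ⟨⟩-cong {y = y} (λ i → cong (c * x i +_) (sym (ℚ.*-identityˡ _))) (λ _ → refl) ⟩
      ⟨ (λ i → c * x i + 1ℚ * H (apply H p x) i) , y ⟩
        ≡⟨ ⟨⟩-linearˡ c 1ℚ x (H (apply H p x)) y ⟩
      c * ⟨ x , y ⟩ + 1ℚ * ⟨ H (apply H p x) , y ⟩
        ≡⟨ cong (λ s → c * ⟨ x , y ⟩ + 1ℚ * s) (trans (H-symm (apply H p x) y)
             (trans (apply-symm p x (H y)) (⟨⟩-congʳ x (apply-commute p y)))) ⟩
      c * ⟨ x , y ⟩ + 1ℚ * ⟨ x , H (apply H p y) ⟩
        ≡⟨ ⟨⟩-linearʳ x c 1ℚ y (H (apply H p y)) ⟨
      ⟨ x , (λ i → c * y i + 1ℚ * H (apply H p y) i) ⟩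
        ≡⟨ ⟨⟩-congʳ x (λ i → cong (c * y i +_) (ℚ.*-identityˡ _)) ⟩
      ⟨ x , apply H (c ∷ p) y ⟩ ∎
      where open ≡-Reasoning

    apply-isSymmetric : ∀ p → IsSymmetric (apply H p)
    apply-isSymmetric p = record { H-cong = apply-cong p ; H-linear = apply-linear p ; H-symm = apply-symm p }

    apply-⊕ : ∀ p q x i → apply H (p ⊕ q) x i ≡ apply H p x i + apply H q x i
    apply-⊕ []      q       x i = sym (ℚ.+-identityˡ _)
    apply-⊕ (c ∷ p) []      x i = sym (ℚ.+-identityʳ _)
    apply-⊕ (c ∷ p) (d ∷ q) x i = trans
      (cong ((c + d) * x i +_) (trans (H-cong (apply-⊕ p q x) i) (H-+ (apply H p x) (apply H q x) i)))
      (solve 5 (λ c d x P Q → (c :+ d) :* x :+ (P :+ Q) := (c :* x :+ P) :+ (d :* x :+ Q)) refl c d (x i) (H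
        (apply H p x) i) (H (apply H q x) i))

    apply-⊙ : ∀ a p x i → apply H (a ⊙ p) x i ≡ a * apply H p x i
    apply-⊙ a []      x i = sym (ℚ.*-zeroʳ a)
    apply-⊙ a (c ∷ p) x i = trans (cong (a * c * x i +_) (trans (H-cong (apply-⊙ a p x) i) (H-scale a
      (apply H p x) i)))
      (solve 4 (λ a c x P → a :* c :* x :+ a :* P := a :* (c :* x :+ P)) refl a c (x i) (H (apply H p x) i))

    apply-⊗ : ∀ p q x i → apply H (p ⊗ q) x i ≡ apply H p (apply H q x) i
    apply-⊗ []      q x i = refl
    apply-⊗ (c ∷ p) q x i = trans (apply-⊕ (c ⊙ q) (0ℚ ∷ p ⊗ q) x i)
      (cong₂ _+_ (apply-⊙ c q x i) (trans (cong₂ _+_ (ℚ.*-zeroˡ (x i)) (H-cong (apply-⊗ p q x) i)) (ℚ.+-identityˡ _)))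

    apply-zeros : ∀ {p} → All (_≡ 0ℚ) p → ∀ x i → apply H p x i ≡ 0ℚ
    apply-zeros []           x i = refl
    apply-zeros (c≡0 ∷ p≡0) x i = trans (cong₂ (λ c h → c * x i + h) c≡0 (H-0 (apply-zeros p≡0 x) i))
      (trans (ℚ.+-identityʳ _) (ℚ.*-zeroˡ (x i)))

  -- The grouping of v between two equal factors is what `positive-smoothstep` exploits.
  smoothstepₚ : Poly → Poly
  smoothstepₚ v = six ⊙ (a ⊗ (v ⊗ a)) ⊕ five-eighths ⊙ (v ⊗ (v ⊗ v))
    where a = v ⊗ (v ⊕ (- five-quarters ∷ []))

  eval-smoothstep : ∀ v x → eval (smoothstepₚ v) x ≡ smoothstep (eval v x)
  eval-smoothstep v x = trans (eval-⊕ (six ⊙ (a ⊗ (v ⊗ a))) _ x) (cong₂ _+_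
    (trans (eval-⊙ six (a ⊗ (v ⊗ a)) x) (cong (six *_) (trans (eval-⊗ a (v ⊗ a) x) (cong₂ _*_ a≡ (trans
      (eval-⊗ v a x) (cong (eval v x *_) a≡))))))
    (trans (eval-⊙ five-eighths (v ⊗ (v ⊗ v)) x) (cong (five-eighths *_) (trans (eval-⊗ v (v ⊗ v) x) (cong
      (eval v x *_) (eval-⊗ v v x))))))
    where
    a = v ⊗ (v ⊕ (- five-quarters ∷ []))
    a≡ : eval a x ≡ eval v x * (eval v x - five-quarters)
    a≡ = trans (eval-⊗ v (v ⊕ (- five-quarters ∷ [])) x) (cong (eval v x *_)
      (trans (eval-⊕ v (- five-quarters ∷ []) x) (cong (eval v x +_) (eval-constant (- five-quarters) x))))

  -- Smoothstep as a composition of operators. It mediates between a polynomial substituted into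
  -- smoothstep and smoothstep as a polynomial in the single operator `apply H v`.
  smoothstepₒ : ∀ {n} → (Vec n → Vec n) → Vec n → Vec n
  smoothstepₒ T x i = six * A (T (A x)) i + five-eighths * T (T (T x)) i
    where
    A : _ → _
    A x = T (λ i → T x i + - five-quarters * x i)

  Complementary : ∀ {n} → (_ _ : Vec n → Vec n) → Set
  Complementary T T′ = ∀ x i → T x i + T′ x i ≡ x i

  module _ {n} {H : Vec n → Vec n} (symmetric : IsSymmetric H) where
    open IsSymmetric symmetric

    apply-smoothstep : ∀ v x → apply H (smoothstepₚ v) x ≗ smoothstepₒ (apply H v) x
    apply-smoothstep v x i = trans (apply-⊕ symmetric (six ⊙ (a ⊗ (v ⊗ a))) (five-eighths ⊙ (v ⊗ (v ⊗ v))) x i)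
      (cong₂ _+_
      (trans (apply-⊙ symmetric six (a ⊗ (v ⊗ a)) x i) (cong (six *_)
        (trans (apply-⊗ symmetric a (v ⊗ a) x i) (trans (A≗ _ i) (T-cong (λ j → cong₂ (λ s t
          → s + - five-quarters * t) (T-cong VA≗ j) (VA≗ j)) i)))))
      (trans (apply-⊙ symmetric five-eighths (v ⊗ (v ⊗ v)) x i) (cong (five-eighths *_)
        (trans (apply-⊗ symmetric v (v ⊗ v) x i) (T-cong (apply-⊗ symmetric v v x) i)))))
      where
      a = v ⊗ (v ⊕ (- five-quarters ∷ []))
      T = apply H v
      T-cong = apply-cong symmetric v
      A≗ : ∀ x → apply H a x ≗ T (λ i → T x i + - five-quarters * x i)
      A≗ x i = trans (apply-⊗ symmetric v _ x i) (T-cong (λ j → trans (apply-⊕ symmetric v _ x j)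
        (cong (T x j +_) (trans (cong (- five-quarters * x j +_) (H-0 (λ _ → refl) j)) (ℚ.+-identityʳ _)))) i)
      VA≗ : apply H (v ⊗ a) x ≗ T (T (λ i → T x i + - five-quarters * x i))
      VA≗ i = trans (apply-⊗ symmetric v a x i) (T-cong (A≗ x) i)

    smoothstepₒ-cong : ∀ {T T′ : Vec n → Vec n} → (∀ {x y} → x ≗ y → T x ≗ T y) → (∀ x → T x ≗ T′ x) →
      ∀ x → smoothstepₒ T x ≗ smoothstepₒ T′ x
    smoothstepₒ-cong {T} {T′} T-cong T≗T′ x i = cong₂ (λ s t → six * s + five-eighths * t)
      (A≗ (λ j → step (A≗ (λ _ → refl)) j) i)
      (step (step (T≗T′ x)) i)
      where
      step : ∀ {x y} → x ≗ y → T x ≗ T′ y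
      step x≗y j = trans (T-cong x≗y j) (T≗T′ _ j)
      A≗ : ∀ {x y} → x ≗ y → T (λ i → T x i + - five-quarters * x i) ≗ T′ (λ i → T′ y i + - five-quarters * y i)
      A≗ x≗y = step λ j → cong₂ (λ s t → s + - five-quarters * t) (step x≗y j) (x≗y j)

    -- The identity f(v) + f(1 - v) = 1 between polynomials, applied to an operator.
    smoothstepₒ-complementary : ∀ {T′} → Complementary H T′ → (∀ {x y} → x ≗ y → T′ x ≗ T′ y) →
      Complementary (smoothstepₒ H) (smoothstepₒ T′)
    smoothstepₒ-complementary {T′} complementary T′-cong x i = begin
      smoothstepₒ H x i + smoothstepₒ T′ x i
        ≡⟨ cong₂ _+_ (smoothstepₒ-cong H-cong X≗ x i) (smoothstepₒ-cong T′-cong 1-X≗ x i) ⟩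
      smoothstepₒ (apply H X) x i + smoothstepₒ (apply H 1-X) x i
        ≡⟨ cong₂ _+_ (apply-smoothstep X x i) (apply-smoothstep 1-X x i) ⟨
      apply H (smoothstepₚ X) x i + apply H (smoothstepₚ 1-X) x i
        ≡⟨ apply-⊕ symmetric (smoothstepₚ X) (smoothstepₚ 1-X) x i ⟨
      1ℚ * x i + H (apply H zs x) i
        ≡⟨ cong (1ℚ * x i +_) (H-0 (apply-zeros symmetric zeros x) i) ⟩
      1ℚ * x i + 0ℚ
        ≡⟨ trans (ℚ.+-identityʳ _) (ℚ.*-identityˡ (x i)) ⟩
      x i ∎
      where
      open ≡-Reasoning
      X 1-X : Poly
      X   = 0ℚ ∷ 1ℚ ∷ []
      1-X = 1ℚ ∷ - 1ℚ ∷ []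
      -- Both lists have six closed rational coefficients, and their sum computes to 1 followed by
      -- these five zeros.
      zs = replicate 5 0ℚ
      zeros : All (_≡ 0ℚ) zs
      zeros = refl ∷ refl ∷ refl ∷ refl ∷ refl ∷ []
      linear : ∀ c d x i → apply H (c ∷ d ∷ []) x i ≡ c * x i + d * H x i
      linear c d x i = cong (c * x i +_) (trans (H-cong (λ j → trans (cong (d * x j +_) (H-0 (λ _ → refl) j))
        (ℚ.+-identityʳ _)) i) (H-scale d x i))
      X≗ : ∀ x → H x ≗ apply H X x
      X≗ x i = sym (trans (linear 0ℚ 1ℚ x i) (solve 2 (λ x h → con 0ℚ :* x :+ con 1ℚ :* h := h) refl (x i) (H x i)))
      1-X≗ : ∀ x → T′ x ≗ apply H 1-X x
      1-X≗ x i = sym (trans (linear 1ℚ (- 1ℚ) x i) (trans (cong (λ s → 1ℚ * s + - 1ℚ * H x i) (sym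
        (complementary x i)))
        (solve 2 (λ h t → con 1ℚ :* (h :+ t) :+ con (- 1ℚ) :* h := t) refl (H x i) (T′ x i))))

  Positive : ∀ {n} → (Vec n → Vec n) → Set
  Positive T = ∀ x → 0ℚ ≤ ⟨ x , T x ⟩

  module _ {n} {H : Vec n → Vec n} (symmetric : IsSymmetric H) where

    -- A symmetric factor moves across the inner product, ⟨ x , p v p x ⟩ = ⟨ p x , v (p x) ⟩. Both
    -- summands of smoothstep have this shape, with p = a and p = v.
    positive-smoothstep : ∀ v → Positive (apply H v) → Positive (apply H (smoothstepₚ v))
    positive-smoothstep v v≥0 x = subst (0ℚ ≤_) (sym expand)
      (0≤+ (0≤* (0≤ι 6) (v≥0 (apply H a x))) (0≤* (ℚ.<⇒≤ (ℚ.positive⁻¹ five-eighths)) (v≥0 (apply H v x))))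
      where
      a = v ⊗ (v ⊕ (- five-quarters ∷ []))
      sandwich : ∀ p → ⟨ x , apply H (p ⊗ (v ⊗ p)) x ⟩ ≡ ⟨ apply H p x , apply H v (apply H p x) ⟩
      sandwich p = trans (⟨⟩-congʳ x λ i → trans (apply-⊗ symmetric p (v ⊗ p) x i)
          (apply-cong symmetric p (apply-⊗ symmetric v p x) i))
        (sym (apply-symm symmetric p x _))
      expand : ⟨ x , apply H (smoothstepₚ v) x ⟩ ≡
        six * ⟨ apply H a x , apply H v (apply H a x) ⟩ + five-eighths * ⟨ apply H v x , apply H v (apply H v x) ⟩
      expand = trans (⟨⟩-congʳ x λ i → trans (apply-⊕ symmetric (six ⊙ (a ⊗ (v ⊗ a))) _ x i)
          (cong₂ _+_ (apply-⊙ symmetric six (a ⊗ (v ⊗ a)) x i) (apply-⊙ symmetric five-eighths (v ⊗ (v ⊗ v)) x i)))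
        (trans (⟨⟩-linearʳ x six five-eighths _ _)
          (cong₂ (λ s t → six * s + five-eighths * t) (sandwich a) (sandwich v)))

    complementary-smoothstep : ∀ v v′ → Complementary (apply H v) (apply H v′) →
      Complementary (apply H (smoothstepₚ v)) (apply H (smoothstepₚ v′))
    complementary-smoothstep v v′ complementary x i =
      trans (cong₂ _+_ (apply-smoothstep symmetric v x i) (apply-smoothstep symmetric v′ x i))
        (smoothstepₒ-complementary (apply-isSymmetric symmetric v) complementary (apply-cong symmetric v′) x i)

  trace : ∀ {n} → (Vec n → Vec n) → ℚ
  trace T = ∑ λ i → T (e i) i

  -- Gram operators of a matrix and of its transpose

  module Gram {m n} (B : Fin m → Fin n → ℚ) where
    down : Vec n → Vec m
    down x τ = ⟨ B τ , x ⟩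

    up : Vec m → Vec n
    up y σ = ∑ λ τ → y τ * B τ σ

    K : Vec n → Vec n
    K = up ∘ down

    adjoint : ∀ x y → ⟨ up y , x ⟩ ≡ ⟨ y , down x ⟩
    adjoint x y = begin
      ∑ (λ σ → ∑ (λ τ → y τ * B τ σ) * x σ)       ≡⟨ ∑-cong (λ σ → ∑-distribʳ (x σ) _) ⟩
      ∑ (λ σ → ∑ (λ τ → y τ * B τ σ * x σ))       ≡⟨ ∑-comm (λ σ τ → y τ * B τ σ * x σ) ⟩
      ∑ (λ τ → ∑ (λ σ → y τ * B τ σ * x σ))       ≡⟨ ∑-cong (λ τ → trans (∑-cong λ σ → ℚ.*-assoc (y τ) (B τ σ)
        (x σ)) (sym (∑-distribˡ (y τ) _))) ⟩
      ⟨ y , down x ⟩ ∎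
      where open ≡-Reasoning

    down-cong : ∀ {x y} → x ≗ y → down x ≗ down y
    down-cong x≗y τ = ⟨⟩-congʳ (B τ) x≗y

    up-cong : ∀ {x y} → x ≗ y → up x ≗ up y
    up-cong x≗y σ = ∑-cong λ τ → cong (_* B τ σ) (x≗y τ)

    up-linear : ∀ a b x y → up (λ i → a * x i + b * y i) ≗ λ i → a * up x i + b * up y i
    up-linear a b x y σ = ⟨⟩-linearˡ a b x y (λ τ → B τ σ)

    K-isSymmetric : IsSymmetric K
    K-isSymmetric = record
      { H-cong = up-cong ∘ down-cong
      ; H-linear = λ a b x y σ → trans (up-cong (λ τ → ⟨⟩-linearʳ (B τ) a b x y) σ) (up-linear a b (down x)
        (down y) σ)
      ; H-symm = λ x y → trans (adjoint y (down x)) (trans (⟨⟩-comm (down x) (down y))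
          (trans (sym (adjoint x (down y))) (⟨⟩-comm _ x)))
      }

    ⟨x,Kx⟩ : ∀ x → ⟨ x , K x ⟩ ≡ ⟨ down x , down x ⟩
    ⟨x,Kx⟩ x = trans (⟨⟩-comm x (K x)) (adjoint x (down x))

    -- K is the sum of the rank one operators bbᵀ over the rows b of B, and T bbᵀ has trace ⟨ b , T
    -- b ⟩.
    trace-∘K : ∀ {T} → IsSymmetric T → trace (T ∘ K) ≡ ∑ λ τ → ⟨ B τ , T (B τ) ⟩
    trace-∘K {T} symmetric = begin
      ∑ (λ σ → T (K (e σ)) σ)                       ≡⟨ ∑-cong (λ σ → H-cong (up-cong λ τ → ⟨ B τ ,e⟩ σ) σ) ⟩
      ∑ (λ σ → T (λ ρ → ∑ λ τ → B τ σ * B τ ρ) σ)   ≡⟨ ∑-cong (λ σ → H-∑ (λ τ → B τ σ) B σ) ⟩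
      ∑ (λ σ → ∑ λ τ → B τ σ * T (B τ) σ)           ≡⟨ ∑-comm (λ σ τ → B τ σ * T (B τ) σ) ⟩
      ∑ (λ τ → ⟨ B τ , T (B τ) ⟩)                   ∎
      where
      open ≡-Reasoning
      open IsSymmetric symmetric

  module _ {m n} (B : Fin m → Fin n → ℚ) where
    private
      Bᵀ : Fin n → Fin m → ℚ
      Bᵀ σ τ = B τ σ
      module G = Gram B
      module Gᵀ = Gram Bᵀ
    open G using (K)
    open Gᵀ using () renaming (K to L)

    up-down : ∀ x → G.down x ≗ Gᵀ.up x
    up-down x τ = ⟨⟩-comm (B τ) x

    down-up : ∀ y → G.up y ≗ Gᵀ.down y
    down-up y σ = ⟨⟩-comm y (Bᵀ σ)

    -- B carries K to L because B (BᵀB) = (BBᵀ) B.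
    intertwine : ∀ p x → apply L p (G.down x) ≗ G.down (apply K p x)
    intertwine []      x τ = sym (∑-0 λ σ → ℚ.*-zeroʳ (B τ σ))
    intertwine (c ∷ p) x τ = sym (begin
      ⟨ B τ , (λ σ → c * x σ + K (apply K p x) σ) ⟩
        ≡⟨ ⟨⟩-congʳ (B τ) (λ σ → cong (c * x σ +_) (sym (ℚ.*-identityˡ _))) ⟩
      ⟨ B τ , (λ σ → c * x σ + 1ℚ * K (apply K p x) σ) ⟩
        ≡⟨ ⟨⟩-linearʳ (B τ) c 1ℚ x _ ⟩
      c * G.down x τ + 1ℚ * G.down (K (apply K p x)) τ
        ≡⟨ cong (c * G.down x τ +_) (trans (ℚ.*-identityˡ _) (trans (up-down _ τ) (Gᵀ.up-cong (down-up _) τ))) ⟩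
      c * G.down x τ + L (G.down (apply K p x)) τ
        ≡⟨ cong (c * G.down x τ +_) (IsSymmetric.H-cong Gᵀ.K-isSymmetric (intertwine p x) τ) ⟨
      apply L (c ∷ p) (G.down x) τ ∎)
      where open ≡-Reasoning

    trace-apply : ∀ {k} (H : Vec k → Vec k) c p → trace (apply H (c ∷ p)) ≡ c * ι k + trace (H ∘ apply H p)
    trace-apply {k} H c p = trans (∑-+ (λ i → c * e i i) _) (cong (_+ trace (H ∘ apply H p))
      (trans (∑-cong λ i → trans (cong (c *_) (δ-refl i)) (ℚ.*-identityʳ c)) (trans (∑-const k c) (ℚ.*-comm
        (ι k) c))))

    -- Cyclicity of the trace: `trace-∘K` for the transpose writes the left side through the columns
    -- of B, and `intertwine` moves p from L to K.
    trace-LK : ∀ p → trace (L ∘ apply L p) ≡ trace (K ∘ apply K p)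
    trace-LK p = begin
      ∑ (λ τ → L (apply L p (e τ)) τ)
        ≡⟨ ∑-cong (λ τ → apply-commute Gᵀ.K-isSymmetric p (e τ) τ) ⟨
      ∑ (λ τ → apply L p (L (e τ)) τ)
        ≡⟨ Gᵀ.trace-∘K (apply-isSymmetric Gᵀ.K-isSymmetric p) ⟩
      ∑ (λ σ → ⟨ Bᵀ σ , apply L p (Bᵀ σ) ⟩)
        ≡⟨ ∑-cong (λ σ → ⟨⟩-congʳ (Bᵀ σ) (λ τ → trans (apply-cong Gᵀ.K-isSymmetric p (λ τ → sym (⟨ B τ ,e⟩ σ)) τ)
          (intertwine p (e σ) τ))) ⟩
      ∑ (λ σ → ⟨ Bᵀ σ , G.down (apply K p (e σ)) ⟩)
        ≡⟨ ∑-cong (λ σ → down-up _ σ) ⟨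
      ∑ (λ σ → K (apply K p (e σ)) σ) ∎
      where open ≡-Reasoning

    -- Beyond the constant term p has a factor L or K, where `trace-LK` gives equal traces; the
    -- constant term alone sees the sizes of the two spaces.
    trace-difference : ∀ p → trace (apply L p) - trace (apply K p) ≡ eval p 0ℚ * (ι m - ι n)
    trace-difference [] = trans (cong₂ _-_ (∑-0 {m} λ _ → refl) (∑-0 {n} λ _ → refl)) (sym (ℚ.*-zeroˡ (ι m - ι n)))
    trace-difference (c ∷ p) = begin
      trace (apply L (c ∷ p)) - trace (apply K (c ∷ p))
        ≡⟨ cong₂ _-_ (trace-apply L c p) (trace-apply K c p) ⟩
      c * ι m + trace (L ∘ apply L p) - (c * ι n + trace (K ∘ apply K p))
        ≡⟨ cong (λ t → c * ι m + t - (c * ι n + trace (K ∘ apply K p))) (trace-LK p) ⟩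
      c * ι m + trace (K ∘ apply K p) - (c * ι n + trace (K ∘ apply K p))
        ≡⟨ solve 5 (λ c m n t p → c :* m :+ t :- (c :* n :+ t) := (c :+ con 0ℚ :* p) :* (m :- n)) refl c (ι m)
          (ι n) _ (eval p 0ℚ) ⟩
      eval (c ∷ p) 0ℚ * (ι m - ι n) ∎
      where open ≡-Reasoning

  δ-sym : ∀ {n} (i j : Fin n) → δ i j ≡ δ j i
  δ-sym i j with i Fin.≟ j
  ... | yes refl = sym (δ-refl i)
  ... | no i≢j   = sym (δ-≢ (i≢j ∘ sym))

  ∑-∑-* : ∀ {m n} (f : Fin m → ℚ) (g : Fin n → ℚ) → ∑ (λ i → ∑ λ j → f i * g j) ≡ ∑ f * ∑ g
  ∑-∑-* f g = trans (∑-cong λ i → sym (∑-distribˡ (f i) g)) (sym (∑-distribʳ (∑ g) f))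

  -- Lagrange's identity: the difference is half the sum of all (a i x j - a j x i)².
  cauchy-schwarz : ∀ {n} (a x : Vec n) → ⟨ a , x ⟩ * ⟨ a , x ⟩ ≤ ⟨ a , a ⟩ * ⟨ x , x ⟩
  cauchy-schwarz a x = ≤-from
    (trans (cong (½ *_) expand) (solve 2 (λ p q → con ½ :* ((p :+ p) :- (q :+ q)) := p :- q) refl
      (⟨ a , a ⟩ * ⟨ x , x ⟩) (⟨ a , x ⟩ * ⟨ a , x ⟩)))
    (0≤* 0≤½ (∑-nonneg λ i → ∑-nonneg λ j → 0≤-square (a i * x j - a j * x i)))
    where
    open ≡-Reasoning
    P = ⟨ a , a ⟩ * ⟨ x , x ⟩
    Q = ⟨ a , x ⟩ * ⟨ a , x ⟩
    p q p′ : Fin _ → Fin _ → ℚ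
    p i j = (a i * a i) * (x j * x j)
    p′ i j = (x i * x i) * (a j * a j)
    q i j = (a i * x i) * (a j * x j)
    expand : ∑ (λ i → ∑ λ j → (a i * x j - a j * x i) * (a i * x j - a j * x i)) ≡ (P + P) - (Q + Q)
    expand = begin
      ∑ (λ i → ∑ λ j → (a i * x j - a j * x i) * (a i * x j - a j * x i))
        ≡⟨ ∑-cong (λ i → ∑-cong λ j → solve 4 (λ a b x y →
             (a :* y :- b :* x) :* (a :* y :- b :* x) := ((a :* a) :* (y :* y) :+ (x :* x) :* (b :* b)) :+ :-
               ((a :* x) :* (b :* y) :+ (a :* x) :* (b :* y)))
             refl (a i) (a j) (x i) (x j)) ⟩
      ∑ (λ i → ∑ λ j → (p i j + p′ i j) + - (q i j + q i j))
        ≡⟨ ∑-cong (λ i → trans (∑-+ (λ j → p i j + p′ i j) _) (cong₂ _+_ (∑-+ (p i) (p′ i)) (trans (∑-neg _)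
          (cong -_ (∑-+ (q i) (q i)))))) ⟩
      ∑ (λ i → (∑ (p i) + ∑ (p′ i)) + - (∑ (q i) + ∑ (q i)))
        ≡⟨ trans (∑-+ (λ i → ∑ (p i) + ∑ (p′ i)) _) (cong₂ _+_ (∑-+ (λ i → ∑ (p i)) _) (trans (∑-neg _) (cong -_
          (∑-+ (λ i → ∑ (q i)) _)))) ⟩
      (∑ (λ i → ∑ (p i)) + ∑ (λ i → ∑ (p′ i))) + - (∑ (λ i → ∑ (q i)) + ∑ (λ i → ∑ (q i)))
        ≡⟨ cong₂ (λ s t → s + - t) (cong₂ _+_ (∑-∑-* (λ i → a i * a i) (λ j → x j * x j))
             (trans (∑-∑-* (λ i → x i * x i) (λ j → a j * a j)) (ℚ.*-comm ⟨ x , x ⟩ ⟨ a , a ⟩)))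
             (cong₂ _+_ (∑-∑-* (λ i → a i * x i) (λ j → a j * x j)) (∑-∑-* (λ i → a i * x i) (λ j → a j * x j))) ⟩
      (P + P) - (Q + Q) ∎

  ⟨x,e⟩-expand : ∀ {n} (x : Vec n) i → x i ≡ ∑ λ l → x l * e l i
  ⟨x,e⟩-expand x i = sym (trans (∑-cong λ l → cong (x l *_) (δ-sym i l)) (⟨ x ,e⟩ i))

  module _ {n} {V : Vec n → Vec n} (symmetric : IsSymmetric V) (positive : Positive V) where
    open IsSymmetric symmetric

    diagonal : Fin n → ℚ
    diagonal i = V (e i) i

    ⟨e,V⟩ : ∀ x i → ⟨ e i , V x ⟩ ≡ V x i
    ⟨e,V⟩ x i = trans (⟨⟩-comm (e i) (V x)) (⟨ V x ,e⟩ i)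

    diagonal-nonneg : ∀ i → 0ℚ ≤ diagonal i
    diagonal-nonneg i = subst (0ℚ ≤_) (⟨e,V⟩ (e i) i) (positive (e i))

    -- Positivity on α eᵢ - β eⱼ.
    spike : ∀ α β i j → α * β * V (e j) i + α * β * V (e i) j ≤ α * α * diagonal i + β * β * diagonal j
    spike α β i j = ≤-from (trans expand
        (solve 6 (λ α β x y z w → α :* (α :* x :+ (:- β) :* y) :+ (:- β) :* (α :* z :+ (:- β) :* w)
          := α :* α :* x :+ β :* β :* w :- (α :* β :* y :+ α :* β :* z)) refl α β (V (e i) i) (V (e j) i) (V
            (e i) j) (V (e j) j)))
      (positive y)
      where
      y : Vec n
      y l = α * e i l + - β * e j l
      row : ∀ k → ⟨ e k , V y ⟩ ≡ α * V (e i) k + - β * V (e j) k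
      row k = trans (⟨e,V⟩ y k) (H-linear α (- β) (e i) (e j) k)
      expand : ⟨ y , V y ⟩ ≡ α * (α * V (e i) i + - β * V (e j) i) + - β * (α * V (e i) j + - β * V (e j) j)
      expand = trans (⟨⟩-linearˡ α (- β) (e i) (e j) (V y)) (cong₂ (λ s t → α * s + - β * t) (row i) (row j))

    ⟨a,Va⟩ : ∀ a → ⟨ a , V a ⟩ ≡ ∑ λ i → ∑ λ j → a i * a j * V (e j) i
    ⟨a,Va⟩ a = ∑-cong λ i → trans (cong (a i *_) (trans (H-cong (⟨x,e⟩-expand a) i) (H-∑ a e i)))
      (trans (∑-distribˡ (a i) _) (∑-cong λ j → sym (ℚ.*-assoc (a i) (a j) _)))

    -- The entries of a are -1, 0 or 1, so a i * a i is the indicator of the support. On the support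
    -- `spike` bounds the two mixed terms of each pair by the sum of two diagonal entries, and
    -- summing over all pairs gives the claim twice.
    signed-bound : ∀ a → (∀ i → a i * (a i * a i) ≡ a i) → ⟨ a , V a ⟩ ≤ ⟨ a , a ⟩ * ∑ λ i → a i * a i * diagonal i
    signed-bound a cube = ≤-from
      (solve 2 (λ p q → con ½ :* ((p :+ p) :- (q :+ q)) := p :- q) refl (d * s) h)
      (0≤* 0≤½ (0≤-from doubled))
      where
      d = ⟨ a , a ⟩
      s = ∑ λ i → a i * a i * diagonal i
      h = ⟨ a , V a ⟩
      I : Fin n → ℚ
      I i = a i * a i
      II : ∀ i → I i * I i ≡ I i
      II i = trans (ℚ.*-assoc (a i) (a i) (I i)) (cong (a i *_) (cube i))
      term : ∀ i j → a i * a j * V (e j) i + a i * a j * V (e i) j ≤ I j * (I i * diagonal i) + I i *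
        (I j * diagonal j)
      term i j = ℚ.≤-trans (ℚ.≤-reflexive (cong₂ (λ s t → s * V (e j) i + t * V (e i) j) (sym αβ) (sym αβ)))
        (ℚ.≤-trans (spike α β i j) (ℚ.≤-reflexive (cong₂ _+_
          (trans (cong (_* diagonal i) αα) (ℚ.*-assoc (I j) (I i) _))
          (trans (cong (_* diagonal j) ββ) (ℚ.*-assoc (I i) (I j) _)))))
        where
        -- The indicators make both weights vanish unless i and j both lie in the support.
        α = a i * I j
        β = a j * I i
        αα : α * α ≡ I j * I i
        αα = trans (solve 2 (λ a j → (a :* j) :* (a :* j) := (j :* j) :* (a :* a)) refl (a i) (I j)) (cong
          (_* I i) (II j))
        ββ : β * β ≡ I i * I j
        ββ = trans (solve 2 (λ a j → (a :* j) :* (a :* j) := (j :* j) :* (a :* a)) refl (a j) (I i)) (cong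
          (_* I j) (II i))
        αβ : α * β ≡ a i * a j
        αβ = trans (solve 2 (λ a b → (a :* (b :* b)) :* (b :* (a :* a)) := (a :* (a :* a)) :* (b :*
          (b :* b))) refl (a i) (a j))
          (cong₂ _*_ (cube i) (cube j))
      doubled : h + h ≤ d * s + d * s
      doubled = begin
        h + h
          ≡⟨ cong₂ _+_ (⟨a,Va⟩ a) (trans (⟨a,Va⟩ a) (trans (∑-comm (λ i j → a i * a j * V (e j) i))
               (∑-cong λ i → ∑-cong λ j → cong (_* V (e i) j) (ℚ.*-comm (a j) (a i))))) ⟩
        ∑ (λ i → ∑ λ j → a i * a j * V (e j) i) + ∑ (λ i → ∑ λ j → a i * a j * V (e i) j)
          ≡⟨ trans (∑-cong λ i → ∑-+ (λ j → a i * a j * V (e j) i) _) (∑-+ (λ i → ∑ λ j → a i * a j * V (e j) i) _) ⟨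
        ∑ (λ i → ∑ λ j → a i * a j * V (e j) i + a i * a j * V (e i) j)
          ≤⟨ ∑-mono (λ i → ∑-mono λ j → term i j) ⟩
        ∑ (λ i → ∑ λ j → I j * (I i * diagonal i) + I i * (I j * diagonal j))
          ≡⟨ trans (∑-cong λ i → ∑-+ (λ j → I j * (I i * diagonal i)) _) (∑-+ (λ i → ∑ λ j → I j *
            (I i * diagonal i)) _) ⟩
        ∑ (λ i → ∑ λ j → I j * (I i * diagonal i)) + ∑ (λ i → ∑ λ j → I i * (I j * diagonal j))
          ≡⟨ cong₂ _+_ (trans (∑-comm (λ i j → I j * (I i * diagonal i))) (∑-∑-* I (λ i → I i * diagonal i)))
            (∑-∑-* I (λ j → I j * diagonal j)) ⟩
        d * s + d * s ∎
        where open ℚ.≤-Reasoning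

  -- The trace estimate for 0 ≤ V ≤ I

  module TraceBound {m n} (B : Fin m → Fin n → ℚ) (cube : ∀ τ σ → B τ σ * (B τ σ * B τ σ) ≡ B τ σ)
    (t q : Fin m → ℚ) (T : ℚ) (0≤t : ∀ τ → 0ℚ ≤ t τ) (0≤q : ∀ τ → 0ℚ ≤ q τ)
    (rows : ∀ τ → ⟨ B τ , B τ ⟩ ≡ t τ + q τ)
    (columns : ∀ σ → ∑ (λ τ → B τ σ * B τ σ * t τ) ≤ T) where
    open Gram B

    module _ {V V′ : Vec n → Vec n} (symmetric : IsSymmetric V)
             (V≥0 : Positive V) (V′≥0 : Positive V′) (complementary : Complementary V V′) where
      W : Fin n → ℚ
      W = diagonal symmetric V≥0

      -- For s ≤ 1 it suffices to use (t + q) s, from the diagonal bound, and for s ≥ 1 to use t +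
      -- q, from V ≤ I.
      row-bound : ∀ τ → ⟨ B τ , V (B τ) ⟩ ≤ t τ * ∑ (λ σ → B τ σ * B τ σ * W σ) + q τ
      row-bound τ with ℚ.≤-total s 1ℚ
        where s = ∑ (λ σ → B τ σ * B τ σ * W σ)
      ... | inj₁ s≤1 = begin
        ⟨ B τ , V (B τ) ⟩     ≤⟨ signed-bound symmetric V≥0 (B τ) (cube τ) ⟩
        ⟨ B τ , B τ ⟩ * s     ≡⟨ cong (_* s) (rows τ) ⟩
        (t τ + q τ) * s       ≡⟨ ℚ.*-distribʳ-+ s (t τ) (q τ) ⟩
        t τ * s + q τ * s     ≤⟨ ℚ.+-monoʳ-≤ (t τ * s) (*-monoˡ (0≤q τ) s≤1) ⟩
        t τ * s + q τ * 1ℚ    ≡⟨ cong (t τ * s +_) (ℚ.*-identityʳ (q τ)) ⟩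
        t τ * s + q τ         ∎
        where
        open ℚ.≤-Reasoning
        s = ∑ (λ σ → B τ σ * B τ σ * W σ)
      ... | inj₂ 1≤s = begin
        ⟨ B τ , V (B τ) ⟩     ≤⟨ ≤-from whole (V′≥0 (B τ)) ⟩
        ⟨ B τ , B τ ⟩         ≡⟨ rows τ ⟩
        t τ + q τ             ≡⟨ cong (_+ q τ) (ℚ.*-identityʳ (t τ)) ⟨
        t τ * 1ℚ + q τ        ≤⟨ ℚ.+-monoˡ-≤ (q τ) (*-monoˡ (0≤t τ) 1≤s) ⟩
        t τ * s + q τ         ∎
        where
        open ℚ.≤-Reasoning
        s = ∑ (λ σ → B τ σ * B τ σ * W σ)
        whole : ⟨ B τ , V′ (B τ) ⟩ ≡ ⟨ B τ , B τ ⟩ - ⟨ B τ , V (B τ) ⟩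
        whole = trans (solve 2 (λ x y → x := con 1ℚ :* y :+ con 1ℚ :* x :- y) refl ⟨ B τ , V′ (B τ) ⟩ ⟨ B τ , V
          (B τ) ⟩)
          (cong (_- ⟨ B τ , V (B τ) ⟩) (trans (sym (⟨⟩-linearʳ (B τ) 1ℚ 1ℚ (V (B τ)) (V′ (B τ))))
            (⟨⟩-congʳ (B τ) λ σ → trans (cong₂ _+_ (ℚ.*-identityˡ (V (B τ) σ)) (ℚ.*-identityˡ (V′ (B τ) σ)))
              (complementary (B τ) σ))))

      trace-VK : trace (V ∘ K) ≤ T * ∑ W + ∑ q
      trace-VK = begin
        trace (V ∘ K)
          ≡⟨ trace-∘K symmetric ⟩
        ∑ (λ τ → ⟨ B τ , V (B τ) ⟩)
          ≤⟨ ∑-mono row-bound ⟩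
        ∑ (λ τ → t τ * ∑ (λ σ → B τ σ * B τ σ * W σ) + q τ)
          ≡⟨ ∑-+ (λ τ → t τ * ∑ (λ σ → B τ σ * B τ σ * W σ)) q ⟩
        ∑ (λ τ → t τ * ∑ (λ σ → B τ σ * B τ σ * W σ)) + ∑ q
          ≡⟨ cong (_+ ∑ q) (trans (∑-cong λ τ → trans (∑-distribˡ (t τ) _) (∑-cong λ σ →
               solve 3 (λ t b w → t :* (b :* w) := b :* t :* w) refl (t τ) (B τ σ * B τ σ) (W σ)))
               (∑-comm λ τ σ → B τ σ * B τ σ * t τ * W σ)) ⟩
        ∑ (λ σ → ∑ λ τ → B τ σ * B τ σ * t τ * W σ) + ∑ q
          ≡⟨ cong (_+ ∑ q) (∑-cong λ σ → ∑-distribʳ (W σ) _) ⟨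
        ∑ (λ σ → ∑ (λ τ → B τ σ * B τ σ * t τ) * W σ) + ∑ q
          ≤⟨ ℚ.+-monoˡ-≤ (∑ q) (∑-mono λ σ → *-monoʳ (diagonal-nonneg symmetric V≥0 σ) (columns σ)) ⟩
        ∑ (λ σ → T * W σ) + ∑ q
          ≡⟨ cong (_+ ∑ q) (∑-distribˡ T W) ⟨
        T * ∑ W + ∑ q ∎
        where open ℚ.≤-Reasoning

  -- v₀ = ½ + κ(x - T) and its iterates under smoothstep approximate the indicator of x ≥ T.
  module Threshold (T κ : ℚ) where
    -- `low` stands for 1 - `high`. Its own recursion lets one positivity argument serve for both.
    low high : ℕ → Poly
    high zero    = ½ - κ * T ∷ κ ∷ []
    high (suc N) = smoothstepₚ (high N)
    low zero    = ½ + κ * T ∷ - κ ∷ []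
    low (suc N) = smoothstepₚ (low N)

    eval-high : ∀ N x → eval (high N) x ≡ iterate N (eval (high 0) x)
    eval-high zero    x = refl
    eval-high (suc N) x = trans (eval-smoothstep (high N) x) (cong smoothstep (eval-high N x))

    eval-low : ∀ N x → eval (low N) x ≡ iterate N (eval (low 0) x)
    eval-low zero    x = refl
    eval-low (suc N) x = trans (eval-smoothstep (low N) x) (cong smoothstep (eval-low N x))

    eval-high+low : ∀ N x → eval (high N) x + eval (low N) x ≡ 1ℚ
    eval-high+low zero x = solve 3 (λ T κ x → (con ½ :- κ :* T :+ x :* (κ :+ x :* con 0ℚ)) :+
      (con ½ :+ κ :* T :+ x :* (:- κ :+ x :* con 0ℚ)) := con 1ℚ) refl T κ x
    eval-high+low (suc N) x = trans (cong₂ _+_ (eval-smoothstep (high N) x)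
      (trans (eval-smoothstep (low N) x) (cong smoothstep (trans (solve 2 (λ h l → l := h :+ l :- h) refl h l)
        (cong (_- h) (eval-high+low N x))))))
      (smoothstep-complement h)
      where
      h = eval (high N) x
      l = eval (low N) x

    -- An approximation of max (x - T) 0.
    cut : ℕ → Poly
    cut N = high N ⊗ (- T ∷ 1ℚ ∷ [])

    eval-cut : ∀ N x → eval (cut N) x ≡ eval (high N) x * (x - T)
    eval-cut N x = trans (eval-⊗ (high N) _ x) (cong (eval (high N) x *_)
      (solve 2 (λ T x → :- T :+ x :* (con 1ℚ :+ x :* con 0ℚ) := x :- T) refl T x))

    module _ (0≤κ : 0ℚ ≤ κ) {ε} (0≤ε : 0ℚ ≤ ε) N (large : 1ℚ ≤ κ * ε * ι N) where

      -- The iterates converge slowly for v near ½, but there the weight z, which is proportional to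
      -- v - ½, is small; the product has a bound independent of z.
      converge : ∀ {z v} → 0ℚ ≤ z → κ * z + κ * z ≡ v + v - 1ℚ → z * (1ℚ - iterate N v) ≤ ε
      converge {z} {v} 0≤z eq with ℚ.≤-total Z 0ℚ
        where Z = z * (1ℚ - iterate N v)
      ... | inj₁ Z≤0 = ℚ.≤-trans Z≤0 0≤ε
      ... | inj₂ 0≤Z = begin
        Z                                           ≡⟨ ℚ.*-identityʳ Z ⟨
        Z * 1ℚ                                      ≤⟨ *-monoˡ 0≤Z large ⟩
        Z * (κ * ε * ι N)                           ≡⟨ solve 5 (λ z d κ ε n → z :* d :* (κ :* ε :* n)
          := ε :* con ½ :* (n :* (κ :* z :+ κ :* z) :* d)) refl z (1ℚ - iterate N v) κ ε (ι N) ⟩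
        ε * ½ * (ι N * (κ * z + κ * z) * (1ℚ - iterate N v))
          ≤⟨ *-monoˡ (0≤* 0≤ε 0≤½) (smoothstep-converges eq (0≤+ (0≤* 0≤κ 0≤z) (0≤* 0≤κ 0≤z)) N) ⟩
        ε * ½ * ι 2                                 ≡⟨ solve 1 (λ ε → ε :* con ½ :* con (ι 2) := ε) refl ε ⟩
        ε                                           ∎
        where
        open ℚ.≤-Reasoning
        Z = z * (1ℚ - iterate N v)

      -- To the right of T the error is |x - T| (1 - high), to the left it is |x - T| (1 - low) = |x
      -- - T| high; `converge` bounds both.
      cut-lower : ∀ x → 0ℚ ≤ eval (cut N) x + ε × x - T ≤ eval (cut N) x + ε
      cut-lower x with ℚ.≤-total T x
      ... | inj₁ T≤x = nonneg , ≥z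
        where
        z = x - T
        h = eval (high N) x
        0≤z = 0≤-from T≤x
        Z≤ε : z * (1ℚ - h) ≤ ε
        Z≤ε = subst (λ h → z * (1ℚ - h) ≤ ε) (sym (eval-high N x)) (converge 0≤z
          (solve 3 (λ T κ x → κ :* (x :- T) :+ κ :* (x :- T) :=
            (con ½ :- κ :* T :+ x :* (κ :+ x :* con 0ℚ)) :+ (con ½ :- κ :* T :+ x :*
              (κ :+ x :* con 0ℚ)) :- con 1ℚ) refl T κ x))
        ≥z : z ≤ eval (cut N) x + ε
        ≥z = ≤-from (trans (solve 3 (λ z h ε → ε :- z :* (con 1ℚ :- h) := h :* z :+ ε :- z) refl z h ε)
          (cong (λ c → c + ε - z) (sym (eval-cut N x)))) (0≤-from Z≤ε)
        nonneg = ℚ.≤-trans 0≤z ≥z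
      ... | inj₂ x≤T = nonneg , ℚ.≤-trans (≤-from (solve 2 (λ T x → T :- x := con 0ℚ :-
          (x :- T)) refl T x) 0≤z) nonneg
        where
        z = T - x
        h = eval (high N) x
        l = eval (low N) x
        0≤z = 0≤-from x≤T
        Z≤ε : z * (1ℚ - l) ≤ ε
        Z≤ε = subst (λ l → z * (1ℚ - l) ≤ ε) (sym (eval-low N x)) (converge 0≤z
          (solve 3 (λ T κ x → κ :* (T :- x) :+ κ :* (T :- x) :=
            (con ½ :+ κ :* T :+ x :* (:- κ :+ x :* con 0ℚ)) :+ (con ½ :+ κ :* T :+ x :*
              (:- κ :+ x :* con 0ℚ)) :- con 1ℚ) refl T κ x))
        nonneg : 0ℚ ≤ eval (cut N) x + ε
        nonneg = subst (0ℚ ≤_) (trans (cong (λ s → ε - z * (s - l)) (sym (eval-high+low N x)))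
          (trans (solve 5 (λ T x h l ε → ε :- (T :- x) :* (h :+ l :- l) := h :* (x :- T) :+ ε) refl T x h l ε)
            (cong (_+ ε) (sym (eval-cut N x))))) (0≤-from Z≤ε)

    -- The condition on κ makes v₀ nonnegative at 0, and smoothstep preserves that; the other factor
    -- is -T. This sign controls the correction from K to L.
    cut-at-0 : 0ℚ ≤ T → κ * T ≤ ½ → ∀ N → eval (cut N) 0ℚ ≤ 0ℚ
    cut-at-0 0≤T κT≤½ N = ≤-from (trans (solve 2 (λ h T → h :* T := con 0ℚ :- h :* (con 0ℚ :- T)) refl (eval
      (high N) 0ℚ) T)
        (cong (λ c → 0ℚ - c) (sym (eval-cut N 0ℚ)))) (0≤* (nonneg N) 0≤T)
      where
      nonneg : ∀ N → 0ℚ ≤ eval (high N) 0ℚ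
      nonneg zero    = subst (0ℚ ≤_) (solve 2 (λ T κ → con ½ :- κ :* T := con ½ :- κ :* T :+ con 0ℚ :*
        (κ :+ con 0ℚ :* con 0ℚ)) refl T κ) (0≤-from κT≤½)
      nonneg (suc N) = subst (0ℚ ≤_) (sym (eval-smoothstep (high N) 0ℚ)) (smoothstep-nonneg (nonneg N))

  -- The trace of the approximate positive part of L - T

  module CutTrace {m n} (B : Fin m → Fin n → ℚ) (cube : ∀ τ σ → B τ σ * (B τ σ * B τ σ) ≡ B τ σ)
    (t q : Fin m → ℚ) (T : ℚ) (0≤t : ∀ τ → 0ℚ ≤ t τ) (0≤q : ∀ τ → 0ℚ ≤ q τ)
    (rows : ∀ τ → ⟨ B τ , B τ ⟩ ≡ t τ + q τ)
    (columns : ∀ σ → ∑ (λ τ → B τ σ * B τ σ * t τ) ≤ T) (0≤T : 0ℚ ≤ T) where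
    open Gram B using (K; K-isSymmetric; ⟨x,Kx⟩; down)
    open Gram (λ σ τ → B τ σ) using () renaming (K to L)
    open IsSymmetric K-isSymmetric

    -- The squared Frobenius norm of B, which is the trace of K and bounds K from above.
    C : ℚ
    C = ∑ λ τ → ⟨ B τ , B τ ⟩

    0≤C : 0ℚ ≤ C
    0≤C = ∑-nonneg λ τ → 0≤⟨x,x⟩ (B τ)

    ⟨x,Kx⟩≤ : ∀ x → ⟨ x , K x ⟩ ≤ C * ⟨ x , x ⟩
    ⟨x,Kx⟩≤ x = begin
      ⟨ x , K x ⟩                               ≡⟨ ⟨x,Kx⟩ x ⟩
      ∑ (λ τ → ⟨ B τ , x ⟩ * ⟨ B τ , x ⟩)       ≤⟨ ∑-mono (λ τ → cauchy-schwarz (B τ) x) ⟩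
      ∑ (λ τ → ⟨ B τ , B τ ⟩ * ⟨ x , x ⟩)       ≡⟨ ∑-distribʳ ⟨ x , x ⟩ _ ⟨
      C * ⟨ x , x ⟩                             ∎
      where open ℚ.≤-Reasoning

    -- As 0 ≤ K ≤ C, the operator K - T lies between -T and C, so this κ puts v₀ between 0 and I.
    -- The summand 1 keeps the divisor positive.
    scale : Σ[ κ ∈ ℚ ] (0ℚ < κ × (C + T + 1ℚ) * κ ≡ ½)
    scale = divide (ℚ.positive⁻¹ ½) (ℚ.+-mono-≤-< (0≤+ 0≤C 0≤T) 0<1)

    κ : ℚ
    κ = proj₁ scale

    0<κ : 0ℚ < κ
    0<κ = proj₁ (proj₂ scale)

    0≤κ : 0ℚ ≤ κ
    0≤κ = ℚ.<⇒≤ 0<κ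

    open Threshold T κ

    κT≤½ : κ * T ≤ ½
    κT≤½ = ≤-from (trans (solve 3 (λ C T κ → (C :+ con 1ℚ) :* κ := (C :+ T :+ con 1ℚ) :* κ :- κ :* T) refl C T κ)
      (cong (_- κ * T) (proj₂ (proj₂ scale)))) (0≤* (0≤+ 0≤C (0≤ι 1)) 0≤κ)

    apply-linearₚ : ∀ c d x i → apply K (c ∷ d ∷ []) x i ≡ c * x i + d * K x i
    apply-linearₚ c d x i = cong (c * x i +_) (trans (H-cong (λ j → trans (cong (d * x j +_) (H-0 (λ _ → refl) j))
      (ℚ.+-identityʳ _)) i) (H-scale d x i))

    ⟨x,linear⟩ : ∀ c d x → ⟨ x , apply K (c ∷ d ∷ []) x ⟩ ≡ c * ⟨ x , x ⟩ + d * ⟨ x , K x ⟩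
    ⟨x,linear⟩ c d x = trans (⟨⟩-congʳ x (apply-linearₚ c d x)) (⟨⟩-linearʳ x c d x (K x))

    high≥0 : ∀ N → Positive (apply K (high N))
    high≥0 zero x = subst (0ℚ ≤_) (sym (⟨x,linear⟩ (½ - κ * T) κ x))
      (0≤+ (0≤* (0≤-from κT≤½) (0≤⟨x,x⟩ x)) (0≤* 0≤κ (subst (0ℚ ≤_) (sym (⟨x,Kx⟩ x)) (0≤⟨x,x⟩ (down x)))))
    high≥0 (suc N) = positive-smoothstep K-isSymmetric (high N) (high≥0 N)

    low≥0 : ∀ N → Positive (apply K (low N))
    low≥0 zero x = subst (0ℚ ≤_)
      (trans (solve 6 (λ C T κ u w k → κ :* (C :* u :- w) :+ (κ :* T :+ κ :* T :+ κ) :* u :=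
        ((C :+ T :+ con 1ℚ) :* κ :+ κ :* T) :* u :+ (:- κ) :* w) refl C T κ ⟨ x , x ⟩ ⟨ x , K x ⟩ 0ℚ)
        (trans (cong (λ h → (h + κ * T) * ⟨ x , x ⟩ + - κ * ⟨ x , K x ⟩) (proj₂ (proj₂ scale))) (sym (⟨x,linear⟩
          (½ + κ * T) (- κ) x))))
      (0≤+ (0≤* 0≤κ (0≤-from (⟨x,Kx⟩≤ x))) (0≤* (0≤+ (0≤+ (0≤* 0≤κ 0≤T) (0≤* 0≤κ 0≤T)) 0≤κ) (0≤⟨x,x⟩ x)))
    low≥0 (suc N) = positive-smoothstep K-isSymmetric (low N) (low≥0 N)

    complementary : ∀ N → Complementary (apply K (high N)) (apply K (low N))
    complementary zero x i = trans (cong₂ _+_ (apply-linearₚ (½ - κ * T) κ x i) (apply-linearₚ (½ + κ * T) (- κ) x i))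
      (solve 4 (λ T κ x k → (con ½ :- κ :* T) :* x :+ κ :* k :+ ((con ½ :+ κ :* T) :* x :+ (:- κ) :* k)
        := x) refl T κ (x i) (K x i))
    complementary (suc N) = complementary-smoothstep K-isSymmetric (high N) (low N) (complementary N)

    -- The cut contributes -T tr V, which cancels the term T tr V of `trace-VK`.
    trace-cut-K : ∀ N → trace (apply K (cut N)) ≤ ∑ q
    trace-cut-K N = begin
      trace (apply K (cut N))
        ≡⟨ ∑-cong (λ i → trans (apply-⊗ K-isSymmetric (high N) _ (e i) i)
             (trans (V.H-cong (apply-linearₚ (- T) 1ℚ (e i)) i) (V.H-linear (- T) 1ℚ (e i) (K (e i)) i))) ⟩
      ∑ (λ i → - T * V (e i) i + 1ℚ * V (K (e i)) i)
        ≡⟨ trans (∑-+ (λ i → - T * V (e i) i) _) (cong₂ _+_ (sym (∑-distribˡ (- T) _)) (∑-cong λ i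
          → ℚ.*-identityˡ _)) ⟩
      - T * trace V + trace (V ∘ K)
        ≤⟨ ℚ.+-monoʳ-≤ (- T * trace V) (TraceBound.trace-VK B cube t q T 0≤t 0≤q rows columns
             V-symmetric (high≥0 N) (low≥0 N) (complementary N)) ⟩
      - T * trace V + (T * trace V + ∑ q)
        ≡⟨ solve 3 (λ T w s → :- T :* w :+ (T :* w :+ s) := s) refl T (trace V) (∑ q) ⟩
      ∑ q ∎
      where
      open ℚ.≤-Reasoning
      V = apply K (high N)
      V-symmetric = apply-isSymmetric K-isSymmetric (high N)
      module V = IsSymmetric V-symmetric

    trace-cut-L : ∀ {ε} → 0ℚ ≤ ε → ∀ N → 1ℚ ≤ κ * ε * ι N → trace (apply L (cut N)) ≤ ∑ q + ε * ι n
    trace-cut-L {ε} 0≤ε N large = begin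
      trace (apply L (cut N))
        ≡⟨ solve 2 (λ l k → l := k :+ (l :- k)) refl (trace (apply L (cut N))) (trace (apply K (cut N))) ⟩
      trace (apply K (cut N)) + (trace (apply L (cut N)) - trace (apply K (cut N)))
        ≤⟨ ℚ.+-mono-≤ (trace-cut-K N) (ℚ.≤-reflexive (trace-difference B (cut N))) ⟩
      ∑ q + c * (ι m - ι n)
        -- Since -ε ≤ c ≤ 0, the number c (m - n) is at most εn whatever the sign of m - n.
        ≤⟨ ≤-from (solve 5 (λ q c m n ε → (c :+ ε) :* n :+ (con 0ℚ :- c) :* m := (q :+ ε :* n) :- (q :+ c :*
          (m :- n))) refl (∑ q) c (ι m) (ι n) ε)
             (0≤+ (0≤* (proj₁ (cut-lower 0≤κ 0≤ε N large 0ℚ)) (0≤ι n)) (0≤* (0≤-from (cut-at-0 0≤T κT≤½ N))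
               (0≤ι m))) ⟩
      ∑ q + ε * ι n ∎
      where
      open ℚ.≤-Reasoning
      c = eval (cut N) 0ℚ

open Operators

-- Eigenvalues over the Cauchy reals

open import Defs

module RealSpectrum where
  open Polynomial ℚ.+-*-commutativeRing using (Poly; eval)

  -- The operations act termwise, so the ring laws of `ℝ` hold with equal sequences.
  pointwise : ∀ {x y} → (∀ n → seq x n ≡ seq y n) → x ≈ y
  pointwise {x} {y} x≡y = mk≈ λ ε 0<ε → 0 , λ n _ → ≡.subst (ℚ._< ε)
    (≡.sym (≡.cong ℚ.∣_∣ (≡.trans (≡.cong (ℚ._- seq y n) (x≡y n)) (ℚ.+-inverseʳ (seq y n))))) 0<ε

  ≈-sym : ∀ {x y} → x ≈ y → y ≈ x
  ≈-sym {x} {y} (mk≈ x≈y) = mk≈ λ ε 0<ε → let N , h = x≈y ε 0<ε in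
    N , λ n N≤n → ≡.subst (ℚ._< ε)
      (≡.trans (≡.sym (ℚ.∣-p∣≡∣p∣ (seq x n ℚ.- seq y n)))
        (≡.cong ℚ.∣_∣ (solve 2 (λ a b → :- (a :- b) := b :- a) ≡.refl (seq x n) (seq y n))))
      (h n N≤n)
    where open +-*-Solver using (solve; _:=_; _:+_; _:*_; _:-_; :-_)

  halves : ∀ {a b ε} c → a ℚ.+ b ≡ c → ℚ.∣ a ∣ ℚ.< ε ℚ.* ½ → ℚ.∣ b ∣ ℚ.< ε ℚ.* ½ → ℚ.∣ c ∣ ℚ.< ε
  halves {a} {b} {ε = ε} c a+b≡c a<ε b<ε = begin-strict
    ℚ.∣ c ∣               ≡⟨ ≡.cong ℚ.∣_∣ a+b≡c ⟨
    ℚ.∣ a ℚ.+ b ∣         ≤⟨ ℚ.∣p+q∣≤∣p∣+∣q∣ a b ⟩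
    ℚ.∣ a ∣ ℚ.+ ℚ.∣ b ∣   <⟨ ℚ.+-mono-< a<ε b<ε ⟩
    ε ℚ.* ½ ℚ.+ ε ℚ.* ½   ≡⟨ half+half ε ⟩
    ε                     ∎
    where open ℚ.≤-Reasoning

  ≈-trans : ∀ {x y z} → x ≈ y → y ≈ z → x ≈ z
  ≈-trans {x} {y} {z} (mk≈ x≈y) (mk≈ y≈z) = mk≈ λ ε 0<ε →
    let M , g = x≈y _ (half-pos 0<ε) ; N , h = y≈z _ (half-pos 0<ε) in
    M ℕ.⊔ N , λ n p → halves _
      (solve 3 (λ a b c → (a :- b) :+ (b :- c) := a :- c) ≡.refl (seq x n) (seq y n) (seq z n))
      (g n (ℕ.m⊔n≤o⇒m≤o M N p)) (h n (ℕ.m⊔n≤o⇒n≤o M N p))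
    where open +-*-Solver using (solve; _:=_; _:+_; _:*_; _:-_; :-_)

  +ᴿ-cong : ∀ {x x′ y y′} → x ≈ x′ → y ≈ y′ → x +ᴿ y ≈ x′ +ᴿ y′
  +ᴿ-cong {x} {x′} {y} {y′} (mk≈ x≈x′) (mk≈ y≈y′) = mk≈ λ ε 0<ε →
    let M , g = x≈x′ _ (half-pos 0<ε) ; N , h = y≈y′ _ (half-pos 0<ε) in
    M ℕ.⊔ N , λ n p → halves _ (≡.sym (sub-+ (seq x n) (seq y n) (seq x′ n) (seq y′ n)))
      (g n (ℕ.m⊔n≤o⇒m≤o M N p)) (h n (ℕ.m⊔n≤o⇒n≤o M N p))

  -ᴿ-cong : ∀ {x y} → x ≈ y → -ᴿ x ≈ -ᴿ y
  -ᴿ-cong {x} {y} (mk≈ x≈y) = mk≈ λ ε 0<ε → let N , h = x≈y ε 0<ε in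
    N , λ n N≤n → ≡.subst (ℚ._< ε)
      (≡.trans (≡.sym (ℚ.∣-p∣≡∣p∣ _)) (≡.cong ℚ.∣_∣ (neg-sub (seq x n) (seq y n)))) (h n N≤n)

  *ᴿ-cong : ∀ {x x′ y y′} → x ≈ x′ → y ≈ y′ → x *ᴿ y ≈ x′ *ᴿ y′
  *ᴿ-cong {x} {x′} {y} {y′} (mk≈ x≈x′) (mk≈ y≈y′) = mk≈ λ ε 0<ε →
    let B , 0<B , N₁ , b = eventually-bounded x
        C , 0<C , N₂ , c = eventually-bounded y′
        δ , 0<δ , Sδ≡ε   = divide 0<ε (+-pos B C 0<B 0<C)
        N₃ , h₃          = x≈x′ δ 0<δ
        N₄ , h₄          = y≈y′ δ 0<δ
    in (N₁ ℕ.⊔ N₂) ℕ.⊔ (N₃ ℕ.⊔ N₄) , λ n p →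
       let p₁₂ = ℕ.m⊔n≤o⇒m≤o (N₁ ℕ.⊔ N₂) (N₃ ℕ.⊔ N₄) p
           p₃₄ = ℕ.m⊔n≤o⇒n≤o (N₁ ℕ.⊔ N₂) (N₃ ℕ.⊔ N₄) p
       in *-near (seq x n) (seq y n) (seq x′ n) (seq y′ n) 0<B 0<C Sδ≡ε
            (b n (ℕ.m⊔n≤o⇒m≤o N₁ N₂ p₁₂)) (c n (ℕ.m⊔n≤o⇒n≤o N₁ N₂ p₁₂))
            (h₄ n (ℕ.m⊔n≤o⇒n≤o N₃ N₄ p₃₄)) (h₃ n (ℕ.m⊔n≤o⇒m≤o N₃ N₄ p₃₄))

  ℝ-commutativeRing : CommutativeRing 0ℓ 0ℓ
  ℝ-commutativeRing = record
    { Carrier = ℝ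
    ; _≈_ = _≈_
    ; _+_ = _+ᴿ_
    ; _*_ = _*ᴿ_
    ; -_ = -ᴿ_
    ; 0# = fromℚ 0ℚ
    ; 1# = fromℚ 1ℚ
    ; isCommutativeRing = record
      { isRing = record
        { +-isAbelianGroup = record
          { isGroup = record
            { isMonoid = record
              { isSemigroup = record
                { isMagma = record
                  { isEquivalence = record { refl = pointwise λ _ → ≡.refl ; sym = ≈-sym ; trans = ≈-trans }
                  ; ∙-cong = +ᴿ-cong
                  }
                ; assoc = λ x y z → pointwise λ n → ℚ.+-assoc (seq x n) (seq y n) (seq z n)
                }
              ; identity = (λ x → pointwise λ n → ℚ.+-identityˡ (seq x n)) , (λ x → pointwise λ n → ℚ.+-identityʳ
                (seq x n))
              }
            ; inverse = (λ x → pointwise λ n → ℚ.+-inverseˡ (seq x n)) , (λ x → pointwise λ n → ℚ.+-inverseʳ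
              (seq x n))
            ; ⁻¹-cong = -ᴿ-cong
            }
          ; comm = λ x y → pointwise λ n → ℚ.+-comm (seq x n) (seq y n)
          }
        ; *-cong = *ᴿ-cong
        ; *-assoc = λ x y z → pointwise λ n → ℚ.*-assoc (seq x n) (seq y n) (seq z n)
        ; *-identity = (λ x → pointwise λ n → ℚ.*-identityˡ (seq x n)) , (λ x → pointwise λ n → ℚ.*-identityʳ
          (seq x n))
        ; distrib = (λ x y z → pointwise λ n → ℚ.*-distribˡ-+ (seq x n) (seq y n) (seq z n))
                  , (λ x y z → pointwise λ n → ℚ.*-distribʳ-+ (seq x n) (seq y n) (seq z n))
        }
      ; *-comm = λ x y → pointwise λ n → ℚ.*-comm (seq x n) (seq y n)
      }
    }

  -- The number n + 1, by a recursion that makes strict growth immediate. These are the sample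
  -- points z, so the characteristic polynomial is used at the values 1 / (n + 1).
  positiveInteger : ℕ → ℚ
  positiveInteger zero    = 1ℚ
  positiveInteger (suc n) = 1ℚ ℚ.+ positiveInteger n

  positiveInteger-< : ∀ m k → positiveInteger m ℚ.< positiveInteger (suc k ℕ.+ m)
  positiveInteger-< m zero    = ≡.subst (ℚ._< positiveInteger (suc m)) (ℚ.+-identityˡ _) (ℚ.+-monoˡ-<
    (positiveInteger m) 0<1)
  positiveInteger-< m (suc k) = ℚ.<-trans (positiveInteger-< m k) (positiveInteger-< (suc k ℕ.+ m) zero)

  positiveInteger-pos : ∀ n → 0ℚ ℚ.< positiveInteger n
  positiveInteger-pos zero    = 0<1
  positiveInteger-pos (suc n) = ℚ.<-trans (positiveInteger-pos n) (positiveInteger-< n zero)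

  open PowerSeries ℝ-commutativeRing using (IsPowers; δ)
  open Polynomial ℝ-commutativeRing using (Separated; trace-powers)
  open Algebra.Definitions.RawSemiring (Semiring.rawSemiring (CommutativeRing.semiring ℝ-commutativeRing)) using (_^_)
  private
    module ℝ′ = CommutativeRing ℝ-commutativeRing
    module Σᴿ = Summation ℝ-commutativeRing

  points : ℕ → ℝ
  points n = fromℚ (positiveInteger n)

  reciprocal : ∀ n → Σ[ q ∈ ℚ ] (0ℚ ℚ.< q × positiveInteger n ℚ.* q ≡ 1ℚ)
  reciprocal n = divide 0<1 (positiveInteger-pos n)

  -- The difference of two points is a positive rational and has a rational inverse.
  points-separated : Separated points
  points-separated m n m<n c zₙc≈zₘc = begin
    c                                          ≈⟨ pointwise (λ i → ≡.trans (≡.sym (ℚ.*-identityˡ (seq c i)))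
                                                    (≡.trans (≡.cong (ℚ._* seq c i) (≡.sym de≡1))
                                                    (rearrange (positiveInteger n) (positiveInteger m) d⁻¹
                                                      (seq c i)))) ⟩
    fromℚ d⁻¹ *ᴿ (points n *ᴿ c +ᴿ -ᴿ (points m *ᴿ c))  ≈⟨ *-congˡ (x≈y⇒x∙y⁻¹≈ε zₙc≈zₘc) ⟩
    fromℚ d⁻¹ *ᴿ fromℚ 0ℚ                        ≈⟨ zeroʳ _ ⟩
    fromℚ 0ℚ                                   ∎
    where
    open CommutativeRing ℝ-commutativeRing using (setoid; *-congˡ; zeroʳ; ring)
    open import Algebra.Properties.Ring ring using (x≈y⇒x∙y⁻¹≈ε)
    open import Relation.Binary.Reasoning.Setoid setoid
    d = positiveInteger n ℚ.- positiveInteger m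
    0<d : 0ℚ ℚ.< d
    0<d = ≡.subst (ℚ._< d) (ℚ.+-inverseʳ (positiveInteger m)) (ℚ.+-monoˡ-< (ℚ.- positiveInteger m)
      (≡.subst (λ k → positiveInteger m ℚ.< positiveInteger k)
        (≡.trans (≡.sym (ℕ.+-suc (n ℕ.∸ suc m) m)) (ℕ.m∸n+n≡m m<n)) (positiveInteger-< m (n ℕ.∸ suc m))))
    inverse = divide 0<1 0<d
    d⁻¹ = proj₁ inverse
    de≡1 = proj₂ (proj₂ inverse)
    rearrange : ∀ p q e c → (p ℚ.- q) ℚ.* e ℚ.* c ≡ e ℚ.* (p ℚ.* c ℚ.+ ℚ.- (q ℚ.* c))
    rearrange = solve 4 (λ p q e c → (p :- q) :* e :* c := e :* (p :* c :+ :- (q :* c))) ≡.refl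
      where open +-*-Solver using (solve; _:=_; _:+_; _:*_; _:-_; :-_)

  eigenvalue-power-sums : ∀ {n} {A : Matrix ℝ n} {μ} → IsEigenvalueList A μ → ∀ {P} → IsPowers A P → ∀ m →
    Σᴿ.∑ (λ i → P (suc m) i i) ≈ Σᴿ.∑ (λ i → μ i ^ suc m)
  eigenvalue-power-sums {A = A} {μ} isEigenvalueList isPowers m =
    trace-powers points (λ n → fromℚ (proj₁ (reciprocal n)))
      (λ n → pointwise λ _ → proj₂ (proj₂ (reciprocal n))) points-separated
      A μ (IsEigenvalueList.characteristic isEigenvalueList) isPowers m

  fromℚ-∑ : ∀ {n} (f : Fin n → ℚ) → fromℚ (Σℚ.∑ f) ≈ Σᴿ.∑ (fromℚ ∘ f)
  fromℚ-∑ {zero}  f = ℝ′.trans (ℝ′.reflexive (≡.cong fromℚ (Σℚ.∑-zero f))) (ℝ′.sym (Σᴿ.∑-zero _))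
  fromℚ-∑ {suc n} f = ℝ′.trans (ℝ′.reflexive (≡.cong fromℚ (Σℚ.∑-suc f)))
    (ℝ′.trans (pointwise λ _ → ≡.refl) (ℝ′.trans (ℝ′.+-congˡ (fromℚ-∑ (f ∘ suc))) (ℝ′.sym (Σᴿ.∑-suc _))))

  seq-∑ : ∀ {n} (f : Fin n → ℝ) s → seq (∑ f) s ≡ Σℚ.∑ (λ i → seq (f i) s)
  seq-∑ {zero}  f s = ≡.sym (Σℚ.∑-zero _)
  seq-∑ {suc n} f s = ≡.trans (≡.cong (seq (f zero) s ℚ.+_) (seq-∑ (f ∘ suc) s)) (≡.sym (Σℚ.∑-suc _))

  evalᴿ : Poly → ℝ → ℝ
  evalᴿ []      x = fromℚ 0ℚ
  evalᴿ (c ∷ p) x = fromℚ c +ᴿ x *ᴿ evalᴿ p x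

  seq-evalᴿ : ∀ p x s → seq (evalᴿ p x) s ≡ eval p (seq x s)
  seq-evalᴿ []      x s = ≡.refl
  seq-evalᴿ (c ∷ p) x s = ≡.cong (λ v → c ℚ.+ seq x s ℚ.* v) (seq-evalᴿ p x s)

  power : ∀ {n} → (Vec n → Vec n) → ℕ → Vec n → Vec n
  power H zero    x = x
  power H (suc s) x = H (power H s x)

  sum-inject≤ : ∀ {k n} (k≤n : k ℕ.≤ n) (f : Fin n → ℚ) → (∀ i → 0ℚ ℚ.≤ f i) →
    Σℚ.∑ (λ i → f (inject≤ i k≤n)) ℚ.≤ Σℚ.∑ f
  sum-inject≤ {zero} k≤n f 0≤f = ℚ.≤-trans (ℚ.≤-reflexive (Σℚ.∑-zero _)) (∑-nonneg 0≤f)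
  sum-inject≤ {suc k} {suc n} k≤n f 0≤f = ℚ.≤-trans (ℚ.≤-reflexive (Σℚ.∑-suc _))
    (ℚ.≤-trans (ℚ.+-monoʳ-≤ (f zero) (sum-inject≤ (ℕ.s≤s⁻¹ k≤n) (f ∘ suc) (0≤f ∘ suc)))
      (ℚ.≤-reflexive (≡.sym (Σℚ.∑-suc f))))

  module _ {n} {H : Vec n → Vec n} (symmetric : IsSymmetric H) {A : Matrix ℝ n}
           (A≡H : ∀ i j → A i j ≡ fromℚ (H (e j) i)) {μ : Fin n → ℝ} (isEigenvalueList : IsEigenvalueList A μ) where
    open IsSymmetric symmetric

    powers : ℕ → Matrix ℝ n
    powers s i j = fromℚ (power H s (e i) j)

    powers-isPowers : IsPowers A powers
    powers-isPowers = record { P-zero = identity ; P-suc = λ s i j → begin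
        fromℚ (H (power H s (e i)) j)
          ≈⟨ ℝ′.reflexive (≡.cong fromℚ (≡.trans (H-cong (⟨x,e⟩-expand (power H s (e i))) j) (H-∑ (power H s
            (e i)) e j))) ⟩
        fromℚ (Σℚ.∑ λ l → power H s (e i) l ℚ.* H (e l) j)
          ≈⟨ fromℚ-∑ _ ⟩
        Σᴿ.∑ (λ l → fromℚ (power H s (e i) l ℚ.* H (e l) j))
          ≈⟨ Σᴿ.∑-cong (λ l → ℝ′.trans (pointwise λ _ → ≡.refl)
               (ℝ′.*-congˡ {fromℚ (power H s (e i) l)} (ℝ′.reflexive (≡.trans (≡.cong fromℚ
                 (entries-symmetric j l)) (≡.sym (A≡H l j)))))) ⟩
        Σᴿ.∑ (λ l → powers s i l *ᴿ A l j) ∎ }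
      where
      open Relation.Binary.Reasoning.Setoid ℝ′.setoid
      identity : ∀ i j → fromℚ (e i j) ≈ δ i j
      identity i j with i Fin.≟ j | j Fin.≟ i
      ... | yes _   | yes _   = ℝ′.refl
      ... | no _    | no _    = ℝ′.refl
      ... | yes i≡j | no j≢i  = ⊥-elim (j≢i (≡.sym i≡j))
      ... | no i≢j  | yes j≡i = ⊥-elim (i≢j (≡.sym j≡i))
      -- `A l j` is an entry of H (e j), while expanding the next power in the basis produces H (e
      -- l).
      entries-symmetric : ∀ i j → H (e j) i ≡ H (e i) j
      entries-symmetric i j = ≡.trans (≡.sym (⟨ H (e j) ,e⟩ i)) (≡.trans (H-symm (e j) (e i))
        (≡.trans (⟨⟩-comm (e j) (H (e i))) (⟨ H (e i) ,e⟩ j)))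

    trace-power : ∀ s → Σᴿ.∑ (λ i → μ i ^ s) ≈ fromℚ (trace (power H s))
    trace-power zero = ℝ′.sym (ℝ′.trans (fromℚ-∑ {n} _) (Σᴿ.∑-cong λ i → ℝ′.reflexive (≡.cong fromℚ (δℚ-refl i))))
      where open PowerSeries ℚ.+-*-commutativeRing using () renaming (δ-refl to δℚ-refl)
    trace-power (suc s) = ℝ′.trans (ℝ′.sym (eigenvalue-power-sums isEigenvalueList powers-isPowers s)) (ℝ′.sym
      (fromℚ-∑ _))

    -- The factor `μ i ^ s` strengthens the claim for induction: each Horner step moves one
    -- multiplication from the polynomial into the power.
    trace-eval-power : ∀ p s → Σᴿ.∑ (λ i → evalᴿ p (μ i) *ᴿ μ i ^ s) ≈ fromℚ (trace (apply H p ∘ power H s))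
    trace-eval-power [] s = ℝ′.trans (Σᴿ.∑-0 λ i → ℝ′.zeroˡ _) (ℝ′.reflexive (≡.cong fromℚ (≡.sym (Σℚ.∑-0 {n} λ _
      → ≡.refl))))
    trace-eval-power (c ∷ p) s = begin
      Σᴿ.∑ (λ i → (fromℚ c +ᴿ μ i *ᴿ evalᴿ p (μ i)) *ᴿ μ i ^ s)
        ≈⟨ Σᴿ.∑-cong (λ i → ℝ′.trans (ℝ′.distribʳ (μ i ^ s) (fromℚ c) (μ i *ᴿ evalᴿ p (μ i)))
             (ℝ′.+-congˡ {fromℚ c *ᴿ μ i ^ s} (ℝ′.trans (ℝ′.*-congʳ {μ i ^ s} (ℝ′.*-comm (μ i) (evalᴿ p (μ i))))
               (ℝ′.*-assoc (evalᴿ p (μ i)) (μ i) (μ i ^ s))))) ⟩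
      Σᴿ.∑ (λ i → fromℚ c *ᴿ μ i ^ s +ᴿ evalᴿ p (μ i) *ᴿ μ i ^ suc s)
        ≈⟨ Σᴿ.∑-+ (λ i → fromℚ c *ᴿ μ i ^ s) _ ⟩
      Σᴿ.∑ (λ i → fromℚ c *ᴿ μ i ^ s) +ᴿ Σᴿ.∑ (λ i → evalᴿ p (μ i) *ᴿ μ i ^ suc s)
        ≈⟨ ℝ′.+-cong (ℝ′.trans (ℝ′.sym (Σᴿ.∑-distribˡ (fromℚ c) (λ i → μ i ^ s))) (ℝ′.*-congˡ (trace-power s)))
          (trace-eval-power p (suc s)) ⟩
      fromℚ c *ᴿ fromℚ (trace (power H s)) +ᴿ fromℚ (trace (apply H p ∘ power H (suc s)))
        ≈⟨ pointwise (λ _ → ≡.sym combine) ⟩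
      fromℚ (trace (apply H (c ∷ p) ∘ power H s)) ∎
      where
      open Relation.Binary.Reasoning.Setoid ℝ′.setoid
      combine : trace (apply H (c ∷ p) ∘ power H s) ≡ c ℚ.* trace (power H s) ℚ.+ trace (apply H p ∘ power H (suc s))
      combine = ≡.trans (Σℚ.∑-+ (λ i → c ℚ.* power H s (e i) i) _) (≡.cong₂ ℚ._+_ (≡.sym (Σℚ.∑-distribˡ c _))
        (Σℚ.∑-cong λ i → ≡.sym (apply-commute symmetric p (power H s (e i)) i)))

    trace-eval : ∀ p → Σᴿ.∑ (λ i → evalᴿ p (μ i)) ≈ fromℚ (trace (apply H p))
    trace-eval p = ℝ′.trans (Σᴿ.∑-cong λ i → ℝ′.sym (ℝ′.*-identityʳ (evalᴿ p (μ i)))) (trace-eval-power p 0)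

    -- The polynomials p stand for max (x - T) 0, up to an error η from below.
    eigenvalue-sum-bound : ∀ {k} (k≤n : k ℕ.≤ n) T Q → (w : ℚ) → 0ℚ ℚ.≤ w →
      (∀ η → 0ℚ ℚ.< η → Σ[ p ∈ Poly ]
        (∀ x → 0ℚ ℚ.≤ eval p x ℚ.+ η × x ℚ.- T ℚ.≤ eval p x ℚ.+ η) × trace (apply H p) ℚ.≤ Q ℚ.+ η ℚ.* w) →
      ∑ (λ (i : Fin k) → μ (inject≤ i k≤n)) ≤ fromℚ (ι k ℚ.* T ℚ.+ Q)
    eigenvalue-sum-bound {k} k≤n T Q w 0≤w approx = mk≤ λ ε 0<ε →
      let η , 0<η , Sη≡ε = divide 0<ε (0<S)
          p , p≥ , tr≤   = approx η 0<η
          N , h          = _≈_.null (trace-eval p) η 0<η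
      in N , λ s N≤s → go s ε η Sη≡ε p p≥ tr≤ (h s N≤s)
      where
      -- The total error is nη from adding η to every summand, ηw from the bound on the trace, and η
      -- from approximating the trace at index s.
      S : ℚ
      S = ι n ℚ.+ w ℚ.+ 1ℚ
      0<S : 0ℚ ℚ.< S
      0<S = ℚ.+-mono-≤-< (0≤+ (0≤ι n) 0≤w) 0<1
      seq-Σᴿ : ∀ f s → seq (Σᴿ.∑ {n} f) s ≡ Σℚ.∑ (λ i → seq (f i) s)
      seq-Σᴿ f s = ≡.trans (≡.cong (λ x → seq x s) (Σᴿ.∑≡sum f)) (seq-∑ f s)
      go : ∀ s ε η → S ℚ.* η ≡ ε → ∀ p →
        (∀ x → 0ℚ ℚ.≤ eval p x ℚ.+ η × x ℚ.- T ℚ.≤ eval p x ℚ.+ η) → trace (apply H p) ℚ.≤ Q ℚ.+ η ℚ.* w →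
        ℚ.∣ seq (Σᴿ.∑ (λ i → evalᴿ p (μ i))) s ℚ.- trace (apply H p) ∣ ℚ.< η →
        seq (∑ (λ (i : Fin k) → μ (inject≤ i k≤n))) s ℚ.≤ ι k ℚ.* T ℚ.+ Q ℚ.+ ε
      -- The whole estimate takes place at one index s, with the rationals m i in place of the
      -- eigenvalues.
      go s ε η Sη≡ε p p≥ tr≤ near = begin
        seq (∑ (λ i → μ (inject≤ i k≤n))) s
          ≡⟨ seq-∑ (λ i → μ (inject≤ i k≤n)) s ⟩
        Σℚ.∑ (λ i → m (inject≤ i k≤n))
          ≤⟨ ∑-mono (λ i → ≤-from (solve 4 (λ x T p η → p :+ η :- (x :- T) := T :+ (p :+ η) :- x) ≡.refl (m
            (inject≤ i k≤n)) T (P (inject≤ i k≤n)) η)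
               (0≤-from (proj₂ (p≥ (m (inject≤ i k≤n)))))) ⟩
        Σℚ.∑ (λ i → T ℚ.+ (P (inject≤ i k≤n) ℚ.+ η))
          ≡⟨ Σℚ.∑-+ (λ _ → T) _ ⟩
        Σℚ.∑ {k} (λ _ → T) ℚ.+ Σℚ.∑ (λ i → P (inject≤ i k≤n) ℚ.+ η)
          -- Each p(m i) + η is nonnegative, so the sum may be extended from the first k indices to
          -- all of them, where it is a trace.
          ≤⟨ ℚ.+-mono-≤ (ℚ.≤-reflexive (∑-const k T)) (sum-inject≤ k≤n (λ i → P i ℚ.+ η) (λ i → proj₁ (p≥ (m i)))) ⟩
        ι k ℚ.* T ℚ.+ Σℚ.∑ (λ i → P i ℚ.+ η)
          ≡⟨ ≡.cong (ι k ℚ.* T ℚ.+_) (≡.trans (Σℚ.∑-+ P _) (≡.cong (Σℚ.∑ P ℚ.+_) (∑-const n η))) ⟩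
        ι k ℚ.* T ℚ.+ (Σℚ.∑ P ℚ.+ ι n ℚ.* η)
          ≤⟨ ℚ.+-monoʳ-≤ (ι k ℚ.* T) (ℚ.+-monoˡ-≤ (ι n ℚ.* η) ΣP≤) ⟩
        ι k ℚ.* T ℚ.+ (η ℚ.+ (Q ℚ.+ η ℚ.* w) ℚ.+ ι n ℚ.* η)
          ≡⟨ solve 5 (λ kT η Q w n → kT :+ (η :+ (Q :+ η :* w) :+ n :* η) := kT :+ Q :+
            (n :+ w :+ con 1ℚ) :* η) ≡.refl (ι k ℚ.* T) η Q w (ι n) ⟩
        ι k ℚ.* T ℚ.+ Q ℚ.+ S ℚ.* η
          ≡⟨ ≡.cong (ι k ℚ.* T ℚ.+ Q ℚ.+_) Sη≡ε ⟩
        ι k ℚ.* T ℚ.+ Q ℚ.+ ε ∎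
        where
        open ℚ.≤-Reasoning
        open +-*-Solver using (solve; _:=_; _:+_; _:*_; _:-_; :-_; con)
        m P : Fin n → ℚ
        m i = seq (μ i) s
        P i = eval p (m i)
        X = seq (Σᴿ.∑ (λ i → evalᴿ p (μ i))) s
        X≡ΣP : X ≡ Σℚ.∑ P
        X≡ΣP = ≡.trans (seq-Σᴿ _ s) (Σℚ.∑-cong λ i → seq-evalᴿ p (μ i) s)
        p≤∣p∣ : ∀ x → x ℚ.≤ ℚ.∣ x ∣
        p≤∣p∣ x with ℚ.∣p∣≡p∨∣p∣≡-p x
        ... | inj₁ ∣x∣≡x = ℚ.≤-reflexive (≡.sym ∣x∣≡x)
        ... | inj₂ ∣x∣≡-x = ≤-from ≡.refl (≡.subst (λ y → 0ℚ ℚ.≤ y ℚ.- x) (≡.sym ∣x∣≡-x) (0≤+ 0≤-x 0≤-x))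
          where
          0≤-x = ≡.subst (0ℚ ℚ.≤_) ∣x∣≡-x (ℚ.0≤∣p∣ x)
        ΣP≤ : Σℚ.∑ P ℚ.≤ η ℚ.+ (Q ℚ.+ η ℚ.* w)
        ΣP≤ = begin
          Σℚ.∑ P                                        ≡⟨ X≡ΣP ⟨
          X                                             ≡⟨ sub-add X (trace (apply H p)) ⟩
          X ℚ.- trace (apply H p) ℚ.+ trace (apply H p)   ≤⟨ ℚ.+-mono-≤ (ℚ.≤-trans (p≤∣p∣ _) (ℚ.<⇒≤ near)) tr≤ ⟩
          η ℚ.+ (Q ℚ.+ η ℚ.* w)                          ∎

  module _ {m n} (B : Fin m → Fin n → ℚ) (cube : ∀ τ σ → B τ σ ℚ.* (B τ σ ℚ.* B τ σ) ≡ B τ σ)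
    (t q : Fin m → ℚ) (T : ℚ) (0≤t : ∀ τ → 0ℚ ℚ.≤ t τ) (0≤q : ∀ τ → 0ℚ ℚ.≤ q τ)
    (rows : ∀ τ → ⟨ B τ , B τ ⟩ ≡ t τ ℚ.+ q τ)
    (columns : ∀ σ → Σℚ.∑ (λ τ → B τ σ ℚ.* B τ σ ℚ.* t τ) ℚ.≤ T) (0≤T : 0ℚ ℚ.≤ T)
    {A : Matrix ℝ m} (A≡BBᵀ : ∀ i j → A i j ≡ fromℚ ⟨ B i , B j ⟩)
    {μ : Fin m → ℝ} (isEigenvalueList : IsEigenvalueList A μ) where
    open CutTrace B cube t q T 0≤t 0≤q rows columns 0≤T
    open Threshold T κ

    incidence-spectral-bound : ∀ {k} (k≤m : k ℕ.≤ m) →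
      ∑ (λ (i : Fin k) → μ (inject≤ i k≤m)) ≤ fromℚ (ι k ℚ.* T ℚ.+ Σℚ.∑ q)
    incidence-spectral-bound k≤m = eigenvalue-sum-bound (Gram.K-isSymmetric (λ σ τ → B τ σ)) A≡L isEigenvalueList
      k≤m T (Σℚ.∑ q) (ι n) (0≤ι n) λ η 0<η →
        let 0≤η = ℚ.<⇒≤ 0<η
            N , large = steps η 0<η
        in cut N , cut-lower 0≤κ 0≤η N large , trace-cut-L 0≤η N large
      where
      A≡L : ∀ i j → A i j ≡ fromℚ (Gram.K (λ σ τ → B τ σ) (e j) i)
      A≡L i j = ≡.trans (A≡BBᵀ i j) (≡.cong fromℚ (Σℚ.∑-cong λ σ →
        ≡.trans (ℚ.*-comm (B i σ) (B j σ)) (≡.cong (ℚ._* B i σ) (≡.sym (⟨ (λ τ → B τ σ) ,e⟩ j)))))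
      steps : ∀ η → 0ℚ ℚ.< η → ∃[ N ] 1ℚ ℚ.≤ κ ℚ.* η ℚ.* ι N
      steps η 0<η = let ρ , _ , κηρ≡1 = divide 0<1 0<κη ; N , ρ≤N = archimedean ρ in
        N , ℚ.≤-trans (ℚ.≤-reflexive (≡.sym κηρ≡1)) (*-monoˡ (ℚ.<⇒≤ 0<κη) ρ≤N)
        where
        0<κη : 0ℚ ℚ.< κ ℚ.* η
        0<κη = ≡.subst (ℚ._< κ ℚ.* η) (ℚ.*-zeroˡ η) (ℚ.*-monoˡ-<-pos η {{ℚ.positive 0<η}} 0<κ)

open RealSpectrum

-- Simplices, colours and the boundary matrix

module Combinatorics where
  open import Data.Integer.Base using (+_)
  open import Data.Rational.Base using (_/_)
  open ≡ using (_≗_; refl; sym; trans; cong; cong₂; subst; module ≡-Reasoning)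
  open +-*-Solver using (solve; _:=_; _:+_; _:*_; _:-_; :-_; con)
  open Σℚ hiding (∑; ∑-syntax)
  private module Σ = Σℚ

  -- The Iverson bracket. Counting is done with rational sums of brackets, so that the exchange and
  -- comparison of sums apply; `ι-injective` leads back to `ℕ`.
  ⟦_⟧ : ∀ {A : Set} → Dec A → ℚ
  ⟦ d ⟧ = if does d then 1ℚ else 0ℚ

  ⟦⟧-yes : ∀ {A : Set} (d : Dec A) → A → ⟦ d ⟧ ≡ 1ℚ
  ⟦⟧-yes (yes _) a = refl
  ⟦⟧-yes (no ¬a) a = ⊥-elim (¬a a)

  ⟦⟧-no : ∀ {A : Set} (d : Dec A) → ¬ A → ⟦ d ⟧ ≡ 0ℚ
  ⟦⟧-no (yes a) ¬a = ⊥-elim (¬a a)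
  ⟦⟧-no (no _)  ¬a = refl

  ⟦⟧-cong : ∀ {A B : Set} (d : Dec A) (d′ : Dec B) → (A → B) → (B → A) → ⟦ d ⟧ ≡ ⟦ d′ ⟧
  ⟦⟧-cong (yes a) d′ f g = sym (⟦⟧-yes d′ (f a))
  ⟦⟧-cong (no ¬a) d′ f g = sym (⟦⟧-no d′ (¬a ∘ g))

  ⟦⟧-nonneg : ∀ {A : Set} (d : Dec A) → 0ℚ ℚ.≤ ⟦ d ⟧
  ⟦⟧-nonneg (yes _) = 0≤ι 1
  ⟦⟧-nonneg (no _)  = ℚ.≤-refl

  1-⟦⟧-nonneg : ∀ {A : Set} (d : Dec A) → 0ℚ ℚ.≤ 1ℚ ℚ.- ⟦ d ⟧
  1-⟦⟧-nonneg (yes _) = ℚ.≤-refl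
  1-⟦⟧-nonneg (no _)  = 0≤ι 1

  ⟦⟧-idem : ∀ {A : Set} (d : Dec A) → ⟦ d ⟧ ℚ.* ⟦ d ⟧ ≡ ⟦ d ⟧
  ⟦⟧-idem (yes _) = refl
  ⟦⟧-idem (no _)  = refl

  ⟦⟧-× : ∀ {A B : Set} (d : Dec A) (d′ : Dec B) → ⟦ d ×-dec d′ ⟧ ≡ ⟦ d ⟧ ℚ.* ⟦ d′ ⟧
  ⟦⟧-× (yes _) d′ = sym (ℚ.*-identityˡ ⟦ d′ ⟧)
  ⟦⟧-× (no _)  d′ = sym (ℚ.*-zeroˡ ⟦ d′ ⟧)

  ι-suc : ∀ m → ι (suc m) ≡ 1ℚ ℚ.+ ι m
  ι-suc m = ι-+ 1 m

  ι-injective : ∀ {m n} → ι m ≡ ι n → m ≡ n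
  ι-injective {m} {n} eq = ℤ.+-injective (cong ℚ.↥_ (trans (sym (/1≡ (+ m))) (trans eq (/1≡ (+ n)))))

  ι-<-irrefl : ∀ m → ¬ ι (suc m) ℚ.≤ ι m
  ι-<-irrefl m p = ℚ.<-irrefl refl (ℚ.<-≤-trans
    (subst (ℚ._< ι (suc m)) (ℚ.+-identityˡ (ι m)) (subst (0ℚ ℚ.+ ι m ℚ.<_) (sym (ι-suc m)) (ℚ.+-monoˡ-<
      (ι m) 0<1))) p)

  length-filter-∑ : ∀ {A : Set} {P : Pred A 0ℓ} (P? : Decidable P) xs →
    ι (length (filter P? xs)) ≡ Σ.∑ λ i → ⟦ P? (lookup xs i) ⟧
  length-filter-∑ P? [] = sym (∑-zero _)
  length-filter-∑ P? (x ∷ xs) with does (P? x) in eq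
  ... | true  = trans (ι-suc (length (filter P? xs))) (trans (cong₂ ℚ._+_ (cong (λ b → if b then 1ℚ else 0ℚ)
      (sym eq)) (length-filter-∑ P? xs)) (sym (∑-suc (λ i → ⟦ P? (lookup (x ∷ xs) i) ⟧))))
  ... | false = trans (sym (ℚ.+-identityˡ (ι (length (filter P? xs))))) (trans (cong₂ ℚ._+_ (cong (λ b
      → if b then 1ℚ else 0ℚ) (sym eq)) (length-filter-∑ P? xs)) (sym (∑-suc (λ i → ⟦ P? (lookup (x ∷ xs) i) ⟧))))

  count-∑ : ∀ {n} {P : Pred (Fin n) 0ℓ} (P? : Decidable P) → ι (count P?) ≡ Σ.∑ λ v → ⟦ P? v ⟧
  count-∑ P? = go P? id
    where
    go : ∀ {m n} {P : Pred (Fin n) 0ℓ} (P? : Decidable P) (g : Fin m → Fin n) →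
      ι (length (filter P? (tabulate g))) ≡ Σ.∑ λ v → ⟦ P? (g v) ⟧
    go {zero}  P? g = sym (∑-zero _)
    go {suc m} P? g with does (P? (g zero)) in eq
    ... | true  = trans (ι-suc (length (filter P? (tabulate (g ∘ suc))))) (trans (cong₂ ℚ._+_ (cong (λ b
        → if b then 1ℚ else 0ℚ) (sym eq)) (go P? (g ∘ suc))) (sym (∑-suc (λ v → ⟦ P? (g v) ⟧))))
    ... | false = trans (sym (ℚ.+-identityˡ (ι (length (filter P? (tabulate (g ∘ suc))))))) (trans (cong₂ ℚ._+_
        (cong (λ b → if b then 1ℚ else 0ℚ) (sym eq)) (go P? (g ∘ suc))) (sym (∑-suc (λ v → ⟦ P? (g v) ⟧))))

  ∣p∣-∑ : ∀ {n} (p : Subset n) → ι ∣ p ∣ ≡ Σ.∑ λ v → ⟦ v ∈? p ⟧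
  ∣p∣-∑ []            = sym (∑-zero _)
  ∣p∣-∑ (inside ∷ p)  = trans (ι-suc ∣ p ∣) (trans (cong (1ℚ ℚ.+_) (∣p∣-∑ p)) (sym (∑-suc (λ v → ⟦ v ∈?
    (inside ∷ p) ⟧))))
  ∣p∣-∑ (outside ∷ p) = trans (sym (ℚ.+-identityˡ (ι ∣ p ∣))) (trans (cong (0ℚ ℚ.+_) (∣p∣-∑ p)) (sym (∑-suc (λ v
    → ⟦ v ∈? (outside ∷ p) ⟧))))

  ∑-unique : ∀ {m} {P : Pred (Fin m) 0ℓ} (P? : Decidable P) → (∀ {i j} → P i → P j → i ≡ j) →
    Σ.∑ (λ i → ⟦ P? i ⟧) ℚ.≤ 1ℚ
  ∑-unique P? unique with Fin.any? P?
  ... | no ¬∃ = ℚ.≤-trans (ℚ.≤-reflexive (∑-0 λ i → ⟦⟧-no (P? i) λ p → ¬∃ (i , p))) (0≤ι 1)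
  ... | yes (i , p) = ℚ.≤-reflexive (trans
    (∑-single _ i λ l l≢i → ⟦⟧-no (P? l) λ p′ → l≢i (unique p′ p)) (⟦⟧-yes (P? i) p))

  ∑∑-unique : ∀ {m n} {P : Fin m → Fin n → Set} (P? : ∀ i j → Dec (P i j)) →
    (∀ {i j i′ j′} → P i j → P i′ j′ → i ≡ i′ × j ≡ j′) →
    Σ.∑ (λ i → Σ.∑ λ j → ⟦ P? i j ⟧) ℚ.≤ 1ℚ
  ∑∑-unique P? unique with Fin.any? (λ i → Fin.any? (P? i))
  ... | no ¬∃ = ℚ.≤-trans (ℚ.≤-reflexive (∑-0 λ i → ∑-0 λ j → ⟦⟧-no (P? i j) λ p → ¬∃ (i , j , p))) (0≤ι 1)
  ... | yes (i , j , p) = ℚ.≤-trans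
    (ℚ.≤-reflexive (∑-single _ i λ l l≢i → ∑-0 λ j′ → ⟦⟧-no (P? l j′) λ p′ → l≢i (proj₁ (unique p′ p))))
    (∑-unique (P? i) λ p p′ → proj₂ (unique p p′))

  ∣p∪q∣+∣p∩q∣ : ∀ {n} (p q : Subset n) → ∣ p ∪ q ∣ ℕ.+ ∣ p ∩ q ∣ ≡ ∣ p ∣ ℕ.+ ∣ q ∣
  ∣p∪q∣+∣p∩q∣ []            []            = refl
  ∣p∪q∣+∣p∩q∣ (inside ∷ p)  (inside ∷ q)  = cong suc (trans (ℕ.+-suc _ _) (trans (cong suc (∣p∪q∣+∣p∩q∣ p q)) (sym
    (ℕ.+-suc _ _))))
  ∣p∪q∣+∣p∩q∣ (inside ∷ p)  (outside ∷ q) = cong suc (∣p∪q∣+∣p∩q∣ p q)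
  ∣p∪q∣+∣p∩q∣ (outside ∷ p) (inside ∷ q)  = trans (cong suc (∣p∪q∣+∣p∩q∣ p q)) (sym (ℕ.+-suc _ _))
  ∣p∪q∣+∣p∩q∣ (outside ∷ p) (outside ∷ q) = ∣p∪q∣+∣p∩q∣ p q

  ∣p─q∣+∣p∩q∣ : ∀ {n} (p q : Subset n) → ∣ p ─ q ∣ ℕ.+ ∣ p ∩ q ∣ ≡ ∣ p ∣
  ∣p─q∣+∣p∩q∣ []            []            = refl
  ∣p─q∣+∣p∩q∣ (inside ∷ p)  (inside ∷ q)  = trans (ℕ.+-suc _ _) (cong suc (∣p─q∣+∣p∩q∣ p q))
  ∣p─q∣+∣p∩q∣ (inside ∷ p)  (outside ∷ q) = cong suc (∣p─q∣+∣p∩q∣ p q)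
  ∣p─q∣+∣p∩q∣ (outside ∷ p) (inside ∷ q)  = ∣p─q∣+∣p∩q∣ p q
  ∣p─q∣+∣p∩q∣ (outside ∷ p) (outside ∷ q) = ∣p─q∣+∣p∩q∣ p q

  x∈p─q⇒x∉q : ∀ {n} {x : Fin n} p q → x ∈ p ─ q → x ∉ q
  x∈p─q⇒x∉q (inside ∷ p)  (outside ∷ q) here      ()
  x∈p─q⇒x∉q (_ ∷ p)       (inside ∷ q)  (there x∈) (there x∈q) = x∈p─q⇒x∉q p q x∈ x∈q
  x∈p─q⇒x∉q (_ ∷ p)       (outside ∷ q) (there x∈) (there x∈q) = x∈p─q⇒x∉q p q x∈ x∈q

  x∈p─q⇒x∈p : ∀ {n} {x : Fin n} p q → x ∈ p ─ q → x ∈ p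
  x∈p─q⇒x∈p p q = p─q⊆p p q

  ⊆∧≥⇒≡ : ∀ {n} {p q : Subset n} → p ⊆ q → ∣ q ∣ ℕ.≤ ∣ p ∣ → p ≡ q
  ⊆∧≥⇒≡ {p = p} {q} p⊆q ∣q∣≤∣p∣ = ⊆-antisym p⊆q λ {x} x∈q → q⊆p x∈q
    where
    q⊆p : q ⊆ p
    q⊆p {x} x∈q with x ∈? p
    ... | yes x∈p = x∈p
    ... | no x∉p  = ⊥-elim (ℕ.<⇒≱ (p⊂q⇒∣p∣<∣q∣ (p⊆q , x , x∈q , x∉p)) ∣q∣≤∣p∣)

  ∪-least : ∀ {n} {p q s : Subset n} → p ⊆ s → q ⊆ s → p ∪ q ⊆ s
  ∪-least {p = p} {q} p⊆s q⊆s x∈ with x∈p∪q⁻ p q x∈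
  ... | inj₁ x∈p = p⊆s x∈p
  ... | inj₂ x∈q = q⊆s x∈q

  x≢y⇒∣p∣≥2 : ∀ {n} {x y : Fin n} {p} → x ∈ p → y ∈ p → x ≢ y → ¬ ∣ p ∣ ℕ.≤ 1
  x≢y⇒∣p∣≥2 {x = x} {y} {p} x∈p y∈p x≢y ∣p∣≤1 =
    x≢y (sym (x∈⁅y⁆⇒x≡y x (subst (y ∈_) (sym (⊆∧≥⇒≡ ⁅x⁆⊆p (subst (∣ p ∣ ℕ.≤_) (sym (∣⁅x⁆∣≡1 x)) ∣p∣≤1))) y∈p)))
    where
    ⁅x⁆⊆p : ⁅ x ⁆ ⊆ p
    ⁅x⁆⊆p z∈ = subst (_∈ p) (sym (x∈⁅y⁆⇒x≡y x z∈)) x∈p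

  ∣p∣≡1⇒member : ∀ {n} (p : Subset n) → ∣ p ∣ ≡ 1 → ∃[ x ] x ∈ p
  ∣p∣≡1⇒member {n} p ∣p∣≡1 with nonempty? p
  ... | yes ne = ne
  ... | no ¬ne = ⊥-elim (ℕ.0≢1+n (trans (sym (trans (cong ∣_∣ (Empty-unique λ ne → ¬ne ne)) (∣⊥∣≡0 n))) ∣p∣≡1))

  unique-member : ∀ {n} {x y : Fin n} (p : Subset n) → ∣ p ∣ ≡ 1 → x ∈ p → y ∈ p → x ≡ y
  unique-member {x = x} {y} p ∣p∣≡1 x∈p y∈p with x Fin.≟ y
  ... | yes x≡y = x≡y
  ... | no x≢y  = ⊥-elim (x≢y⇒∣p∣≥2 x∈p y∈p x≢y (ℕ.≤-reflexive ∣p∣≡1))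

  ∈-subsets : ∀ {n} (p : Subset n) → p ∈ₗ subsets n
  ∈-subsets []            = Any.here refl
  ∈-subsets (inside ∷ p)  = ∈-++⁺ʳ (map (outside ∷_) (subsets _)) (∈-map⁺ (inside ∷_) (∈-subsets p))
  ∈-subsets (outside ∷ p) = ∈-++⁺ˡ (∈-map⁺ (outside ∷_) (∈-subsets p))

  subsets-unique : ∀ n → Unique (subsets n)
  subsets-unique zero    = All.[] ∷ []
  subsets-unique (suc n) = Unique.++⁺ (Unique.map⁺ Vec.∷-injectiveʳ (subsets-unique n))
    (Unique.map⁺ Vec.∷-injectiveʳ (subsets-unique n)) disjoint
    where
    disjoint : ∀ {p} → ¬ (p ∈ₗ map (outside ∷_) (subsets n) × p ∈ₗ map (inside ∷_) (subsets n))
    disjoint (p∈ , p∈′) with ∈-map⁻ (outside ∷_) p∈ | ∈-map⁻ (inside ∷_) p∈′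
    ... | _ , _ , refl | _ , _ , ()

  lookup-injective : ∀ {A : Set} {xs : List A} → Unique xs → ∀ i j → lookup xs i ≡ lookup xs j → i ≡ j
  lookup-injective (x∉ ∷ _) zero    zero    _  = refl
  lookup-injective (x∉ ∷ _) zero    (suc j) eq = ⊥-elim (All.lookup x∉ (∈-lookup j) eq)
  lookup-injective (x∉ ∷ _) (suc i) zero    eq = ⊥-elim (All.lookup x∉ (∈-lookup i) (sym eq))
  lookup-injective (_ ∷ u)  (suc i) (suc j) eq = cong suc (lookup-injective u i j eq)

  -- Simplices as an indexed family

  module Simplices {n : ℕ} (X : SimplicialComplex n) where
    open SimplicialComplex X

    simplex : ∀ {m} → Fin (f X m) → Subset n
    simplex {m} = lookup (simplices X m)

    private
      P? : ∀ m → Decidable (λ σ → Face σ × ∣ σ ∣ ≡ m)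
      P? m σ = face? σ ×-dec (∣ σ ∣ ℕ.≟ m)

    simplex-face : ∀ {m} (i : Fin (f X m)) → Face (simplex i)
    simplex-face {m} i = proj₁ (proj₂ (∈-filter⁻ (P? m) {xs = subsets n} (∈-lookup i)))

    simplex-size : ∀ {m} (i : Fin (f X m)) → ∣ simplex i ∣ ≡ m
    simplex-size {m} i = proj₂ (proj₂ (∈-filter⁻ (P? m) {xs = subsets n} (∈-lookup i)))

    simplex-injective : ∀ {m} (i j : Fin (f X m)) → simplex i ≡ simplex j → i ≡ j
    simplex-injective {m} = lookup-injective (Unique.filter⁺ (P? m) (subsets-unique n))

    simplex-index : ∀ {m σ} → Face σ → ∣ σ ∣ ≡ m → ∃[ i ] simplex {m} i ≡ σ
    simplex-index {m} {σ} face size = Any.index σ∈ , sym (lookup-index σ∈)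
      where
      σ∈ : σ ∈ₗ simplices X m
      σ∈ = ∈-filter⁺ (P? m) (∈-subsets σ) (face , size)

    deg-∑ : ∀ r τ → ι (deg X r τ) ≡ Σ.∑ λ i → ⟦ τ ⊆? simplex {suc r} i ⟧
    deg-∑ r τ = length-filter-∑ (τ ⊆?_) (simplices X (suc r))

  facet-complement : ∀ {n r} {τ σ : Subset n} → ∣ τ ∣ ≡ r → ∣ σ ∣ ≡ suc r → τ ⊆ σ → ∣ σ ─ τ ∣ ≡ 1
  facet-complement {r = r} {τ} {σ} ∣τ∣ ∣σ∣ τ⊆σ = ℕ.+-cancelʳ-≡ r _ _
    (trans (cong (∣ σ ─ τ ∣ ℕ.+_) (trans (sym ∣τ∣) (cong ∣_∣ (sym σ∩τ≡τ)))) (trans (∣p─q∣+∣p∩q∣ σ τ) ∣σ∣))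
    where
    σ∩τ≡τ : σ ∩ τ ≡ τ
    σ∩τ≡τ = ⊆-antisym (p∩q⊆q σ τ) λ x∈τ → x∈p∩q⁺ (τ⊆σ x∈τ , x∈τ)

  -- The only vertex of σ outside τ is v, so a vertex of τ′ outside τ would be v, which τ′ avoids.
  facet-unique : ∀ {n r} {τ τ′ σ : Subset n} {v} → ∣ τ ∣ ≡ r → ∣ τ′ ∣ ≡ r → ∣ σ ∣ ≡ suc r → τ ⊆ σ → τ′ ⊆ σ →
    v ∈ σ → v ∉ τ → v ∉ τ′ → τ ≡ τ′
  facet-unique {τ = τ} {τ′} {σ} {v} ∣τ∣ ∣τ′∣ ∣σ∣ τ⊆σ τ′⊆σ v∈σ v∉τ v∉τ′ =
    sym (⊆∧≥⇒≡ τ′⊆τ (ℕ.≤-reflexive (trans ∣τ∣ (sym ∣τ′∣))))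
    where
    τ′⊆τ : τ′ ⊆ τ
    τ′⊆τ {x} x∈τ′ with x ∈? τ
    ... | yes x∈τ = x∈τ
    ... | no x∉τ  = ⊥-elim (v∉τ′ (subst (_∈ τ′) (unique-member (σ ─ τ) (facet-complement ∣τ∣ ∣σ∣ τ⊆σ)
          (x∈p∧x∉q⇒x∈p─q (τ′⊆σ x∈τ′) x∉τ) (x∈p∧x∉q⇒x∈p─q v∈σ v∉τ)) x∈τ′))

  cofacet-unique : ∀ {n r} {τ σ σ′ : Subset n} {v} → ∣ τ ∣ ≡ r → ∣ σ ∣ ≡ suc r → ∣ σ′ ∣ ≡ suc r → τ ⊆ σ → τ ⊆ σ′ →
    v ∈ σ → v ∈ σ′ → v ∉ τ → σ ≡ σ′
  cofacet-unique {τ = τ} {σ} {σ′} {v} ∣τ∣ ∣σ∣ ∣σ′∣ τ⊆σ τ⊆σ′ v∈σ v∈σ′ v∉τ = ⊆∧≥⇒≡ σ⊆σ′ (ℕ.≤-reflexive (trans ∣σ′∣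
    (sym ∣σ∣)))
    where
    σ⊆σ′ : σ ⊆ σ′
    σ⊆σ′ {x} x∈σ with x ∈? τ
    ... | yes x∈τ = τ⊆σ′ x∈τ
    ... | no x∉τ  = subst (_∈ σ′) (unique-member (σ ─ τ) (facet-complement ∣τ∣ ∣σ∣ τ⊆σ)
          (x∈p∧x∉q⇒x∈p─q v∈σ v∉τ) (x∈p∧x∉q⇒x∈p─q x∈σ x∉τ)) v∈σ′

  -- Colours of vertices

  module Colouring {n r : ℕ} (X : SimplicialComplex n) (partite : Partite X (suc r)) where
    open SimplicialComplex X
    private
      V = proj₁ partite
    colour : Fin n → Fin (suc r)
    colour v = proj₁ (proj₁ (proj₂ partite) v)

    ∈-colour : ∀ v → v ∈ V (colour v)
    ∈-colour v = proj₁ (proj₂ (proj₁ (proj₂ partite) v))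

    colour-unique : ∀ {v i} → v ∈ V i → colour v ≡ i
    colour-unique {v} = proj₂ (proj₂ (proj₁ (proj₂ partite) v))

    monochromatic : ∀ {σ} → Face σ → ∀ {v w} → v ∈ σ → w ∈ σ → colour v ≡ colour w → v ≡ w
    monochromatic {σ} face {v} {w} v∈σ w∈σ same with v Fin.≟ w
    ... | yes v≡w = v≡w
    ... | no v≢w  = ⊥-elim (x≢y⇒∣p∣≥2 (x∈p∩q⁺ (v∈σ , ∈-colour v))
            (x∈p∩q⁺ (w∈σ , subst (λ i → w ∈ V i) (sym same) (∈-colour w))) v≢w (proj₂ (proj₂ partite) face
              (colour v)))

    -- Pigeonhole: σ has r + 1 vertices and at most one of each colour, so a missing colour would
    -- leave at most r.
    rainbow : ∀ {σ} → Face σ → ∣ σ ∣ ≡ suc r → ∀ i → ¬ (∀ w → w ∈ σ → colour w ≢ i)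
    rainbow {σ} face ∣σ∣ i missing = ι-<-irrefl r (begin
      ι (suc r)
        ≡⟨ trans (cong ι (sym ∣σ∣)) (∣p∣-∑ σ) ⟩
      Σ.∑ (λ v → ⟦ v ∈? σ ⟧)
        ≡⟨ ∑-cong split ⟨
      Σ.∑ (λ v → Σ.∑ λ j → ⟦ v ∈? (σ ∩ V j) ⟧)
        ≡⟨ ∑-comm (λ v j → ⟦ v ∈? (σ ∩ V j) ⟧) ⟩
      Σ.∑ (λ j → Σ.∑ λ v → ⟦ v ∈? (σ ∩ V j) ⟧)
        ≤⟨ ∑-mono bound ⟩
      Σ.∑ (λ j → 1ℚ ℚ.+ ℚ.- ⟦ j Fin.≟ i ⟧)
        ≡⟨ trans (∑-+ {suc r} (λ _ → 1ℚ) _) (cong₂ ℚ._+_ (trans (∑-const (suc r) 1ℚ) (ℚ.*-identityʳ (ι (suc r))))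
          (∑-neg _)) ⟩
      ι (suc r) ℚ.- Σ.∑ (λ j → ⟦ j Fin.≟ i ⟧)
        ≡⟨ cong₂ ℚ._-_ (ι-suc r) (trans (∑-single _ i λ l l≢i → ⟦⟧-no (l Fin.≟ i) l≢i) (⟦⟧-yes (i Fin.≟ i) refl)) ⟩
      1ℚ ℚ.+ ι r ℚ.- 1ℚ
        ≡⟨ solve 1 (λ r → con 1ℚ :+ r :- con 1ℚ := r) refl (ι r) ⟩
      ι r ∎)
      where
      open ℚ.≤-Reasoning
      split : ∀ v → Σ.∑ (λ j → ⟦ v ∈? (σ ∩ V j) ⟧) ≡ ⟦ v ∈? σ ⟧
      split v = trans (∑-single _ (colour v) λ j j≢ → ⟦⟧-no (v ∈? (σ ∩ V j)) λ v∈ →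
          j≢ (sym (colour-unique (proj₂ (x∈p∩q⁻ σ (V j) v∈)))))
        (⟦⟧-cong (v ∈? (σ ∩ V (colour v))) (v ∈? σ) (λ v∈ → proj₁ (x∈p∩q⁻ σ _ v∈)) (λ v∈ → x∈p∩q⁺ (v∈ , ∈-colour v)))
      bound : ∀ j → Σ.∑ (λ v → ⟦ v ∈? (σ ∩ V j) ⟧) ℚ.≤ 1ℚ ℚ.+ ℚ.- ⟦ j Fin.≟ i ⟧
      bound j with j Fin.≟ i
      ... | yes refl = ℚ.≤-reflexive (∑-0 λ v → ⟦⟧-no (v ∈? (σ ∩ V i)) λ v∈ →
              missing v (proj₁ (x∈p∩q⁻ σ (V i) v∈)) (colour-unique (proj₂ (x∈p∩q⁻ σ (V i) v∈))))
      ... | no _     = ℚ.≤-trans (ℚ.≤-reflexive (sym (∣p∣-∑ (σ ∩ V j)))) (ι-mono (proj₂ (proj₂ partite) face j))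

    -- Both τ and τ′ must be the facet of σ that misses the colour of v.
    extension-unique : ∀ {τ τ′ σ ρ ρ′ v} → Face σ → Face ρ → Face ρ′ →
      ∣ τ ∣ ≡ r → ∣ τ′ ∣ ≡ r → ∣ σ ∣ ≡ suc r → τ ⊆ σ → τ′ ⊆ σ → τ ⊆ ρ → τ′ ⊆ ρ′ →
      v ∈ ρ → v ∉ τ → v ∈ ρ′ → v ∉ τ′ → τ ≡ τ′
    extension-unique {τ} {τ′} {σ} {ρ} {ρ′} {v} faceσ faceρ faceρ′ ∣τ∣ ∣τ′∣ ∣σ∣ τ⊆σ τ′⊆σ τ⊆ρ τ′⊆ρ′ v∈ρ v∉τ v∈ρ′ v∉τ′
      with Vec.≡-dec Bool._≟_ τ τ′
    ... | yes τ≡τ′ = τ≡τ′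
    ... | no τ≢τ′  = ⊥-elim (rainbow faceσ ∣σ∣ (colour v) missing)
      where
      -- A vertex w of σ with the colour of v cannot lie in τ: in the face ρ it would coincide with
      -- v. Likewise for τ′, so both τ and τ′ would be the facet of σ opposite w.
      missing : ∀ w → w ∈ σ → colour w ≢ colour v
      missing w w∈σ same with w ∈? τ | w ∈? τ′
      ... | yes w∈τ | _        = v∉τ (subst (_∈ τ) (monochromatic faceρ (τ⊆ρ w∈τ) v∈ρ same) w∈τ)
      ... | no _    | yes w∈τ′ = v∉τ′ (subst (_∈ τ′) (monochromatic faceρ′ (τ′⊆ρ′ w∈τ′) v∈ρ′ same) w∈τ′)
      ... | no w∉τ  | no w∉τ′  = τ≢τ′ (facet-unique ∣τ∣ ∣τ′∣ ∣σ∣ τ⊆σ τ′⊆σ w∈σ w∉τ w∉τ′)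

  -1^n-square : ∀ n → (-1ℤ ℤ.^ n) ℤ.* (-1ℤ ℤ.^ n) ≡ 1ℤ
  -1^n-square zero    = refl
  -1^n-square (suc n) = trans (cong₂ ℤ._*_ (ℤ.-1*i≡-i (-1ℤ ℤ.^ n)) (ℤ.-1*i≡-i (-1ℤ ℤ.^ n)))
    (trans (sym (ℤ.neg-distribˡ-* x (ℤ.- x))) (trans (cong ℤ.-_ (sym (ℤ.neg-distribʳ-* x x))) (trans
      (ℤ.neg-involutive (x ℤ.* x)) (-1^n-square n))))
    where x = -1ℤ ℤ.^ n

  count-cong : ∀ {n} {P Q : Pred (Fin n) 0ℓ} (P? : Decidable P) (Q? : Decidable Q) →
    (∀ v → P v → Q v) → (∀ v → Q v → P v) → count P? ≡ count Q?
  count-cong P? Q? P⇒Q Q⇒P = ι-injective (trans (count-∑ P?)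
    (trans (∑-cong λ v → ⟦⟧-cong (P? v) (Q? v) (P⇒Q v) (Q⇒P v)) (sym (count-∑ Q?))))

  count-insert : ∀ {n} {P Q : Pred (Fin n) 0ℓ} (P? : Decidable P) (Q? : Decidable Q) a → P a → ¬ Q a →
    (∀ v → v ≢ a → P v → Q v) → (∀ v → Q v → P v) → count P? ≡ suc (count Q?)
  count-insert P? Q? a Pa ¬Qa P⇒Q Q⇒P = ι-injective (begin
    ι (count P?)
      ≡⟨ count-∑ P? ⟩
    Σ.∑ (λ v → ⟦ P? v ⟧)
      ≡⟨ ∑-cong split ⟩
    Σ.∑ (λ v → ⟦ v Fin.≟ a ⟧ ℚ.+ ⟦ Q? v ⟧)
      ≡⟨ ∑-+ (λ v → ⟦ v Fin.≟ a ⟧) _ ⟩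
    Σ.∑ (λ v → ⟦ v Fin.≟ a ⟧) ℚ.+ Σ.∑ (λ v → ⟦ Q? v ⟧)
      ≡⟨ cong₂ ℚ._+_ (trans (∑-single _ a λ l l≢a → ⟦⟧-no (l Fin.≟ a) l≢a) (⟦⟧-yes (a Fin.≟ a) refl)) (sym
        (count-∑ Q?)) ⟩
    1ℚ ℚ.+ ι (count Q?)
      ≡⟨ ι-suc (count Q?) ⟨
    ι (suc (count Q?)) ∎)
    where
    open ≡-Reasoning
    split : ∀ v → ⟦ P? v ⟧ ≡ ⟦ v Fin.≟ a ⟧ ℚ.+ ⟦ Q? v ⟧
    split v with v Fin.≟ a
    ... | yes refl = trans (⟦⟧-yes (P? a) Pa) (cong (1ℚ ℚ.+_) (sym (⟦⟧-no (Q? a) ¬Qa)))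
    ... | no v≢a   = trans (⟦⟧-cong (P? v) (Q? v) (P⇒Q v v≢a) (Q⇒P v)) (sym (ℚ.+-identityˡ ⟦ Q? v ⟧))

  -- The boundary matrix and its Gram matrix

  module Boundary {n : ℕ} {_≺_ : Rel (Fin n) 0ℓ} (≺-order : IsStrictTotalOrder _≡_ _≺_) (X : SimplicialComplex n) (r : ℕ) where
    open SimplicialComplex X
    open Laplacian X ≺-order using (incidence; upperEntry)
    open IsStrictTotalOrder ≺-order using (asym; compare) renaming (_<?_ to _≺?_)
    open Simplices X

    incidence-square : ∀ τ σ → incidence τ σ ℤ.* incidence τ σ ≡ 1ℤ
    incidence-square τ σ = -1^n-square (count λ v → (v ∈? τ) ×-dec Fin.any? (λ w → (w ∈? (τ ─ σ)) ×-dec (v ≺? w)))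

    -- τ = κ ∪ {a}, η = κ ∪ {b} and ρ = κ ∪ {a , b}.
    record Diamond (τ η ρ κ : Subset n) (a b : Fin n) : Set where
      field
        ρ⊆τ∪η : ∀ {x} → x ∈ ρ → x ∈ τ ⊎ x ∈ η
        τ⊆ρ   : τ ⊆ ρ
        η⊆ρ   : η ⊆ ρ
        τ∩η⊆κ : ∀ {x} → x ∈ τ → x ∈ η → x ∈ κ
        κ⊆τ   : κ ⊆ τ
        κ⊆η   : κ ⊆ η
        a∈τ   : a ∈ τ
        a∉η   : a ∉ η
        b∈η   : b ∈ η
        b∉τ   : b ∉ τ
        a!    : ∀ {x} → x ∈ τ → x ∉ η → x ≡ a
        b!    : ∀ {x} → x ∈ η → x ∉ τ → x ≡ b

    flip : ∀ {τ η ρ κ a b} → Diamond τ η ρ κ a b → Diamond η τ ρ κ b a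
    flip d = record
      { ρ⊆τ∪η = λ x∈ρ → Sum.swap (ρ⊆τ∪η x∈ρ) ; τ⊆ρ = η⊆ρ ; η⊆ρ = τ⊆ρ
      ; τ∩η⊆κ = λ x∈η x∈τ → τ∩η⊆κ x∈τ x∈η ; κ⊆τ = κ⊆η ; κ⊆η = κ⊆τ
      ; a∈τ = b∈η ; a∉η = b∉τ ; b∈η = a∈τ ; b∉τ = a∉η ; a! = b! ; b! = a! }
      where open Diamond d

    -- For a ≺ b, adding b before a does not change the sign of a, while adding
    -- a before b reverses the sign of b.
    diamond-≺ : ∀ {τ η ρ κ a b} → Diamond τ η ρ κ a b → a ≺ b →
      incidence ρ τ ℤ.* incidence ρ η ≡ ℤ.- (incidence τ κ ℤ.* incidence η κ)
    diamond-≺ {τ} {η} {ρ} {κ} {a} {b} d a≺b = begin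
      incidence ρ τ ℤ.* incidence ρ η               ≡⟨ cong₂ ℤ._*_ reversed unchanged ⟩
      ℤ.- incidence η κ ℤ.* incidence τ κ           ≡⟨ ℤ.neg-distribˡ-* (incidence η κ) (incidence τ κ) ⟨
      ℤ.- (incidence η κ ℤ.* incidence τ κ)         ≡⟨ cong ℤ.-_ (ℤ.*-comm (incidence η κ) (incidence τ κ)) ⟩
      ℤ.- (incidence τ κ ℤ.* incidence η κ)         ∎
      where
      open ≡-Reasoning
      open Diamond d
      before? : (τ σ : Subset n) → Decidable (λ v → v ∈ τ × ∃[ w ] (w ∈ τ ─ σ × v ≺ w))
      before? τ σ v = (v ∈? τ) ×-dec Fin.any? (λ w → (w ∈? (τ ─ σ)) ×-dec (v ≺? w))

      new-a : ∀ {w} → w ∈ ρ ─ η → w ≡ a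
      new-a {w} w∈ with ρ⊆τ∪η (x∈p─q⇒x∈p ρ η w∈)
      ... | inj₁ w∈τ = a! w∈τ (x∈p─q⇒x∉q ρ η w∈)
      ... | inj₂ w∈η = ⊥-elim (x∈p─q⇒x∉q ρ η w∈ w∈η)

      new-b : ∀ {w} → w ∈ ρ ─ τ → w ≡ b
      new-b {w} w∈ with ρ⊆τ∪η (x∈p─q⇒x∈p ρ τ w∈)
      ... | inj₁ w∈τ = ⊥-elim (x∈p─q⇒x∉q ρ τ w∈ w∈τ)
      ... | inj₂ w∈η = b! w∈η (x∈p─q⇒x∉q ρ τ w∈)

      unchanged : incidence ρ η ≡ incidence τ κ
      unchanged = cong (-1ℤ ℤ.^_) (count-cong (before? ρ η) (before? τ κ) to from)
        where
        to : ∀ v → v ∈ ρ × ∃[ w ] (w ∈ ρ ─ η × v ≺ w) → v ∈ τ × ∃[ w ] (w ∈ τ ─ κ × v ≺ w)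
        to v (v∈ρ , w , w∈ , v≺w) = v∈τ , a , x∈p∧x∉q⇒x∈p─q a∈τ (a∉η ∘ κ⊆η) , v≺a
          where
          v≺a = subst (v ≺_) (new-a w∈) v≺w
          v∈τ : v ∈ τ
          v∈τ with v ∈? τ | ρ⊆τ∪η v∈ρ
          ... | yes v∈τ | _        = v∈τ
          ... | no v∉τ  | inj₁ v∈τ = v∈τ
          ... | no v∉τ  | inj₂ v∈η = ⊥-elim (asym a≺b (subst (_≺ a) (b! v∈η v∉τ) v≺a))
        from : ∀ v → v ∈ τ × ∃[ w ] (w ∈ τ ─ κ × v ≺ w) → v ∈ ρ × ∃[ w ] (w ∈ ρ ─ η × v ≺ w)
        from v (v∈τ , w , w∈ , v≺w) = τ⊆ρ v∈τ , w ,
          x∈p∧x∉q⇒x∈p─q (τ⊆ρ w∈τ) (λ w∈η → x∈p─q⇒x∉q τ κ w∈ (τ∩η⊆κ w∈τ w∈η)) , v≺w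
          where w∈τ = x∈p─q⇒x∈p τ κ w∈

      reversed : incidence ρ τ ≡ ℤ.- incidence η κ
      reversed = trans (cong (-1ℤ ℤ.^_) (count-insert (before? ρ τ) (before? η κ) a
          (τ⊆ρ a∈τ , b , x∈p∧x∉q⇒x∈p─q (η⊆ρ b∈η) b∉τ , a≺b) (a∉η ∘ proj₁) to from))
        (ℤ.-1*i≡-i (incidence η κ))
        where
        to : ∀ v → v ≢ a → v ∈ ρ × ∃[ w ] (w ∈ ρ ─ τ × v ≺ w) → v ∈ η × ∃[ w ] (w ∈ η ─ κ × v ≺ w)
        to v v≢a (v∈ρ , w , w∈ , v≺w) = v∈η , b , x∈p∧x∉q⇒x∈p─q b∈η (b∉τ ∘ κ⊆τ) , subst (v ≺_) (new-b w∈) v≺w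
          where
          v∈η : v ∈ η
          v∈η with v ∈? η | ρ⊆τ∪η v∈ρ
          ... | yes v∈η | _        = v∈η
          ... | no v∉η  | inj₂ v∈η = v∈η
          ... | no v∉η  | inj₁ v∈τ = ⊥-elim (v≢a (a! v∈τ v∉η))
        from : ∀ v → v ∈ η × ∃[ w ] (w ∈ η ─ κ × v ≺ w) → v ∈ ρ × ∃[ w ] (w ∈ ρ ─ τ × v ≺ w)
        from v (v∈η , w , w∈ , v≺w) = η⊆ρ v∈η , w ,
          x∈p∧x∉q⇒x∈p─q (η⊆ρ w∈η) (λ w∈τ → x∈p─q⇒x∉q η κ w∈ (τ∩η⊆κ w∈τ w∈η)) , v≺w
          where w∈η = x∈p─q⇒x∈p η κ w∈

    -- The sign rule behind ∂∂ = 0: the two ways down from ρ to κ carry opposite signs. Exchanging τ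
    -- and η reduces it to a ≺ b.
    diamond : ∀ {τ η ρ κ a b} → Diamond τ η ρ κ a b →
      incidence ρ τ ℤ.* incidence ρ η ≡ ℤ.- (incidence τ κ ℤ.* incidence η κ)
    diamond {τ} {η} {ρ} {κ} {a} {b} d with compare a b
    ... | tri< a≺b _ _ = diamond-≺ d a≺b
    ... | tri≈ _ refl _ = ⊥-elim (Diamond.a∉η d (Diamond.b∈η d))
    ... | tri> _ _ b≺a = trans (ℤ.*-comm (incidence ρ τ) (incidence ρ η))
      (trans (diamond-≺ (flip d) b≺a) (cong ℤ.-_ (ℤ.*-comm (incidence η κ) (incidence τ κ))))

    union-diamond : {τ η : Subset n} → ∣ τ ∣ ≡ r → ∣ η ∣ ≡ r → suc ∣ τ ∩ η ∣ ≡ r →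
      Σ[ a ∈ Fin n ] Σ[ b ∈ Fin n ] Diamond τ η (τ ∪ η) (τ ∩ η) a b
    union-diamond {τ} {η} ∣τ∣ ∣η∣ ∣τ∩η∣ = a , b , record
      { ρ⊆τ∪η = x∈p∪q⁻ τ η
      ; τ⊆ρ = p⊆p∪q η
      ; η⊆ρ = q⊆p∪q τ η
      ; τ∩η⊆κ = λ x∈τ x∈η → x∈p∩q⁺ (x∈τ , x∈η)
      ; κ⊆τ = p∩q⊆p τ η
      ; κ⊆η = p∩q⊆q τ η
      ; a∈τ = x∈p─q⇒x∈p τ η a∈ ; a∉η = x∈p─q⇒x∉q τ η a∈
      ; b∈η = x∈p─q⇒x∈p η τ b∈ ; b∉τ = x∈p─q⇒x∉q η τ b∈
      ; a! = λ x∈τ x∉η → unique-member (τ ─ η) ∣τ─η∣ (x∈p∧x∉q⇒x∈p─q x∈τ x∉η) a∈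
      ; b! = λ x∈η x∉τ → unique-member (η ─ τ) ∣η─τ∣ (x∈p∧x∉q⇒x∈p─q x∈η x∉τ) b∈
      }
      where

      ∣τ─η∣ : ∣ τ ─ η ∣ ≡ 1
      ∣τ─η∣ = ℕ.+-cancelʳ-≡ ∣ τ ∩ η ∣ _ _ (trans (∣p─q∣+∣p∩q∣ τ η) (trans ∣τ∣ (sym ∣τ∩η∣)))
      ∣η─τ∣ : ∣ η ─ τ ∣ ≡ 1
      ∣η─τ∣ = ℕ.+-cancelʳ-≡ ∣ η ∩ τ ∣ _ _ (trans (∣p─q∣+∣p∩q∣ η τ) (trans ∣η∣ (trans (sym ∣τ∩η∣) (cong (suc ∘ ∣_∣)
        (∩-comm τ η)))))
      a = proj₁ (∣p∣≡1⇒member (τ ─ η) ∣τ─η∣)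
      a∈ = proj₂ (∣p∣≡1⇒member (τ ─ η) ∣τ─η∣)
      b = proj₁ (∣p∣≡1⇒member (η ─ τ) ∣η─τ∣)
      b∈ = proj₂ (∣p∣≡1⇒member (η ─ τ) ∣η─τ∣)

    sign : (τ σ : Subset n) → ℚ
    sign τ σ = incidence σ τ / 1

    -- The matrix of the boundary operator, with the facet as first argument to make X(r - 1) index
    -- the rows.
    boundary : (τ σ : Subset n) → ℚ
    boundary τ σ = ⟦ τ ⊆? σ ⟧ ℚ.* sign τ σ

    boundary-square : ∀ τ σ → boundary τ σ ℚ.* boundary τ σ ≡ ⟦ τ ⊆? σ ⟧
    boundary-square τ σ = begin
      ⟦ τ ⊆? σ ⟧ ℚ.* sign τ σ ℚ.* (⟦ τ ⊆? σ ⟧ ℚ.* sign τ σ)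
        ≡⟨ solve 2 (λ i s → i :* s :* (i :* s) := (i :* i) :* (s :* s)) refl ⟦ τ ⊆? σ ⟧ (sign τ σ) ⟩
      (⟦ τ ⊆? σ ⟧ ℚ.* ⟦ τ ⊆? σ ⟧) ℚ.* (sign τ σ ℚ.* sign τ σ)
        ≡⟨ cong₂ ℚ._*_ (⟦⟧-idem (τ ⊆? σ)) (trans (sym (/1-* (incidence σ τ) (incidence σ τ))) (cong (_/ 1)
          (incidence-square σ τ))) ⟩
      ⟦ τ ⊆? σ ⟧ ℚ.* 1ℚ
        ≡⟨ ℚ.*-identityʳ ⟦ τ ⊆? σ ⟧ ⟩
      ⟦ τ ⊆? σ ⟧ ∎
      where open ≡-Reasoning

    boundary-cube : ∀ τ σ → boundary τ σ ℚ.* (boundary τ σ ℚ.* boundary τ σ) ≡ boundary τ σ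
    boundary-cube τ σ = trans (cong (boundary τ σ ℚ.*_) (boundary-square τ σ))
      (trans (solve 2 (λ i s → i :* s :* i := (i :* i) :* s) refl ⟦ τ ⊆? σ ⟧ (sign τ σ)) (cong (ℚ._* sign τ σ)
        (⟦⟧-idem (τ ⊆? σ))))

    boundary-⊆ : ∀ {τ σ} → τ ⊆ σ → boundary τ σ ≡ sign τ σ
    boundary-⊆ {τ} {σ} τ⊆σ = trans (cong (ℚ._* sign τ σ) (⟦⟧-yes (τ ⊆? σ) τ⊆σ)) (ℚ.*-identityˡ (sign τ σ))

    boundary-⊈ : ∀ {τ σ} → ¬ τ ⊆ σ → boundary τ σ ≡ 0ℚ
    boundary-⊈ {τ} {σ} τ⊈σ = trans (cong (ℚ._* sign τ σ) (⟦⟧-no (τ ⊆? σ) τ⊈σ)) (ℚ.*-zeroˡ (sign τ σ))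

    boundary-term-0 : ∀ {τ η σ} → ¬ (τ ⊆ σ × η ⊆ σ) → boundary τ σ ℚ.* boundary η σ ≡ 0ℚ
    boundary-term-0 {τ} {η} {σ} ¬both = by-cases (τ ⊆? σ) (η ⊆? σ)
      where
      by-cases : Dec (τ ⊆ σ) → Dec (η ⊆ σ) → boundary τ σ ℚ.* boundary η σ ≡ 0ℚ
      by-cases (no τ⊈σ)  _         = trans (cong (ℚ._* boundary η σ) (boundary-⊈ τ⊈σ)) (ℚ.*-zeroˡ (boundary η σ))
      by-cases (yes _)   (no η⊈σ)  = trans (cong (boundary τ σ ℚ.*_) (boundary-⊈ η⊈σ)) (ℚ.*-zeroʳ (boundary τ σ))
      by-cases (yes τ⊆σ) (yes η⊆σ) = ⊥-elim (¬both (τ⊆σ , η⊆σ))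

    -- If τ ∪ η had only r vertices, τ and η would both be equal to it; with more than r it fills σ.
    common-coface : {τ η σ : Subset n} → ∣ τ ∣ ≡ r → ∣ η ∣ ≡ r → ∣ σ ∣ ≡ suc r → τ ≢ η → τ ⊆ σ → η ⊆ σ → τ ∪ η ≡ σ
    common-coface {τ} {η} {σ} ∣τ∣ ∣η∣ ∣σ∣ τ≢η τ⊆σ η⊆σ = ⊆∧≥⇒≡ (∪-least τ⊆σ η⊆σ) (subst (ℕ._≤ ∣ τ ∪ η ∣) (sym ∣σ∣)
      (ℕ.≰⇒> ¬small))
      where
      ¬small : ¬ ∣ τ ∪ η ∣ ℕ.≤ r
      ¬small small = τ≢η (trans (⊆∧≥⇒≡ (p⊆p∪q η) (subst (∣ τ ∪ η ∣ ℕ.≤_) (sym ∣τ∣) small))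
        (sym (⊆∧≥⇒≡ (q⊆p∪q τ η) (subst (∣ τ ∪ η ∣ ℕ.≤_) (sym ∣η∣) small))))

    ∣τ∪η∣+∣τ∩η∣ : (τ η : Subset n) → ∣ τ ∣ ≡ r → ∣ η ∣ ≡ r → ∣ τ ∪ η ∣ ℕ.+ ∣ τ ∩ η ∣ ≡ r ℕ.+ r
    ∣τ∪η∣+∣τ∩η∣ τ η ∣τ∣ ∣η∣ = trans (∣p∪q∣+∣p∩q∣ τ η) (cong₂ ℕ._+_ ∣τ∣ ∣η∣)

    -- The entries of L = BBᵀ. On the diagonal each coface contributes 1. Distinct τ and η have at
    -- most the coface τ ∪ η in common, and `diamond` turns its product of signs into the one in the
    -- Laplacian.
    upperEntry-gram : ∀ τ η → ∣ τ ∣ ≡ r → ∣ η ∣ ≡ r →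
      upperEntry r τ η / 1 ≡ Σ.∑ λ i → boundary τ (simplex {suc r} i) ℚ.* boundary η (simplex {suc r} i)
    upperEntry-gram τ η ∣τ∣ ∣η∣ with Vec.≡-dec Bool._≟_ τ η
    ... | yes refl = trans (deg-∑ r τ) (∑-cong λ i → sym (boundary-square τ (simplex i)))
    ... | no τ≢η with (suc ∣ τ ∩ η ∣ ℕ.≟ r) ×-dec face? (τ ∪ η)
    ...   | yes (∣τ∩η∣ , face) = sym (begin
      Σ.∑ (λ i → boundary τ (simplex i) ℚ.* boundary η (simplex i))
        ≡⟨ ∑-single _ i₀ (λ l l≢i₀ → boundary-term-0 λ (τ⊆σ , η⊆σ) → l≢i₀ (simplex-injective l i₀
             (trans (sym (common-coface ∣τ∣ ∣η∣ (simplex-size l) τ≢η τ⊆σ η⊆σ)) (sym simplex≡)))) ⟩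
      boundary τ (simplex i₀) ℚ.* boundary η (simplex i₀)
        ≡⟨ cong (λ σ → boundary τ σ ℚ.* boundary η σ) simplex≡ ⟩
      boundary τ (τ ∪ η) ℚ.* boundary η (τ ∪ η)
        ≡⟨ cong₂ ℚ._*_ (boundary-⊆ (p⊆p∪q η)) (boundary-⊆ (q⊆p∪q τ η)) ⟩
      sign τ (τ ∪ η) ℚ.* sign η (τ ∪ η)
        ≡⟨ /1-* (incidence (τ ∪ η) τ) (incidence (τ ∪ η) η) ⟨
      (incidence (τ ∪ η) τ ℤ.* incidence (τ ∪ η) η) / 1
        ≡⟨ cong (_/ 1) (diamond (proj₂ (proj₂ (union-diamond ∣τ∣ ∣η∣ ∣τ∩η∣)))) ⟩
      (ℤ.- (incidence τ (τ ∩ η) ℤ.* incidence η (τ ∩ η))) / 1 ∎)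
      where
      open ≡-Reasoning
      ∣τ∪η∣ : ∣ τ ∪ η ∣ ≡ suc r
      ∣τ∪η∣ = ℕ.+-cancelʳ-≡ ∣ τ ∩ η ∣ _ _ (trans (∣τ∪η∣+∣τ∩η∣ τ η ∣τ∣ ∣η∣)
        (trans (cong (r ℕ.+_) (sym ∣τ∩η∣)) (ℕ.+-suc r ∣ τ ∩ η ∣)))
      i₀ = proj₁ (simplex-index face ∣τ∪η∣)
      simplex≡ = proj₂ (simplex-index face ∣τ∪η∣)
    -- A common coface would be τ ∪ η, making the union a face and, by inclusion-exclusion, leaving
    -- r - 1 vertices for the intersection.
    ...   | no ¬adjacent = sym (∑-0 λ i → boundary-term-0 λ (τ⊆σ , η⊆σ) →
      let τ∪η≡σ = common-coface ∣τ∣ ∣η∣ (simplex-size i) τ≢η τ⊆σ η⊆σ in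
      ¬adjacent (ℕ.+-cancelˡ-≡ r _ _ (trans (ℕ.+-suc r ∣ τ ∩ η ∣) (trans (cong (ℕ._+ ∣ τ ∩ η ∣) (sym (trans
        (cong ∣_∣ τ∪η≡σ) (simplex-size i))))
        (∣τ∪η∣+∣τ∩η∣ τ η ∣τ∣ ∣η∣))) , subst Face (sym τ∪η≡σ) (simplex-face i)))

  ∑-≤?-min : ∀ k d → ι (k ℕ.⊓ d) ℚ.≤ Σ.∑ (λ (i : Fin k) → ⟦ suc (toℕ i) ℕ.≤? d ⟧)
  ∑-≤?-min zero    d       = ∑-nonneg {f = λ (i : Fin 0) → ⟦ suc (toℕ i) ℕ.≤? d ⟧} λ ()
  ∑-≤?-min (suc k) zero    = ∑-nonneg λ i → ⟦⟧-nonneg (suc (toℕ i) ℕ.≤? 0)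
  ∑-≤?-min (suc k) (suc d) = ℚ.≤-trans (ℚ.≤-reflexive (ι-suc (k ℕ.⊓ d)))
    (ℚ.≤-trans (ℚ.+-monoʳ-≤ 1ℚ (∑-≤?-min k d)) (ℚ.≤-reflexive (sym (trans (∑-suc _)
      (cong₂ ℚ._+_ (⟦⟧-yes (1 ℕ.≤? suc d) (s≤s z≤n))
        (∑-cong λ i → ⟦⟧-cong (suc (suc (toℕ i)) ℕ.≤? suc d) (suc (toℕ i) ℕ.≤? d) s≤s⁻¹ s≤s))))))

  -- High and low vertices, and the count by degrees

  module DegreeSplit {n : ℕ} {_≺_ : Rel (Fin n) 0ℓ} (≺-order : IsStrictTotalOrder _≡_ _≺_)
    (r : ℕ) (X : SimplicialComplex n) (partite : Partite X (suc r)) (k : ℕ) where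
    open SimplicialComplex X
    open Simplices X
    open Boundary ≺-order X r
    open Colouring {r = r} X partite

    high? : ∀ v → Dec (k ℕ.≤ degᵛ X r v)
    high? v = k ℕ.≤? degᵛ X r v

    high low : Fin n → ℚ
    high v = ⟦ high? v ⟧
    low v  = 1ℚ ℚ.- high v

    low-nonneg : ∀ v → 0ℚ ℚ.≤ low v
    low-nonneg v = 1-⟦⟧-nonneg (high? v)

    -- σ = τ ∪ {v}.
    Extends : Fin (f X r) → Fin (f X (suc r)) → Fin n → Set
    Extends τ σ v = simplex τ ⊆ simplex σ × v ∈ simplex σ ─ simplex τ

    extends? : ∀ τ σ v → Dec (Extends τ σ v)
    extends? τ σ v = (simplex τ ⊆? simplex σ) ×-dec (v ∈? (simplex σ ─ simplex τ))

    ω : Fin (f X r) → Fin (f X (suc r)) → Fin n → ℚ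
    ω τ σ v = ⟦ extends? τ σ v ⟧

    t q : Fin (f X r) → ℚ
    t τ = Σ.∑ λ σ → Σ.∑ λ v → high v ℚ.* ω τ σ v
    q τ = Σ.∑ λ σ → Σ.∑ λ v → low v ℚ.* ω τ σ v

    t-nonneg : ∀ τ → 0ℚ ℚ.≤ t τ
    t-nonneg τ = ∑-nonneg λ σ → ∑-nonneg λ v → 0≤* (⟦⟧-nonneg (high? v)) (⟦⟧-nonneg (extends? τ σ v))

    q-nonneg : ∀ τ → 0ℚ ℚ.≤ q τ
    q-nonneg τ = ∑-nonneg λ σ → ∑-nonneg λ v → 0≤* (low-nonneg v) (⟦⟧-nonneg (extends? τ σ v))

    B : Fin (f X r) → Fin (f X (suc r)) → ℚ
    B τ σ = boundary (simplex τ) (simplex σ)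

    ∑-ω : ∀ τ σ → Σ.∑ (ω τ σ) ≡ ⟦ simplex τ ⊆? simplex σ ⟧
    ∑-ω τ σ = by-cases (simplex τ ⊆? simplex σ)
      where
      by-cases : Dec (simplex τ ⊆ simplex σ) → Σ.∑ (ω τ σ) ≡ ⟦ simplex τ ⊆? simplex σ ⟧
      by-cases (yes τ⊆σ) = trans
        (∑-cong λ v → ⟦⟧-cong (extends? τ σ v) (v ∈? (simplex σ ─ simplex τ)) proj₂ (λ v∈ → (λ {x} → τ⊆σ {x}) , v∈))
        (trans (sym (∣p∣-∑ (simplex σ ─ simplex τ)))
          (trans (cong ι (facet-complement (simplex-size τ) (simplex-size σ) τ⊆σ)) (sym (⟦⟧-yes
            (simplex τ ⊆? simplex σ) τ⊆σ))))
      by-cases (no τ⊈σ) = trans (∑-0 λ v → ⟦⟧-no (extends? τ σ v) λ e → τ⊈σ (proj₁ e)) (sym (⟦⟧-no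
        (simplex τ ⊆? simplex σ) τ⊈σ))

    rows : ∀ τ → ⟨ B τ , B τ ⟩ ≡ t τ ℚ.+ q τ
    rows τ = begin
      Σ.∑ (λ σ → B τ σ ℚ.* B τ σ)
        ≡⟨ ∑-cong (λ σ → trans (boundary-square (simplex τ) (simplex σ)) (sym (∑-ω τ σ))) ⟩
      Σ.∑ (λ σ → Σ.∑ (ω τ σ))
        ≡⟨ ∑-cong (λ σ → trans (∑-cong λ v → solve 2 (λ h w → w := h :* w :+ (con 1ℚ :- h) :* w) refl (high v)
          (ω τ σ v))
             (∑-+ (λ v → high v ℚ.* ω τ σ v) _)) ⟩
      Σ.∑ (λ σ → Σ.∑ (λ v → high v ℚ.* ω τ σ v) ℚ.+ Σ.∑ (λ v → low v ℚ.* ω τ σ v))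
        ≡⟨ ∑-+ (λ σ → Σ.∑ λ v → high v ℚ.* ω τ σ v) _ ⟩
      t τ ℚ.+ q τ ∎
      where open ≡-Reasoning

    T : ℚ
    T = Σ.∑ high

    -- This is where the colours enter. The sum counts triples (τ, ρ, v) with v high, τ ⊆ σ and ρ =
    -- τ ∪ {v}; given v, `extension-unique` determines τ and then `cofacet-unique` determines ρ.
    columns : ∀ σ → Σ.∑ (λ τ → B τ σ ℚ.* B τ σ ℚ.* t τ) ℚ.≤ T
    columns σ = begin
      Σ.∑ (λ τ → B τ σ ℚ.* B τ σ ℚ.* t τ)
        ≡⟨ ∑-cong (λ τ → trans (cong (ℚ._* t τ) (boundary-square (simplex τ) (simplex σ)))
             (trans (∑-distribˡ (I τ) _) (∑-cong λ ρ → trans (∑-distribˡ (I τ) _) (∑-cong λ v → rearrange τ ρ v)))) ⟩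
      Σ.∑ (λ τ → Σ.∑ λ ρ → Σ.∑ λ v → high v ℚ.* ⟦ both? v τ ρ ⟧)
        ≡⟨ trans (∑-cong λ τ → ∑-comm (λ ρ v → high v ℚ.* ⟦ both? v τ ρ ⟧)) (∑-comm (λ τ v → Σ.∑ λ ρ
          → high v ℚ.* ⟦ both? v τ ρ ⟧)) ⟩
      Σ.∑ (λ v → Σ.∑ λ τ → Σ.∑ λ ρ → high v ℚ.* ⟦ both? v τ ρ ⟧)
        ≡⟨ ∑-cong (λ v → trans (∑-distribˡ (high v) _) (∑-cong λ τ → ∑-distribˡ (high v) _)) ⟨
      Σ.∑ (λ v → high v ℚ.* Σ.∑ λ τ → Σ.∑ λ ρ → ⟦ both? v τ ρ ⟧)
        ≤⟨ ∑-mono (λ v → ℚ.≤-trans (*-monoˡ (⟦⟧-nonneg (high? v)) (∑∑-unique (both? v) (unique v))) (ℚ.≤-reflexive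
          (ℚ.*-identityʳ (high v)))) ⟩
      T ∎
      where
      open ℚ.≤-Reasoning
      I : Fin (f X r) → ℚ
      I τ = ⟦ simplex τ ⊆? simplex σ ⟧
      Both : Fin n → Fin (f X r) → Fin (f X (suc r)) → Set
      Both v τ ρ = simplex τ ⊆ simplex σ × Extends τ ρ v
      both? : ∀ v τ ρ → Dec (Both v τ ρ)
      both? v τ ρ = (simplex τ ⊆? simplex σ) ×-dec extends? τ ρ v
      rearrange : ∀ τ ρ v → I τ ℚ.* (high v ℚ.* ω τ ρ v) ≡ high v ℚ.* ⟦ both? v τ ρ ⟧
      rearrange τ ρ v = trans (solve 3 (λ i h w → i :* (h :* w) := h :* (i :* w)) refl (I τ) (high v) (ω τ ρ v))
        (cong (high v ℚ.*_) (sym (⟦⟧-× (simplex τ ⊆? simplex σ) (extends? τ ρ v))))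
      unique : ∀ v {τ ρ τ′ ρ′} → Both v τ ρ → Both v τ′ ρ′ → τ ≡ τ′ × ρ ≡ ρ′
      unique v {τ} {ρ} {τ′} {ρ′} (τ⊆σ , τ⊆ρ , v∈) (τ′⊆σ , τ′⊆ρ′ , v∈′) = τ≡τ′ , simplex-injective ρ ρ′
          (cofacet-unique (simplex-size τ) (simplex-size ρ) (simplex-size ρ′) τ⊆ρ
            (subst (λ τ → simplex τ ⊆ simplex ρ′) (sym τ≡τ′) τ′⊆ρ′) v∈ρ v∈ρ′ v∉τ)
        where
        v∈ρ = x∈p─q⇒x∈p (simplex ρ) (simplex τ) v∈
        v∉τ = x∈p─q⇒x∉q (simplex ρ) (simplex τ) v∈
        v∈ρ′ = x∈p─q⇒x∈p (simplex ρ′) (simplex τ′) v∈′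
        v∉τ′ = x∈p─q⇒x∉q (simplex ρ′) (simplex τ′) v∈′
        τ≡τ′ : τ ≡ τ′
        τ≡τ′ = simplex-injective τ τ′ (extension-unique (simplex-face σ) (simplex-face ρ) (simplex-face ρ′)
          (simplex-size τ) (simplex-size τ′) (simplex-size σ) τ⊆σ τ′⊆σ τ⊆ρ τ′⊆ρ′ v∈ρ v∉τ v∈ρ′ v∉τ′)

    -- An r-simplex has at most one facet that avoids a given vertex v of it, so v is the added
    -- vertex of at most deg v pairs.
    ∑-q : Σ.∑ q ℚ.≤ Σ.∑ λ v → low v ℚ.* ι (degᵛ X r v)
    ∑-q = begin
      Σ.∑ (λ τ → Σ.∑ λ σ → Σ.∑ λ v → low v ℚ.* ω τ σ v)
        ≡⟨ trans (∑-cong λ τ → ∑-comm (λ σ v → low v ℚ.* ω τ σ v)) (∑-comm (λ τ v → Σ.∑ λ σ → low v ℚ.* ω τ σ v)) ⟩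
      Σ.∑ (λ v → Σ.∑ λ τ → Σ.∑ λ σ → low v ℚ.* ω τ σ v)
        ≡⟨ ∑-cong (λ v → trans (∑-distribˡ (low v) _) (∑-cong λ τ → ∑-distribˡ (low v) _)) ⟨
      Σ.∑ (λ v → low v ℚ.* Σ.∑ λ τ → Σ.∑ λ σ → ω τ σ v)
        ≤⟨ ∑-mono (λ v → *-monoˡ (low-nonneg v) (ℚ.≤-trans (ℚ.≤-reflexive (∑-comm (λ τ σ → ω τ σ v)))
             (ℚ.≤-trans (∑-mono (λ σ → facets v σ)) (ℚ.≤-reflexive (sym (deg-∑ r ⁅ v ⁆)))))) ⟩
      Σ.∑ (λ v → low v ℚ.* ι (degᵛ X r v)) ∎
      where
      open ℚ.≤-Reasoning
      facets : ∀ v σ → Σ.∑ (λ τ → ω τ σ v) ℚ.≤ ⟦ ⁅ v ⁆ ⊆? simplex σ ⟧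
      facets v σ = by-cases (v ∈? simplex σ)
        where
        by-cases : Dec (v ∈ simplex σ) → Σ.∑ (λ τ → ω τ σ v) ℚ.≤ ⟦ ⁅ v ⁆ ⊆? simplex σ ⟧
        by-cases (yes v∈σ) = ℚ.≤-trans
          (∑-unique (λ τ → extends? τ σ v) λ {τ} {τ′} (τ⊆σ , v∈) (τ′⊆σ , v∈′) → simplex-injective τ τ′
            (facet-unique (simplex-size τ) (simplex-size τ′) (simplex-size σ) τ⊆σ τ′⊆σ v∈σ
              (x∈p─q⇒x∉q (simplex σ) (simplex τ) v∈) (x∈p─q⇒x∉q (simplex σ) (simplex τ′) v∈′)))
          (ℚ.≤-reflexive (sym (⟦⟧-yes (⁅ v ⁆ ⊆? simplex σ) λ x∈ → subst (_∈ simplex σ) (sym (x∈⁅y⁆⇒x≡y v x∈)) v∈σ)))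
        by-cases (no v∉σ) = ℚ.≤-trans
          (ℚ.≤-reflexive (∑-0 λ τ → ⟦⟧-no (extends? τ σ v) λ e → v∉σ (x∈p─q⇒x∈p (simplex σ) (simplex τ) (proj₂ e))))
          (⟦⟧-nonneg (⁅ v ⁆ ⊆? simplex σ))

    conjugate : Fin k → ℕ
    conjugate i = count (λ v → suc (toℕ i) ℕ.≤? degᵛ X r v)

    -- Vertex by vertex: a high v contributes k and a low v at most its degree, that is min (k, deg
    -- v) in both cases.
    degree-bound : ι k ℚ.* T ℚ.+ Σ.∑ q ℚ.≤ Σ.∑ λ i → ι (conjugate i)
    degree-bound = begin
      ι k ℚ.* T ℚ.+ Σ.∑ q
        ≤⟨ ℚ.+-mono-≤ (ℚ.≤-reflexive (∑-distribˡ (ι k) high)) ∑-q ⟩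
      Σ.∑ (λ v → ι k ℚ.* high v) ℚ.+ Σ.∑ (λ v → low v ℚ.* ι (degᵛ X r v))
        ≡⟨ ∑-+ (λ v → ι k ℚ.* high v) _ ⟨
      Σ.∑ (λ v → ι k ℚ.* high v ℚ.+ low v ℚ.* ι (degᵛ X r v))
        ≤⟨ ∑-mono (λ v → ℚ.≤-trans (ℚ.≤-reflexive (minimum v)) (∑-≤?-min k (degᵛ X r v))) ⟩
      Σ.∑ (λ v → Σ.∑ λ i → ⟦ suc (toℕ i) ℕ.≤? degᵛ X r v ⟧)
        ≡⟨ ∑-comm (λ v (i : Fin k) → ⟦ suc (toℕ i) ℕ.≤? degᵛ X r v ⟧) ⟩
      Σ.∑ (λ i → Σ.∑ λ v → ⟦ suc (toℕ i) ℕ.≤? degᵛ X r v ⟧)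
        ≡⟨ ∑-cong (λ i → count-∑ (λ v → suc (toℕ i) ℕ.≤? degᵛ X r v)) ⟨
      Σ.∑ (λ i → ι (conjugate i)) ∎
      where
      open ℚ.≤-Reasoning
      minimum : ∀ v → ι k ℚ.* high v ℚ.+ low v ℚ.* ι (degᵛ X r v) ≡ ι (k ℕ.⊓ degᵛ X r v)
      minimum v = by-cases (high? v)
        where
        d = degᵛ X r v
        by-cases : Dec (k ℕ.≤ d) → ι k ℚ.* high v ℚ.+ low v ℚ.* ι d ≡ ι (k ℕ.⊓ d)
        by-cases (yes k≤d) = trans (cong (λ h → ι k ℚ.* h ℚ.+ (1ℚ ℚ.- h) ℚ.* ι d) (⟦⟧-yes (high? v) k≤d))
          (trans (solve 2 (λ k d → k :* con 1ℚ :+ (con 1ℚ :- con 1ℚ) :* d := k) refl (ι k) (ι d)) (cong ι (sym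
            (ℕ.m≤n⇒m⊓n≡m k≤d))))
        by-cases (no k≰d) = trans (cong (λ h → ι k ℚ.* h ℚ.+ (1ℚ ℚ.- h) ℚ.* ι d) (⟦⟧-no (high? v) k≰d))
          (trans (solve 2 (λ k d → k :* con 0ℚ :+ (con 1ℚ :- con 0ℚ) :* d := d) refl (ι k) (ι d)) (cong ι (sym
            (ℕ.m≥n⇒m⊓n≡n (ℕ.<⇒≤ (ℕ.≰⇒> k≰d))))))

open Combinatorics

-- From the spectral bound to conjugate degrees

corollary1p10 : (n : ℕ) (_≺_ : Rel (Fin n) 0ℓ) (≺-order : IsStrictTotalOrder _≡_ _≺_) →
    (r : ℕ) → 1 ℕ.≤ r →
    (X : SimplicialComplex n) → HasDimension X r → Partite X (suc r) →
    (k : ℕ) → 1 ℕ.≤ k → (k≤f : k ℕ.≤ f X r) →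
    (μ : Fin (f X r) → ℝ) → IsEigenvalueList (Laplacian.L⁺ X ≺-order r) μ →
    ∑ (λ (i : Fin k) → μ (inject≤ i k≤f))
    ≤ ∑ (λ (i : Fin k) → fromℕ (count (λ v → suc (toℕ i) ≤? degᵛ X r v)))
corollary1p10 n _≺_ ≺-order r _ X _ partite k _ k≤f μ isEigenvalueList =
  -- The right-hand side has the same rational value at every index, so the N found for the spectral
  -- bound serves unchanged.
  mk≤ λ ε 0<ε → let N , h = _≤_.bound spectral ε 0<ε in N , λ s N≤s →
    ℚ.≤-trans (h s N≤s) (ℚ.+-monoˡ-≤ ε (ℚ.≤-trans degree-bound (ℚ.≤-reflexive (≡.sym (seq-∑ _ s)))))
  where
  open DegreeSplit ≺-order r X partite k
  open Simplices X
  open Boundary ≺-order X r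
  spectral : ∑ (λ (i : Fin k) → μ (inject≤ i k≤f)) ≤ fromℚ (ι k ℚ.* T ℚ.+ Σℚ.∑ q)
  spectral = incidence-spectral-bound B (λ τ σ → boundary-cube (simplex τ) (simplex σ)) t q T t-nonneg q-nonneg
    rows columns (∑-nonneg λ v → ⟦⟧-nonneg (high? v))
    (λ i j → ≡.cong fromℚ (upperEntry-gram (simplex i) (simplex j) (simplex-size i) (simplex-size j)))
    isEigenvalueList k≤f
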